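{- Let $T$ be a tree on $n$ vertices $1,2,\ldots,n$ with $n\ge2$. Let $\lambda_1<\mu_1<\lambda_2<\cdots<\mu_{n-1}<\lambda_n$ be $2n-1$ real numbers such that $\lambda_j=-\lambda_{n+1-j}$ for all $j=1,\ldots,n$, and $\mu_k=-\mu_{n-k}$ for all $k=1,\ldots,n-1$. If $T$ is NEB at a vertex $v$, then there exists a skew-symmetric matrix $A\in S^-(T)$ with eigenvalues $\mathrm{i}\lambda_1,\mathrm{i}\lambda_2,\ldots,\mathrm{i}\lambda_n$ such that the eigenvalues of $A(v)$ are $\mathrm{i}\mu_1,\mathrm{i}\mu_2,\ldots,\mathrm{i}\mu_{n-1}$.
   Context: $\mathrm{i}=\sqrt{ -1}$. For a real skew-symmetric matrix $A=[a_{i,j}]$ of order $n$, its graph $G(A)$ has vertex set $\{1,\ldots,n\}$ and edge set $\{\{i,j\}: a_{i,j}\ne 0,\ i<j\}$. $S^-(T)$ is the set of all real skew-symmetric matrices whose graph is $T$. $A(v)$ is the principal submatrix of $A$ obtained by deleting row and column $v$. For a vertex $w$ of a tree $T$, $T(w)$ is the forest obtained by deleting $w$; for a neighbor $u$ of $w$, $T_u(w)$ is the connected component of $T(w)$ containing $u$. NEB (nearly even branching; recursive): let $T$ be a tree on $n$ vertices and $w$ a vertex of $T$. If $n=1$, $T$ is NEB at $w$. If $n\ge2$, $T$ is NEB at $w$ if (i) $T(w)$ has exactly one odd component (a connected component with an odd number of vertices) when $n$ is even, and no odd component when $n$ is odd; and (ii) for each neighbor $u$ of $w$ in $T$, $T_u(w)$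 is NEB at $u$. -}

module Defs where

open import Level using (0ℓ)
open import Algebra.Bundles using (CommutativeRing; RawRing)
import Algebra.Definitions.RawMonoid as RawMonoidDefs
open import Data.Empty using (⊥)
open import Data.Fin.Base using (Fin; punchIn; inject₁; suc; opposite)
import Data.Fin.Base as Fin
open import Data.Fin.Subset using (Subset; _∈_; _⊆_; _-_; ∣_∣; Nonempty; ⊤)
open import Data.List.Base using (List; []; _∷_; _∷ʳ_; length)
open import Data.List.Relation.Unary.Linked using (Linked)
open import Data.List.Relation.Unary.Unique.Propositional using (Unique)
open import Data.Nat.Base using (ℕ; suc; _≤_)
open import Data.Nat.Divisibility using (_∣_; _∤_)
open import Data.Product using (∃; ∃!; _×_; _,_)
open import Data.Sum.Base using (_⊎_)
open import Data.Vec.Functional using (Vector)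
open import Function.Bundles using (_⇔_)
open import Function.Definitions using (Injective)
open import Relation.Binary.Construct.Closure.ReflexiveTransitive using (Star)
open import Relation.Binary.Core using (Rel)
open import Relation.Binary.Definitions using (Symmetric; Irreflexive; Decidable)
open import Relation.Binary.PropositionalEquality.Core using (_≡_)
open import Relation.Binary.Structures using (IsStrictTotalOrder)
open import Relation.Nullary.Negation.Core using (¬_)

-- The real numbers are characterised axiomatically, as a Dedekind-complete
-- ordered field; classically this determines them up to unique isomorphism.
-- The axioms are those of classical analysis: the order is trichotomous, and
-- every nonempty bounded-above predicate has a least upper bound.
record CompleteOrderedField : Set₁ where
  field
    commutativeRing : CommutativeRing 0ℓ 0ℓ

  open CommutativeRing commutativeRing public

  infix 4 _<_ _≤ʳ_
  field
    _<_                : Rel Carrier 0ℓ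
    isStrictTotalOrder : IsStrictTotalOrder _≈_ _<_
    0<1                : 0# < 1#
    +-monoˡ-<          : ∀ z {x y} → x < y → x + z < y + z
    *-positive         : ∀ {x y} → 0# < x → 0# < y → 0# < x * y
    inverse            : ∀ x → ¬ (x ≈ 0#) → ∃ λ y → x * y ≈ 1#

  _≤ʳ_ : Rel Carrier 0ℓ
  x ≤ʳ y = x < y ⊎ x ≈ y

  IsUpperBound : (Carrier → Set) → Carrier → Set
  IsUpperBound P b = ∀ x → P x → x ≤ʳ b

  field
    supremum : (P : Carrier → Set) → ∃ P → ∃ (IsUpperBound P) →
               ∃ λ s → IsUpperBound P s × (∀ b → IsUpperBound P b → s ≤ʳ b)

record Graph (n : ℕ) : Set₁ where
  infix 4 _~_
  field
    _~_    : Rel (Fin n) 0ℓ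
    _~?_   : Decidable _~_
    sym    : Symmetric _~_
    irrefl : Irreflexive _≡_ _~_

module _ {n : ℕ} (G : Graph n) where
  open Graph G

  Connected : Set
  Connected = ∀ u v → Star _~_ u v

  -- A cycle is given by its list of at least three distinct vertices; the
  -- first vertex is appended to close the walk.
  IsCycle : List (Fin n) → Set
  IsCycle []       = ⊥
  IsCycle (x ∷ xs) =
    2 ≤ length xs × Unique (x ∷ xs) × Linked _~_ (x ∷ (xs ∷ʳ x))

  IsTree : Set
  IsTree = Connected × (∀ c → ¬ IsCycle c)

  -- Subgraphs are induced subgraphs, represented by their vertex sets.
  Adjacent-in : Subset n → Rel (Fin n) 0ℓ
  Adjacent-in S x y = x ∈ S × y ∈ S × x ~ y

  IsComponent : Subset n → Subset n → Set
  IsComponent S C =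
    Nonempty C × C ⊆ S × (∀ x → x ∈ C → ∀ y → y ∈ C ⇔ Star (Adjacent-in S) x y)

  IsOddComponent : Subset n → Subset n → Set
  IsOddComponent S C = IsComponent S C × 2 ∤ ∣ C ∣

  -- NEB-on S w : the subgraph induced on S is NEB at its vertex w.
  -- In the recursive condition C is T_u(w), the component of S - w containing u.
  data NEB-on (S : Subset n) (w : Fin n) : Set where
    single : w ∈ S → ∣ S ∣ ≡ 1 → NEB-on S w
    branch : w ∈ S → 2 ≤ ∣ S ∣ →
             (2 ∣ ∣ S ∣ → ∃! _≡_ (IsOddComponent (S - w))) →
             (2 ∤ ∣ S ∣ → ∀ C → ¬ IsOddComponent (S - w) C) →
             (∀ u → u ∈ S → w ~ u → ∀ C → IsComponent (S - w) C → u ∈ C →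
               NEB-on C u) →
             NEB-on S w

  NEB : Fin n → Set
  NEB = NEB-on ⊤

module Reals (𝓡 : CompleteOrderedField) where
  open CompleteOrderedField 𝓡 public renaming (Carrier to ℝ)

  record ℂ : Set where
    constructor _+i_
    field
      re im : ℝ

  infix 5 _+i_

  open ℂ public

  ℂ-rawRing : RawRing 0ℓ 0ℓ
  ℂ-rawRing = record
    { Carrier = ℂ
    ; _≈_     = λ z w → re z ≈ re w × im z ≈ im w
    ; _+_     = λ z w → (re z + re w) +i (im z + im w)
    ; _*_     = λ z w → (re z * re w + - (im z * im w)) +i (re z * im w + im z * re w)
    ; -_      = λ z → (- re z) +i (- im z)
    ; 0#      = 0# +i 0#
    ; 1#      = 1# +i 0#
    }

  module ℂR = RawRing ℂ-rawRing

  open RawMonoidDefs ℂR.+-rawMonoid public using () renaming (sum to ∑)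

  fromℝ : ℝ → ℂ
  fromℝ x = x +i 0#

  𝕚 : ℂ
  𝕚 = 0# +i 1#

  Matrix : ℕ → Set
  Matrix n = Fin n → Fin n → ℝ

  SkewSymmetric : ∀ {n} → Matrix n → Set
  SkewSymmetric A = ∀ i j → A i j ≈ - A j i

  -- A ∈S⁻ T : A is skew-symmetric and its graph G(A) is T.
  infix 4 _∈S⁻_
  _∈S⁻_ : ∀ {n} → Matrix n → Graph n → Set
  A ∈S⁻ T = SkewSymmetric A × (∀ i j → i Fin.< j → (i ~ j) ⇔ (¬ (A i j ≈ 0#)))
    where open Graph T

  delete : ∀ {m} → Matrix (suc m) → Fin (suc m) → Matrix m
  delete A v i j = A (punchIn v i) (punchIn v j)

  IsEigenvalue : ∀ {n} → Matrix n → ℂ → Set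
  IsEigenvalue {n} A z = ∃ λ (x : Vector ℂ n) →
    ¬ (∀ i → x i ℂR.≈ ℂR.0#) ×
    (∀ i → ∑ (λ j → fromℝ (A i j) ℂR.* x j) ℂR.≈ z ℂR.* x i)

  -- The eigenvalues of A, of order n, are the n pairwise distinct numbers σ j.
  -- Being n in number they all have multiplicity one, so this determines the
  -- spectrum as a multiset.
  HasDistinctEigenvalues : ∀ {n} → Matrix n → (Fin n → ℂ) → Set
  HasDistinctEigenvalues A σ =
    Injective _≡_ ℂR._≈_ σ ×
    (∀ z → IsEigenvalue A z ⇔ (∃ λ j → z ℂR.≈ σ j))

  Interlacing : ∀ {m} → (Fin (suc m) → ℝ) → (Fin m → ℝ) → Set
  Interlacing lam mu = ∀ k → lam (inject₁ k) < mu k × mu k < lam (suc k)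

  -- With indices counted from 0, opposite j is n - 1 - j.
  SymmetricAboutZero : ∀ {n} → (Fin n → ℝ) → Set
  SymmetricAboutZero a = ∀ j → a j ≈ - a (opposite j)

{-# OPTIONS --safe #-}
module Submission where

-- Cutting the edge between the root w and one of its neighbours u splits a
-- rooted tree into a tree s rooted at w and a branch t rooted at u, and NEB
-- says that an odd branch is only cut off from a tree of even order. If that
-- edge has weight a, the pair (f , g) of characteristic polynomials of A(w)
-- and A is given by f = f_s g_t and g = g_s g_t + a² f_s f_t.
-- Up to a factor z, the partial fractions of g / f are Σ cᵢ / (y + dᵢ) in
-- y = z², with cᵢ > 0 and distinct dᵢ ≥ 0. Hence a tree with prescribed
-- partial fractions is obtained by handing part of the sum to t: the branch
-- must satisfy g_t / (a² f_t) = 1 / Σ cᵢ / (y + dᵢ), and the zeros of the sum,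
-- which exist by the intermediate value theorem, interlace the dᵢ, so that
-- the reciprocal again has positive partial fractions. Finally, a vector
-- solving (z − A) x = 0 away from w has ((z − A) x)_w : x_w = g : f, so the
-- eigenvalues of A and A(w) are the zeros of g and f, no determinants needed.

open import Defs
open import Algebra.Bundles using (CommutativeRing)
open import Algebra.Morphism.Construct.Identity using (isRingHomomorphism)
open import Algebra.Morphism.Structures using (IsRingHomomorphism)
import Algebra.Properties.AbelianGroup as AbelianGroupProperties
import Algebra.Properties.CommutativeMonoid.Sum as CommutativeMonoidSum
import Algebra.Properties.Ring as RingProperties
import Algebra.Properties.Semiring.Mult.TCOptimised as NatMultiples
import Algebra.Properties.Semiring.Sum as SemiringSum
import Algebra.Solver.Ring as RingSolver
open import Algebra.Solver.Ring.AlmostCommutativeRing using (fromCommutativeRing; _-Raw-AlmostCommutative⟶_)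
open import Data.Bool.Base using (true; false)
open import Data.Empty using (⊥-elim)
open import Data.Fin.Base using (Fin; zero; suc; punchIn; punchOut; toℕ; fromℕ<; opposite)
import Data.Fin.Properties as Fin
open import Data.Fin.Subset as Subset using (Subset; _∈_; _∉_; _⊆_; _─_; _∪_; ⁅_⁆; ∣_∣) renaming (⊤ to full)
open import Data.Fin.Subset.Properties
import Data.Integer.Base as ℤ
import Data.Integer.Properties as ℤ
open import Data.List.Base using (List; []; _∷_; _∷ʳ_; length)
import Data.List.Membership.DecPropositional as DecMembership
open import Data.List.Membership.Propositional using () renaming (_∈_ to _∈ˡ_)
open import Data.List.Relation.Unary.All as All using (All; []; _∷_)
open import Data.List.Relation.Unary.All.Properties using (¬Any⇒All¬)
open import Data.List.Relation.Unary.AllPairs.Core using ([]; _∷_)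
open import Data.List.Relation.Unary.Any using (here; there)
open import Data.List.Relation.Unary.Linked using (Linked; [-]; _∷_)
open import Data.List.Relation.Unary.Unique.Propositional using (Unique)
open import Data.Maybe.Base using (Maybe; just; nothing)
open import Data.Nat.Base as ℕ using (ℕ; zero; suc; _≤_; _∸_; z≤n; s≤s)
open import Data.Nat.Divisibility using (_∣_; _∤_; _∣?_; ∣m∣n⇒∣m+n; ∣m+n∣m⇒∣n; n∣m*n; ∣1⇒≡1)
import Data.Nat.Properties as ℕ
open import Data.Nat.Solver using (module +-*-Solver)
open import Data.Parity.Base using (Parity; 0ℙ; 1ℙ)
open import Data.Product.Base using (∃; ∃₂; _×_; _,_; proj₁; proj₂)
import Data.Sign.Base as Sign
open import Data.Sum.Base using (_⊎_; inj₁; inj₂; [_,_]′)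
open import Data.Unit.Base using (⊤; tt)
open import Data.Vec.Base using ([]; _∷_; here; there)
open import Data.Vec.Functional using (Vector; insertAt)
open import Data.Vec.Functional.Properties using (insertAt-lookup; insertAt-punchIn)
open import Function.Base using (_∘_)
open import Function.Bundles using (_⇔_; mk⇔; module Equivalence)
open import Function.Construct.Composition using (_⇔-∘_)
open import Level using (0ℓ)
open import Relation.Binary.Construct.Closure.ReflexiveTransitive as Star using (Star; ε; _◅_; _◅◅_; reverse)
open import Relation.Binary.Definitions using (tri<; tri≈; tri>)
import Relation.Binary.PropositionalEquality as ≡
open ≡ using (_≡_; _≢_)
import Relation.Binary.Reasoning.Setoid as SetoidReasoning
open import Relation.Binary.Structures using (IsStrictTotalOrder)
open import Relation.Nullary.Decidable using (Dec; yes; no; _×-dec_; _⊎-dec_; ¬?)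
open import Relation.Nullary.Negation.Core using (¬_; contradiction)

-- What NEB is for: symmetry of the two spectra puts a zero in the middle, among the `λ` for odd
-- order and among the `μ` for even order, so the node 0 occurs in the partial fractions of `g / f`
-- exactly when the order is even. Since `g / f = g_s / f_s + a² f_t / g_t`, a branch contributes
-- poles at the zeros of `g_t`, and 0 is one of these exactly when `t` is odd. Nodes of a sum have
-- to be distinct, so an odd branch can only join a tree whose node 0 is still free, that is, one of
-- odd order. No further compatibility between the parts is required: the nodes may be dealt out
-- arbitrarily, and only their number must fit the orders. Strictness of the interlacing enters
-- twice. It makes all weights positive, so that they have real square roots as edge weights, and it
-- keeps `f` and `g` from vanishing together; at a common zero the ratio `g : f` would say nothing
-- about eigenvectors.

-- Ring solver with integer coefficients.

module IntegerCoefficients (R : CommutativeRing 0ℓ 0ℓ) where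
  open import Data.Integer.Base using (ℤ; +_; -[1+_]; _⊖_; _◃_)
  open CommutativeRing R
  open RingProperties ring using (-‿distribˡ-*; -‿distribʳ-*; -0#≈0#; -‿involutive)
  open AbelianGroupProperties +-abelianGroup using (⁻¹-∙-comm)
  open NatMultiples semiring using (×-homo-+; ×1-homo-*; 1+×) renaming (_×_ to _·_)
  open SetoidReasoning setoid

  fromℕ : ℕ → Carrier
  fromℕ n = n · 1#

  fromℤ : ℤ → Carrier
  fromℤ (+ n)    = fromℕ n
  fromℤ -[1+ n ] = - fromℕ (suc n)

  fromℤ-neg : ∀ i → fromℤ (ℤ.- i) ≈ - fromℤ i
  fromℤ-neg (+ zero)  = sym -0#≈0#
  fromℤ-neg (+ suc n) = refl
  fromℤ-neg -[1+ n ]  = sym (-‿involutive _)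

  fromℤ-⊖ : ∀ m n → fromℤ (m ⊖ n) ≈ fromℕ m + - fromℕ n
  fromℤ-⊖ m       zero    = sym (trans (+-congˡ -0#≈0#) (+-identityʳ _))
  fromℤ-⊖ zero    (suc n) = sym (+-identityˡ _)
  fromℤ-⊖ (suc m) (suc n) = begin
    fromℤ (suc m ⊖ suc n)                         ≡⟨ ≡.cong fromℤ (ℤ.[1+m]⊖[1+n]≡m⊖n m n) ⟩
    fromℤ (m ⊖ n)                                 ≈⟨ fromℤ-⊖ m n ⟩
    fromℕ m + - fromℕ n                           ≈⟨ +-congʳ (+-identityˡ _) ⟨
    0# + fromℕ m + - fromℕ n                      ≈⟨ +-congʳ (+-congʳ (-‿inverseʳ 1#)) ⟨
    1# + - 1# + fromℕ m + - fromℕ n               ≈⟨ +-congʳ (+-assoc _ _ _) ⟩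
    1# + (- 1# + fromℕ m) + - fromℕ n             ≈⟨ +-congʳ (+-congˡ (+-comm _ _)) ⟩
    1# + (fromℕ m + - 1#) + - fromℕ n             ≈⟨ +-congʳ (+-assoc _ _ _) ⟨
    1# + fromℕ m + - 1# + - fromℕ n               ≈⟨ +-assoc _ _ _ ⟩
    1# + fromℕ m + (- 1# + - fromℕ n)             ≈⟨ +-congˡ (⁻¹-∙-comm _ _) ⟩
    1# + fromℕ m + - (1# + fromℕ n)               ≈⟨ +-cong (1+× m 1#) (-‿cong (1+× n 1#)) ⟨
    fromℕ (suc m) + - fromℕ (suc n)               ∎

  fromℤ-+ : ∀ i j → fromℤ (i ℤ.+ j) ≈ fromℤ i + fromℤ j
  fromℤ-+ (+ m)    (+ n)    = ×-homo-+ 1# m n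
  fromℤ-+ (+ m)    -[1+ n ] = fromℤ-⊖ m (suc n)
  fromℤ-+ -[1+ m ] (+ n)    = trans (fromℤ-⊖ n (suc m)) (+-comm _ _)
  fromℤ-+ -[1+ m ] -[1+ n ] = begin
    - fromℕ (suc (suc (m ℕ.+ n)))         ≡⟨ ≡.cong (λ k → - fromℕ k) (≡.sym (ℕ.+-suc (suc m) n)) ⟩
    - fromℕ (suc m ℕ.+ suc n)             ≈⟨ -‿cong (×-homo-+ 1# (suc m) (suc n)) ⟩
    - (fromℕ (suc m) + fromℕ (suc n))     ≈⟨ ⁻¹-∙-comm _ _ ⟨
    - fromℕ (suc m) + - fromℕ (suc n)     ∎

  fromℤ-* : ∀ i j → fromℤ (i ℤ.* j) ≈ fromℤ i * fromℤ j
  fromℤ-* (+ m) (+ n) = begin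
    fromℤ (Sign.+ ◃ (m ℕ.* n))  ≡⟨ ≡.cong fromℤ (ℤ.+◃n≡+n (m ℕ.* n)) ⟩
    fromℕ (m ℕ.* n)             ≈⟨ ×1-homo-* m n ⟩
    fromℕ m * fromℕ n           ∎
  fromℤ-* (+ m) -[1+ n ] = begin
    fromℤ (Sign.- ◃ (m ℕ.* suc n))   ≡⟨ ≡.cong fromℤ (ℤ.-◃n≡-n (m ℕ.* suc n)) ⟩
    fromℤ (ℤ.- (+ (m ℕ.* suc n)))    ≈⟨ fromℤ-neg (+ (m ℕ.* suc n)) ⟩
    - fromℕ (m ℕ.* suc n)            ≈⟨ -‿cong (×1-homo-* m (suc n)) ⟩
    - (fromℕ m * fromℕ (suc n))      ≈⟨ -‿distribʳ-* _ _ ⟩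
    fromℕ m * - fromℕ (suc n)        ∎
  fromℤ-* -[1+ m ] (+ n) = begin
    fromℤ (Sign.- ◃ (suc m ℕ.* n))   ≡⟨ ≡.cong fromℤ (ℤ.-◃n≡-n (suc m ℕ.* n)) ⟩
    fromℤ (ℤ.- (+ (suc m ℕ.* n)))    ≈⟨ fromℤ-neg (+ (suc m ℕ.* n)) ⟩
    - fromℕ (suc m ℕ.* n)            ≈⟨ -‿cong (×1-homo-* (suc m) n) ⟩
    - (fromℕ (suc m) * fromℕ n)      ≈⟨ -‿distribˡ-* _ _ ⟩
    - fromℕ (suc m) * fromℕ n        ∎
  fromℤ-* -[1+ m ] -[1+ n ] = begin
    fromℕ (suc m ℕ.* suc n)               ≈⟨ ×1-homo-* (suc m) (suc n) ⟩
    fromℕ (suc m) * fromℕ (suc n)         ≈⟨ -‿involutive _ ⟨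
    - - (fromℕ (suc m) * fromℕ (suc n))   ≈⟨ -‿cong (-‿distribˡ-* _ _) ⟩
    - (- fromℕ (suc m) * fromℕ (suc n))   ≈⟨ -‿distribʳ-* _ _ ⟩
    - fromℕ (suc m) * - fromℕ (suc n)     ∎

  fromℤ-homomorphism : ℤ.+-*-rawRing -Raw-AlmostCommutative⟶ fromCommutativeRing R
  fromℤ-homomorphism = record
    { ⟦_⟧    = fromℤ
    ; +-homo = fromℤ-+
    ; *-homo = fromℤ-*
    ; -‿homo = fromℤ-neg
    ; 0-homo = refl
    ; 1-homo = refl
    }

  fromℤ-≟ : ∀ i j → Maybe (fromℤ i ≈ fromℤ j)
  fromℤ-≟ i j with i ℤ.≟ j
  ... | yes i≡j = just (reflexive (≡.cong fromℤ i≡j))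
  ... | no  _   = nothing

  open RingSolver ℤ.+-*-rawRing (fromCommutativeRing R) fromℤ-homomorphism fromℤ-≟ public
    using (solve; Polynomial; con; _:=_; _:+_; _:*_; :-_; _:-_)

  :0 :1 : ∀ {n} → Polynomial n
  :0 = con (+ 0)
  :1 = con (+ 1)

-- Ordered-field inequalities and the intermediate value theorem for polynomials.

module OrderedField (𝓡 : CompleteOrderedField) where
  open Reals 𝓡
  open IntegerCoefficients commutativeRing
  open IsStrictTotalOrder isStrictTotalOrder public
    using (compare; <-respˡ-≈; <-respʳ-≈)
    renaming (trans to <-trans; irrefl to <-irrefl; asym to <-asym)

  opaque
    pos-resp : ∀ {x y} → x ≈ y → 0# < x → 0# < y
    pos-resp = <-respʳ-≈

    pos⇒≉0 : ∀ {x} → 0# < x → ¬ (x ≈ 0#)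
    pos⇒≉0 0<x x≈0 = <-irrefl (sym x≈0) 0<x

    +-pos : ∀ {x y} → 0# < x → 0# < y → 0# < x + y
    +-pos {x} {y} 0<x 0<y = <-trans 0<y (<-respˡ-≈ (+-identityˡ y) (+-monoˡ-< y 0<x))

    <⇒diff-pos : ∀ {x y} → x < y → 0# < y - x
    <⇒diff-pos {x} {y} x<y = <-respˡ-≈ (-‿inverseʳ x) (+-monoˡ-< (- x) x<y)

    diff-pos⇒< : ∀ {x y} → 0# < y - x → x < y
    diff-pos⇒< {x} {y} 0<d = <-respʳ-≈ (solve 2 (λ x y → y :- x :+ x := y) refl x y)
      (<-respˡ-≈ (+-identityˡ x) (+-monoˡ-< x 0<d))

    neg-pos : ∀ {x} → x < 0# → 0# < - x
    neg-pos {x} x<0 = pos-resp (+-identityˡ (- x)) (<⇒diff-pos x<0)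

    pos-neg : ∀ {x} → 0# < x → - x < 0#
    pos-neg {x} 0<x = diff-pos⇒< (pos-resp (solve 1 (λ x → x := :0 :- (:- x)) refl x) 0<x)

    *-pos-cancelˡ : ∀ {x y} → 0# < x → 0# < x * y → 0# < y
    *-pos-cancelˡ {x} {y} 0<x 0<xy with compare 0# y
    ... | tri< 0<y _ _ = 0<y
    ... | tri≈ _ 0≈y _ = ⊥-elim (pos⇒≉0 0<xy (trans (*-congˡ (sym 0≈y)) (zeroʳ x)))
    ... | tri> _ _ y<0 = ⊥-elim (pos⇒≉0 (+-pos 0<xy (*-positive 0<x (neg-pos y<0)))
                          (solve 2 (λ x y → x :* y :+ x :* (:- y) := :0) refl x y))

    halve-pos : ∀ {x} → 0# < x + x → 0# < x
    halve-pos {x} 0<2x = *-pos-cancelˡ (+-pos 0<1 0<1)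
      (pos-resp (solve 1 (λ x → x :+ x := (:1 :+ :1) :* x) refl x) 0<2x)

    pos-inverse : ∀ {x} → 0# < x → ∃ λ y → 0# < y × x * y ≈ 1#
    pos-inverse {x} 0<x with inverse x (pos⇒≉0 0<x)
    ... | y , xy≈1 = y , *-pos-cancelˡ 0<x (pos-resp (sym xy≈1) 0<1) , xy≈1

    square-pos : ∀ {x} → ¬ (x ≈ 0#) → 0# < x * x
    square-pos {x} x≉0 with compare 0# x
    ... | tri< 0<x _ _ = *-positive 0<x 0<x
    ... | tri≈ _ 0≈x _ = ⊥-elim (x≉0 (sym 0≈x))
    ... | tri> _ _ x<0 = pos-resp (solve 1 (λ x → (:- x) :* (:- x) := x :* x) refl x)
                           (*-positive (neg-pos x<0) (neg-pos x<0))

    +-square-pos : ∀ {x} y → 0# < x → 0# < x + y * y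
    +-square-pos {x} y 0<x with compare 0# y
    ... | tri< _ 0≉y _ = +-pos 0<x (square-pos (λ y≈0 → 0≉y (sym y≈0)))
    ... | tri≈ _ 0≈y _ = pos-resp (trans (sym (+-identityʳ x)) (+-congˡ (trans (sym (zeroʳ y)) (*-congˡ 0≈y)))) 0<x
    ... | tri> _ 0≉y _ = +-pos 0<x (square-pos (λ y≈0 → 0≉y (sym y≈0)))

    *-cancel-pos : ∀ {x y} → 0# < x → x * y ≈ 0# → y ≈ 0#
    *-cancel-pos {x} {y} 0<x xy≈0 with pos-inverse 0<x
    ... | x⁻¹ , _ , xx⁻¹≈1 = begin
      y                ≈⟨ *-identityˡ y ⟨
      1# * y           ≈⟨ *-congʳ xx⁻¹≈1 ⟨
      x * x⁻¹ * y      ≈⟨ solve 3 (λ x i y → x :* i :* y := i :* (x :* y)) refl x x⁻¹ y ⟩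
      x⁻¹ * (x * y)    ≈⟨ *-congˡ xy≈0 ⟩
      x⁻¹ * 0#         ≈⟨ zeroʳ x⁻¹ ⟩
      0#               ∎
      where open SetoidReasoning setoid

  -- An inductive predicate on functions, so that continuity estimates go by induction on the way
  -- `f` is built.
  data IsPolynomial : (ℝ → ℝ) → Set where
    const : ∀ c → IsPolynomial (λ _ → c)
    id    : IsPolynomial (λ x → x)
    ⊖_    : ∀ {f} → IsPolynomial f → IsPolynomial (λ x → - f x)
    _⊕_   : ∀ {f g} → IsPolynomial f → IsPolynomial g → IsPolynomial (λ x → f x + g x)
    _⊗_   : ∀ {f g} → IsPolynomial f → IsPolynomial g → IsPolynomial (λ x → f x * g x)

  opaque
    polynomial-cong : ∀ {f} → IsPolynomial f → ∀ {x y} → x ≈ y → f x ≈ f y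
    polynomial-cong (const c) x≈y = refl
    polynomial-cong id        x≈y = x≈y
    polynomial-cong (⊖ p)     x≈y = -‿cong (polynomial-cong p x≈y)
    polynomial-cong (p ⊕ q)   x≈y = +-cong (polynomial-cong p x≈y) (polynomial-cong q x≈y)
    polynomial-cong (p ⊗ q)   x≈y = *-cong (polynomial-cong p x≈y) (polynomial-cong q x≈y)

  infix 4 ∣_∣<_
  -- The bound `|x| < b` as two positivity statements: every estimate then reduces to sums and
  -- products of positive numbers.
  ∣_∣<_ : ℝ → ℝ → Set
  ∣ x ∣< b = 0# < b + x × 0# < b - x

  opaque
    ∣+∣< : ∀ {x y b c} → ∣ x ∣< b → ∣ y ∣< c → ∣ x + y ∣< b + c
    ∣+∣< {x} {y} {b} {c} (l , u) (l′ , u′) =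
      pos-resp (solve 4 (λ x y b c → b :+ x :+ (c :+ y) := b :+ c :+ (x :+ y)) refl x y b c) (+-pos l l′) ,
      pos-resp (solve 4 (λ x y b c → b :- x :+ (c :- y) := b :+ c :- (x :+ y)) refl x y b c) (+-pos u u′)

    ∣-∣< : ∀ {x b} → ∣ x ∣< b → ∣ - x ∣< b
    ∣-∣< {x} {b} (l , u) = u , pos-resp (solve 2 (λ b x → b :+ x := b :- (:- x)) refl b x) l

    -- Each of `2 (b c + x y)` and `2 (b c - x y)` is a sum of two products of the positive factors
    -- `b ± x` and `c ± y`.
    ∣*∣< : ∀ {x y b c} → ∣ x ∣< b → ∣ y ∣< c → ∣ x * y ∣< b * c
    ∣*∣< {x} {y} {b} {c} (l , u) (l′ , u′) =
      halve-pos (pos-resp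
        (solve 4 (λ x y b c → (b :- x) :* (c :- y) :+ (b :+ x) :* (c :+ y) :=
          (b :* c :+ x :* y) :+ (b :* c :+ x :* y)) refl x y b c)
        (+-pos (*-positive u u′) (*-positive l l′))) ,
      halve-pos (pos-resp
        (solve 4 (λ x y b c → (b :- x) :* (c :+ y) :+ (b :+ x) :* (c :- y) :=
          (b :* c :- x :* y) :+ (b :* c :- x :* y)) refl x y b c)
        (+-pos (*-positive u l′) (*-positive l u′)))

    ∣x∣<1+x² : ∀ x → ∣ x ∣< 1# + x * x
    ∣x∣<1+x² x =
      halve-pos (pos-resp
        (solve 1 (λ x → :1 :+ x :* x :+ (:1 :+ x) :* (:1 :+ x) :=
          (:1 :+ x :* x :+ x) :+ (:1 :+ x :* x :+ x)) refl x)
        (+-square-pos (1# + x) (+-square-pos x 0<1))) ,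
      halve-pos (pos-resp
        (solve 1 (λ x → :1 :+ x :* x :+ (:1 :- x) :* (:1 :- x) :=
          (:1 :+ x :* x :- x) :+ (:1 :+ x :* x :- x)) refl x)
        (+-square-pos (1# - x) (+-square-pos x 0<1)))

    bound-pos : ∀ {x b} → ∣ x ∣< b → 0# < b
    bound-pos {x} {b} (l , u) = halve-pos (pos-resp
      (solve 2 (λ x b → b :+ x :+ (b :- x) := b :+ b) refl x b) (+-pos l u))

  LocallyBounded : (ℝ → ℝ) → Set
  LocallyBounded u = ∃ λ b → ∀ h → ∣ h ∣< 1# → ∣ u h ∣< b

  opaque
    const-bounded : ∀ c → LocallyBounded (λ _ → c)
    const-bounded c = 1# + c * c , λ _ _ → ∣x∣<1+x² c

    neg-bounded : ∀ {u} → LocallyBounded u → LocallyBounded (λ h → - u h)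
    neg-bounded (b , u<b) = b , λ h h<1 → ∣-∣< (u<b h h<1)

    +-bounded : ∀ {u v} → LocallyBounded u → LocallyBounded v → LocallyBounded (λ h → u h + v h)
    +-bounded (b , u<b) (c , v<c) = b + c , λ h h<1 → ∣+∣< (u<b h h<1) (v<c h h<1)

    *-bounded : ∀ {u v} → LocallyBounded u → LocallyBounded v → LocallyBounded (λ h → u h * v h)
    *-bounded (b , u<b) (c , v<c) = b * c , λ h h<1 → ∣*∣< (u<b h h<1) (v<c h h<1)

  -- The form of continuity at `s` that is used: a difference quotient `u` bounded for `|h| < 1`. It
  -- passes through sums and products with an explicit quotient and bound.
  HasBoundedSlope : (ℝ → ℝ) → ℝ → Set
  HasBoundedSlope f s = ∃ λ (u : ℝ → ℝ) → (∀ h → f (s + h) ≈ f s + h * u h) × LocallyBounded u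

  opaque
    polynomial-slope : ∀ {f} → IsPolynomial f → ∀ s → HasBoundedSlope f s
    polynomial-slope (const c) s = (λ _ → 0#) ,
      (λ h → sym (trans (+-congˡ (zeroʳ h)) (+-identityʳ c))) , const-bounded 0#
    polynomial-slope id s = (λ _ → 1#) , (λ h → +-congˡ (sym (*-identityʳ h))) , const-bounded 1#
    polynomial-slope (⊖_ {f} p) s with polynomial-slope p s
    ... | u , fs , bu = (λ h → - u h) ,
      (λ h → trans (-‿cong (fs h))
        (solve 3 (λ a h u → :- (a :+ h :* u) := :- a :+ h :* (:- u)) refl (f s) h (u h))) ,
      neg-bounded bu
    polynomial-slope (_⊕_ {f} {g} p q) s with polynomial-slope p s | polynomial-slope q s
    ... | u , fs , bu | v , gs , bv = (λ h → u h + v h) ,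
      (λ h → trans (+-cong (fs h) (gs h))
        (solve 5 (λ a b h u v → a :+ h :* u :+ (b :+ h :* v) := a :+ b :+ h :* (u :+ v))
          refl (f s) (g s) h (u h) (v h))) ,
      +-bounded bu bv
    polynomial-slope (_⊗_ {f} {g} p q) s with polynomial-slope p s | polynomial-slope q s
    ... | u , fs , bu | v , gs , bv = (λ h → f s * v h + (g s * u h + h * (u h * v h))) ,
      (λ h → trans (*-cong (fs h) (gs h))
        (solve 5 (λ a b h u v → (a :+ h :* u) :* (b :+ h :* v) :=
                   a :* b :+ h :* (a :* v :+ (b :* u :+ h :* (u :* v))))
          refl (f s) (g s) h (u h) (v h))) ,
      +-bounded (*-bounded (const-bounded (f s)) bv)
        (+-bounded (*-bounded (const-bounded (g s)) bu)
          (*-bounded (1# , λ _ h<1 → h<1) (*-bounded bu bv)))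

  opaque
    -- Stands in for a minimum: the witness `x y / (x + y)` differs from `x` and `y` by
    -- `x² / (x + y)` and `y² / (x + y)`.
    common-lower-bound : ∀ {x y} → 0# < x → 0# < y → ∃ λ h → 0# < h × 0# < x - h × 0# < y - h
    common-lower-bound {x} {y} 0<x 0<y with pos-inverse (+-pos 0<x 0<y)
    ... | r , 0<r , r-inv = x * y * r , *-positive (*-positive 0<x 0<y) 0<r ,
      pos-resp
        (trans (solve 3 (λ x y r → x :* x :* r := x :* ((x :+ y) :* r) :- x :* y :* r) refl x y r)
          (+-congʳ (trans (*-congˡ r-inv) (*-identityʳ x))))
        (*-positive (*-positive 0<x 0<x) 0<r) ,
      pos-resp
        (trans (solve 3 (λ x y r → y :* y :* r := y :* ((x :+ y) :* r) :- x :* y :* r) refl x y r)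
          (+-congʳ (trans (*-congˡ r-inv) (*-identityʳ y))))
        (*-positive (*-positive 0<y 0<y) 0<r)

  opaque
    ∣0∣<1 : ∣ 0# ∣< 1#
    ∣0∣<1 = pos-resp (sym (+-identityʳ 1#)) 0<1 , pos-resp (solve 0 (:1 := :1 :- :0) refl) 0<1

  opaque
    ∣∣<-weaken : ∀ {h b c} → 0# < c - b → ∣ h ∣< b → ∣ h ∣< c
    ∣∣<-weaken {h} {b} {c} b<c (l , m) =
      pos-resp (solve 3 (λ b c h → b :+ h :+ (c :- b) := c :+ h) refl b c h) (+-pos l b<c) ,
      pos-resp (solve 3 (λ b c h → b :- h :+ (c :- b) := c :- h) refl b c h) (+-pos m b<c)

  opaque
    scaled-bound : ∀ {a b r δ} → 0# < b → b * r ≈ 1# → 0# < a * r - δ → 0# < a - δ * b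
    scaled-bound {a} {b} {r} {δ} 0<b br≈1 δ<ar = pos-resp eq (*-positive 0<b δ<ar)
      where
      eq : b * (a * r - δ) ≈ a - δ * b
      eq = trans (solve 4 (λ a b r d → b :* (a :* r :- d) := a :* (b :* r) :- d :* b) refl a b r δ)
          (+-congʳ (trans (*-congˡ br≈1) (*-identityʳ a)))

  opaque
    +-∣∣<-pos : ∀ {a b x} → ∣ x ∣< b → 0# < a - b → 0# < a + x
    +-∣∣<-pos {a} {b} {x} (l , _) b<a =
      pos-resp (solve 3 (λ a b x → (b :+ x) :+ (a :- b) := a :+ x) refl a b x) (+-pos l b<a)

  opaque
    polynomial-pos-near : ∀ {f} → IsPolynomial f → ∀ s → 0# < f s →
      ∃ λ δ → 0# < δ × (∀ h → ∣ h ∣< δ → 0# < f (s + h))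
    polynomial-pos-near {f} p s 0<fs with polynomial-slope p s
    ... | u , fs , b , u<b with bound-pos (u<b 0# ∣0∣<1)
    ...   | 0<b with pos-inverse 0<b
    -- `δ` lies below 1, where the slope bound `b` is valid, and below `f s / b`, so that the
    -- increment `h * u h` stays below `f s` in absolute value.
    ...     | r , 0<r , br≈1 with common-lower-bound 0<1 (*-positive 0<fs 0<r)
    ...       | δ , 0<δ , δ<1 , δ<fs/b = δ , 0<δ , near
      where
      near : ∀ h → ∣ h ∣< δ → 0# < f (s + h)
      near h ∣h∣<δ = pos-resp (sym (fs h))
        (+-∣∣<-pos {f s} {δ * b} {h * u h} (∣*∣< {h} {u h} {δ} {b} ∣h∣<δ (u<b h (∣∣<-weaken {h} {δ} δ<1 ∣h∣<δ)))
           (scaled-bound 0<b br≈1 δ<fs/b))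

  opaque
    polynomial-pos-right : ∀ {f} → IsPolynomial f → ∀ {s b} → s < b → 0# < f s →
      ∃ λ x → s < x × x < b × 0# < f x
    polynomial-pos-right p {s} {b} s<b 0<fs with polynomial-pos-near p s 0<fs
    ... | δ , 0<δ , near with common-lower-bound 0<δ (<⇒diff-pos s<b)
    ...   | h , 0<h , h<δ , h<b-s = s + h ,
      diff-pos⇒< (pos-resp (solve 2 (λ s h → h := s :+ h :- s) refl s h) 0<h) ,
      diff-pos⇒< (pos-resp (solve 3 (λ b s h → b :- s :- h := b :- (s :+ h)) refl b s h) h<b-s) ,
      near h (+-pos 0<δ 0<h , h<δ)

  opaque
    polynomial-neg-left : ∀ {f} → IsPolynomial f → ∀ s → f s < 0# →
      ∃ λ t → t < s × (∀ x → t < x → x ≤ʳ s → f x < 0#)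
    polynomial-neg-left {f} p s fs<0 with polynomial-pos-near (⊖ p) s (neg-pos fs<0)
    ... | δ , 0<δ , near = s - δ ,
      diff-pos⇒< (pos-resp (solve 2 (λ s d → d := s :- (s :- d)) refl s δ) 0<δ) , neg
      where
      δ-h : ∀ x → x ≤ʳ s → 0# < δ - (x - s)
      δ-h x (inj₁ x<s) = pos-resp (solve 3 (λ x s d → d :+ (s :- x) := d :- (x :- s)) refl x s δ)
                           (+-pos 0<δ (<⇒diff-pos x<s))
      δ-h x (inj₂ x≈s) = pos-resp (sym (trans (+-congˡ (-‿cong (trans (+-congʳ x≈s) (-‿inverseʳ s))))
                           (solve 1 (λ d → d :- :0 := d) refl δ))) 0<δ
      neg : ∀ x → s - δ < x → x ≤ʳ s → f x < 0#
      neg x s-δ<x x≤s = diff-pos⇒< (pos-resp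
        (trans (-‿cong (polynomial-cong p (solve 2 (λ x s → s :+ (x :- s) := x) refl x s)))
          (sym (+-identityˡ _)))
        (near (x - s)
          (pos-resp (solve 3 (λ x s d → x :- (s :- d) := d :+ (x :- s)) refl x s δ) (<⇒diff-pos s-δ<x) ,
           δ-h x x≤s)))

  opaque
    <⇒≱ : ∀ {x y} → x < y → ¬ (y ≤ʳ x)
    <⇒≱ x<y (inj₁ y<x) = <-asym x<y y<x
    <⇒≱ x<y (inj₂ y≈x) = <-irrefl (sym y≈x) x<y

  opaque
    -- Let `s` be the supremum of the points below `b` with positive value. A positive value at `s`
    -- would persist to the right, and a negative one would hold already on an interval to the left;
    -- either contradicts the choice of `s`.
    intermediate-value : ∀ {f} → IsPolynomial f → ∀ {a b} → a < b → 0# < f a → f b < 0# →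
      ∃ λ c → a < c × c < b × f c ≈ 0#
    intermediate-value {f} p {a} {b} a<b 0<fa fb<0 with
      supremum (λ x → x < b × 0# < f x) (a , a<b , 0<fa) (b , λ x (x<b , _) → inj₁ x<b)
    ... | s , upper , least = s , a<s , s<b , fs≈0
      where
      s≤b : s ≤ʳ b
      s≤b = least b (λ x (x<b , _) → inj₁ x<b)

      fs≯0 : ¬ (0# < f s)
      fs≯0 0<fs with s≤b
      ... | inj₂ s≈b = <-asym (pos-resp (polynomial-cong p s≈b) 0<fs) fb<0
      ... | inj₁ s<b with polynomial-pos-right p s<b 0<fs
      ...   | x , s<x , x<b , 0<fx = <⇒≱ s<x (upper x (x<b , 0<fx))

      fs≮0 : ¬ (f s < 0#)
      fs≮0 fs<0 with polynomial-neg-left p s fs<0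
      ... | t , t<s , neg = <⇒≱ t<s (least t t-upper)
        where
        t-upper : IsUpperBound (λ x → x < b × 0# < f x) t
        t-upper x (x<b , 0<fx) with compare x t
        ... | tri< x<t _ _ = inj₁ x<t
        ... | tri≈ _ x≈t _ = inj₂ x≈t
        ... | tri> _ _ t<x = ⊥-elim (<-asym 0<fx (neg x t<x (upper x (x<b , 0<fx))))

      fs≈0 : f s ≈ 0#
      fs≈0 with compare 0# (f s)
      ... | tri< 0<fs _ _ = ⊥-elim (fs≯0 0<fs)
      ... | tri≈ _ 0≈fs _ = sym 0≈fs
      ... | tri> _ _ fs<0 = ⊥-elim (fs≮0 fs<0)

      a<s : a < s
      a<s with upper a (a<b , 0<fa)
      ... | inj₁ a<s = a<s
      ... | inj₂ a≈s = ⊥-elim (fs≯0 (pos-resp (polynomial-cong p a≈s) 0<fa))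

      s<b : s < b
      s<b with s≤b
      ... | inj₁ s<b = s<b
      ... | inj₂ s≈b = ⊥-elim (fs≮0 (<-respˡ-≈ (sym (polynomial-cong p s≈b)) fb<0))

  opaque
    pos-sqrt : ∀ {x} → 0# < x → ∃ λ r → 0# < r × r * r ≈ x
    pos-sqrt {x} 0<x with
      -- `x - r²` changes sign between 0 and `x + 1`, because `(x + 1)² - x = x + 1 + x²` is
      -- positive.
      intermediate-value (const x ⊕ (⊖ (id ⊗ id))) {0#} {x + 1#} (+-pos 0<x 0<1)
        (pos-resp (solve 1 (λ x → x := x :+ (:- (:0 :* :0))) refl x) 0<x)
        (diff-pos⇒< (pos-resp
          (solve 1 (λ x → x :+ :1 :+ x :* x := :0 :- (x :+ (:- ((x :+ :1) :* (x :+ :1))))) refl x)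
          (+-square-pos x (+-pos 0<x 0<1))))
    ... | r , 0<r , _ , root = r , 0<r , trans
      (solve 2 (λ x r → r :* r := x :- (x :+ (:- (r :* r)))) refl x r)
      (trans (+-congˡ (-‿cong root)) (solve 1 (λ x → x :- :0 := x) refl x))

-- The complex numbers as a field.

module ComplexField (𝓡 : CompleteOrderedField) where
  open Reals 𝓡
  open OrderedField 𝓡
  open IntegerCoefficients commutativeRing

  ℂ-commutativeRing : CommutativeRing 0ℓ 0ℓ
  ℂ-commutativeRing = record
    { Carrier = ℂ
    ; _≈_     = ℂR._≈_
    ; _+_     = ℂR._+_
    ; _*_     = ℂR._*_
    ; -_      = ℂR.-_
    ; 0#      = ℂR.0#
    ; 1#      = ℂR.1#
    ; isCommutativeRing = record
      { isRing = record
        { +-isAbelianGroup = record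
          { isGroup = record
            { isMonoid = record
              { isSemigroup = record
                { isMagma = record
                  { isEquivalence = record
                    { refl  = refl , refl
                    ; sym   = λ (p , q) → sym p , sym q
                    ; trans = λ (p , q) (p′ , q′) → trans p p′ , trans q q′
                    }
                  ; ∙-cong = λ (p , q) (p′ , q′) → +-cong p p′ , +-cong q q′
                  }
                ; assoc = λ _ _ _ → +-assoc _ _ _ , +-assoc _ _ _
                }
              ; identity = (λ _ → +-identityˡ _ , +-identityˡ _) , (λ _ → +-identityʳ _ , +-identityʳ _)
              }
            ; inverse = (λ _ → -‿inverseˡ _ , -‿inverseˡ _) , (λ _ → -‿inverseʳ _ , -‿inverseʳ _)
            ; ⁻¹-cong = λ (p , q) → -‿cong p , -‿cong q
            }
          ; comm = λ _ _ → +-comm _ _ , +-comm _ _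
          }
        ; *-cong = λ (p , q) (p′ , q′) → +-cong (*-cong p p′) (-‿cong (*-cong q q′)) ,
                                         +-cong (*-cong p q′) (*-cong q p′)
        ; *-assoc = λ (a +i b) (c +i d) (e +i f) →
            solve 6 (λ a b c d e f →
              (a :* c :+ :- (b :* d)) :* e :+ :- ((a :* d :+ b :* c) :* f) :=
              a :* (c :* e :+ :- (d :* f)) :+ :- (b :* (c :* f :+ d :* e))) refl a b c d e f ,
            solve 6 (λ a b c d e f →
              (a :* c :+ :- (b :* d)) :* f :+ (a :* d :+ b :* c) :* e :=
              a :* (c :* f :+ d :* e) :+ b :* (c :* e :+ :- (d :* f))) refl a b c d e f
        ; *-identity =
            (λ (a +i b) → solve 2 (λ a b → :1 :* a :+ :- (:0 :* b) := a) refl a b ,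
                          solve 2 (λ a b → :1 :* b :+ :0 :* a := b) refl a b) ,
            (λ (a +i b) → solve 2 (λ a b → a :* :1 :+ :- (b :* :0) := a) refl a b ,
                          solve 2 (λ a b → a :* :0 :+ b :* :1 := b) refl a b)
        ; distrib =
            (λ (a +i b) (c +i d) (e +i f) →
              solve 6 (λ a b c d e f → a :* (c :+ e) :+ :- (b :* (d :+ f)) :=
                (a :* c :+ :- (b :* d)) :+ (a :* e :+ :- (b :* f))) refl a b c d e f ,
              solve 6 (λ a b c d e f → a :* (d :+ f) :+ b :* (c :+ e) :=
                (a :* d :+ b :* c) :+ (a :* f :+ b :* e)) refl a b c d e f) ,
            (λ (a +i b) (c +i d) (e +i f) →
              solve 6 (λ a b c d e f → (c :+ e) :* a :+ :- ((d :+ f) :* b) :=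
                (c :* a :+ :- (d :* b)) :+ (e :* a :+ :- (f :* b))) refl a b c d e f ,
              solve 6 (λ a b c d e f → (c :+ e) :* b :+ (d :+ f) :* a :=
                (c :* b :+ d :* a) :+ (e :* b :+ f :* a)) refl a b c d e f)
        }
      ; *-comm = λ (a +i b) (c +i d) →
          solve 4 (λ a b c d → a :* c :+ :- (b :* d) := c :* a :+ :- (d :* b)) refl a b c d ,
          solve 4 (λ a b c d → a :* d :+ b :* c := c :* b :+ d :* a) refl a b c d
      }
    }

  fromℝ-homomorphism : IsRingHomomorphism (CommutativeRing.rawRing commutativeRing) ℂ-rawRing fromℝ
  fromℝ-homomorphism = record
    { isSemiringHomomorphism = record
      { isNearSemiringHomomorphism = record
        { +-isMonoidHomomorphism = record
          { isMagmaHomomorphism = record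
            { isRelHomomorphism = record { cong = λ p → p , refl }
            ; homo = λ _ _ → refl , sym (+-identityˡ 0#)
            }
          ; ε-homo = refl , refl
          }
        ; *-homo = λ x y →
            solve 2 (λ x y → x :* y := x :* y :+ :- (:0 :* :0)) refl x y ,
            solve 2 (λ x y → :0 := x :* :0 :+ :0 :* y) refl x y
        }
      ; 1#-homo = refl , refl
      }
    ; -‿homo = λ x → refl , solve 0 (:0 := :- :0) refl
    }

  ℂ-≈0? : ∀ z → Dec (z ℂR.≈ ℂR.0#)
  ℂ-≈0? (a +i b) with compare a 0# | compare b 0#
  ... | tri≈ _ a≈0 _ | tri≈ _ b≈0 _ = yes (a≈0 , b≈0)
  ... | tri< _ a≉0 _ | _ = no (λ (a≈0 , _) → a≉0 a≈0)
  ... | tri> _ a≉0 _ | _ = no (λ (a≈0 , _) → a≉0 a≈0)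
  ... | _ | tri< _ b≉0 _ = no (λ (_ , b≈0) → b≉0 b≈0)
  ... | _ | tri> _ b≉0 _ = no (λ (_ , b≈0) → b≉0 b≈0)

  opaque
    norm-pos : ∀ a b → ¬ (a +i b ℂR.≈ ℂR.0#) → 0# < a * a + b * b
    norm-pos a b z≉0 with compare a 0# | compare b 0#
    ... | tri< _ a≉0 _ | _ = +-square-pos b (square-pos a≉0)
    ... | tri> _ a≉0 _ | _ = +-square-pos b (square-pos a≉0)
    ... | tri≈ _ a≈0 _ | tri≈ _ b≈0 _ = ⊥-elim (z≉0 (a≈0 , b≈0))
    ... | _ | tri< _ b≉0 _ = pos-resp (+-comm _ _) (+-square-pos a (square-pos b≉0))
    ... | _ | tri> _ b≉0 _ = pos-resp (+-comm _ _) (+-square-pos a (square-pos b≉0))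

  opaque
    -- Multiplying z w = 0 by the conjugate of z gives |z|² w = 0.
    ℂ-*-cancelˡ : ∀ z w → ¬ (z ℂR.≈ ℂR.0#) → z ℂR.* w ℂR.≈ ℂR.0# → w ℂR.≈ ℂR.0#
    ℂ-*-cancelˡ (a +i b) (c +i d) z≉0 (p , q) =
      *-cancel-pos 0<|z|² (trans
        (solve 4 (λ a b c d → (a :* a :+ b :* b) :* c :=
          a :* (a :* c :+ :- (b :* d)) :+ b :* (a :* d :+ b :* c)) refl a b c d)
        (trans (+-cong (*-congˡ p) (*-congˡ q)) (solve 2 (λ a b → a :* :0 :+ b :* :0 := :0) refl a b))) ,
      *-cancel-pos 0<|z|² (trans
        (solve 4 (λ a b c d → (a :* a :+ b :* b) :* d :=
          a :* (a :* d :+ b :* c) :- b :* (a :* c :+ :- (b :* d))) refl a b c d)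
        (trans (+-cong (*-congˡ q) (-‿cong (*-congˡ p))) (solve 2 (λ a b → a :* :0 :- b :* :0 := :0) refl a b)))
      where
      0<|z|² : 0# < a * a + b * b
      0<|z|² = norm-pos a b z≉0

  opaque
    ℂ-*-zero : ∀ z w → z ℂR.* w ℂR.≈ ℂR.0# → z ℂR.≈ ℂR.0# ⊎ w ℂR.≈ ℂR.0#
    ℂ-*-zero z w zw≈0 with ℂ-≈0? z
    ... | yes z≈0 = inj₁ z≈0
    ... | no  z≉0 = inj₂ (ℂ-*-cancelˡ z w z≉0 zw≈0)

-- Partial fractions with positive weights.

module PartialFractions (𝓡 : CompleteOrderedField) where
  open Reals 𝓡
  open OrderedField 𝓡

  -- Atoms lo k stands for the rational function Σᵢ cᵢ / (y + dᵢ) with k nodes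
  -- lo < d₁ < ... < d_k and positive weights cᵢ.
  data Atoms (lo : ℝ) : ℕ → Set where
    []   : Atoms lo 0
    cons : ∀ {k} d c → lo < d → 0# < c → Atoms d k → Atoms lo (suc k)

  weaken : ∀ {lo lo′ k} → lo′ < lo → Atoms lo k → Atoms lo′ k
  weaken lo′<lo []                    = []
  weaken lo′<lo (cons d c lo<d 0<c M) = cons d c (<-trans lo′<lo lo<d) 0<c M

  splitAtoms : ∀ {lo} k {l} → Atoms lo (k ℕ.+ l) → Atoms lo k × Atoms lo l
  splitAtoms zero    M = [] , M
  splitAtoms (suc k) (cons d c lo<d 0<c M) with splitAtoms k M
  ... | M₁ , M₂ = cons d c lo<d 0<c M₁ , weaken lo<d M₂

  ≤-<-trans : ∀ {x y z} → x ≤ʳ y → y < z → x < z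
  ≤-<-trans (inj₁ x<y) y<z = <-trans x<y y<z
  ≤-<-trans (inj₂ x≈y) y<z = <-respˡ-≈ (sym x≈y) y<z

  gap-pos : ∀ {x lo d} → x ≤ʳ lo → lo < d → 0# < d - x
  gap-pos x≤lo lo<d = <⇒diff-pos (≤-<-trans x≤lo lo<d)

  module _ {β lo d} (β≤lo : β ≤ʳ lo) (lo<d : lo < d) where
    gap⁻¹ : ℝ
    gap⁻¹ = proj₁ (pos-inverse (gap-pos β≤lo lo<d))

    gap⁻¹-pos : 0# < gap⁻¹
    gap⁻¹-pos = proj₁ (proj₂ (pos-inverse (gap-pos β≤lo lo<d)))

    gap-inverse : (d - β) * gap⁻¹ ≈ 1#
    gap-inverse = proj₂ (proj₂ (pos-inverse (gap-pos β≤lo lo<d)))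

  weight-factor : ∀ {β lo d} c (β≤lo : β ≤ʳ lo) (lo<d : lo < d) → c ≈ c * gap⁻¹ β≤lo lo<d * (d - β)
  weight-factor c β≤lo lo<d = sym (trans (*-assoc _ _ _)
    (trans (*-congˡ (trans (*-comm _ _) (gap-inverse β≤lo lo<d))) (*-identityʳ c)))

  -- Multiplies each weight by (d − α) / (d − β), that is, multiplies the
  -- rational function by (y + α) / (y + β) and drops the pole at − β.
  reweight : ∀ {lo k α β} → α ≤ʳ lo → β ≤ʳ lo → Atoms lo k → Atoms lo k
  reweight α≤lo β≤lo [] = []
  reweight {α = α} {β} α≤lo β≤lo (cons d c lo<d 0<c M) =
    cons d (c * gap⁻¹ β≤lo lo<d * (d - α)) lo<d
      (*-positive (*-positive 0<c (gap⁻¹-pos β≤lo lo<d)) (gap-pos α≤lo lo<d))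
      (reweight (inj₁ (≤-<-trans α≤lo lo<d)) (inj₁ (≤-<-trans β≤lo lo<d)) M)

  -- The residue Σᵢ cᵢ / (dᵢ − β) at the dropped pole.
  residue : ∀ {lo k β} → β ≤ʳ lo → Atoms lo k → ℝ
  residue β≤lo [] = 0#
  residue β≤lo (cons d c lo<d 0<c M) =
    c * gap⁻¹ β≤lo lo<d + residue (inj₁ (≤-<-trans β≤lo lo<d)) M

  opaque
    -- The residue of no atoms is 0, so a positive summand `x` is carried in front and absorbs the
    -- terms one by one.
    +-residue-pos : ∀ {lo k β x} (β≤lo : β ≤ʳ lo) (M : Atoms lo k) → 0# < x → 0# < x + residue β≤lo M
    +-residue-pos β≤lo [] 0<x = pos-resp (sym (+-identityʳ _)) 0<x
    +-residue-pos β≤lo (cons d c lo<d 0<c M) 0<x = pos-resp (+-assoc _ _ _)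
      (+-residue-pos _ M (+-pos 0<x (*-positive 0<c (gap⁻¹-pos β≤lo lo<d))))

  -- The product form of these functions: `e` and `b` alternate above `lo`, and
  -- `Π (y + b) / Π (y + e)` is 1 plus partial fractions with the nodes `e`.
  data Interlaced (lo : ℝ) : ℕ → Set where
    []   : Interlaced lo 0
    cons : ∀ {k} e b → lo < e → e < b → Interlaced b k → Interlaced lo (suc k)

  -- Rational functions are present only through their values, so each identity is proved over any
  -- commutative ring that receives the reals: real points serve to locate zeros, complex points to
  -- find eigenvalues.
  module Evaluation
    (K : CommutativeRing 0ℓ 0ℓ) (ι : ℝ → CommutativeRing.Carrier K)
    (ι-hom : IsRingHomomorphism (CommutativeRing.rawRing commutativeRing) (CommutativeRing.rawRing K) ι)
    where
    private
      module K = CommutativeRing K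
      module S = IntegerCoefficients K
      module ι = IsRingHomomorphism ι-hom
      open S using (_:=_; _:+_; _:*_; :-_; _:-_; :0; :1)
      open SetoidReasoning K.setoid

    denominator : ∀ {lo k} → Atoms lo k → K.Carrier → K.Carrier
    denominator []             y = K.1#
    denominator (cons d c _ _ M) y = (y K.+ ι d) K.* denominator M y

    numerator : ∀ {lo k} → Atoms lo k → K.Carrier → K.Carrier
    numerator []             y = K.0#
    numerator (cons d c _ _ M) y = ι c K.* denominator M y K.+ (y K.+ ι d) K.* numerator M y

    lowerProduct : ∀ {lo k} → Interlaced lo k → K.Carrier → K.Carrier
    lowerProduct []               y = K.1#
    lowerProduct (cons e b _ _ I) y = (y K.+ ι e) K.* lowerProduct I y

    upperProduct : ∀ {lo k} → Interlaced lo k → K.Carrier → K.Carrier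
    upperProduct []               y = K.1#
    upperProduct (cons e b _ _ I) y = (y K.+ ι b) K.* upperProduct I y

    denominator-weaken : ∀ {lo lo′ k} (lt : lo′ < lo) (M : Atoms lo k) y →
      denominator (weaken lt M) y K.≈ denominator M y
    denominator-weaken lt []             y = K.refl
    denominator-weaken lt (cons _ _ _ _ M) y = K.refl

    numerator-weaken : ∀ {lo lo′ k} (lt : lo′ < lo) (M : Atoms lo k) y →
      numerator (weaken lt M) y K.≈ numerator M y
    numerator-weaken lt []             y = K.refl
    numerator-weaken lt (cons _ _ _ _ M) y = K.refl

    private
      opaque
        split-step : ∀ c u p₁ p₂ q₁ q₂ →
          c K.* (p₁ K.* p₂) K.+ u K.* (q₁ K.* p₂ K.+ p₁ K.* q₂) K.≈
          (c K.* p₁ K.+ u K.* q₁) K.* p₂ K.+ u K.* p₁ K.* q₂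
        split-step = S.solve 6 (λ c u p₁ p₂ q₁ q₂ →
          c :* (p₁ :* p₂) :+ u :* (q₁ :* p₂ :+ p₁ :* q₂) :=
          (c :* p₁ :+ u :* q₁) :* p₂ :+ u :* p₁ :* q₂) K.refl

        expand-head : ∀ u c p v q →
          u K.* (c K.* p K.+ v K.* q) K.≈ u K.* c K.* p K.+ v K.* (u K.* q)
        expand-head = S.solve 5 (λ u c p v q →
          u :* (c :* p :+ v :* q) := u :* c :* p :+ v :* (u :* q)) K.refl

        exchange : ∀ y a b v p d q m →
          (y K.+ a) K.* (v K.* (d K.- b)) K.* p K.+ (y K.+ d) K.* ((y K.+ b) K.* q K.+ (a K.- b) K.* m K.* p) K.≈
          (y K.+ b) K.* (v K.* (d K.- a) K.* p K.+ (y K.+ d) K.* q) K.+ (a K.- b) K.* (v K.+ m) K.* ((y K.+ d) K.* p)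
        exchange = S.solve 8 (λ y a b v p d q m →
          (y :+ a) :* (v :* (d :- b)) :* p :+ (y :+ d) :* ((y :+ b) :* q :+ (a :- b) :* m :* p) :=
          (y :+ b) :* (v :* (d :- a) :* p :+ (y :+ d) :* q) :+ (a :- b) :* (v :+ m) :* ((y :+ d) :* p)) K.refl

        split-pole : ∀ y b e p q m →
          (y K.+ b) K.* p K.+ ((y K.+ e) K.* q K.+ (b K.- e) K.* m K.* p) K.≈
          (y K.+ e) K.* (p K.+ q) K.+ (b K.- e) K.* (K.1# K.+ m) K.* p
        split-pole = S.solve 6 (λ y b e p q m →
          (y :+ b) :* p :+ ((y :+ e) :* q :+ (b :- e) :* m :* p) :=
          (y :+ e) :* (p :+ q) :+ (b :- e) :* (:1 :+ m) :* p) K.refl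

        factor-out : ∀ u p c q → u K.* p K.+ (c K.* p K.+ u K.* q) K.≈ u K.* (p K.+ q) K.+ c K.* p
        factor-out = S.solve 4 (λ u p c q → u :* p :+ (c :* p :+ u :* q) := u :* (p :+ q) :+ c :* p) K.refl

    opaque
      ι-diff : ∀ x y → ι (x - y) K.≈ ι x K.- ι y
      ι-diff x y = K.trans (ι.+-homo x (- y)) (K.+-congˡ (ι.-‿homo y))

      denominator-split : ∀ {lo} k {l} (M : Atoms lo (k ℕ.+ l)) y →
        denominator M y K.≈ denominator (proj₁ (splitAtoms k M)) y K.* denominator (proj₂ (splitAtoms k M)) y
      denominator-split zero    M y = K.sym (K.*-identityˡ _)
      denominator-split (suc k) (cons d c lo<d _ M) y =
        K.trans (K.*-congˡ (K.trans (denominator-split k M y)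
                  (K.*-congˡ (K.sym (denominator-weaken lo<d (proj₂ (splitAtoms k M)) y)))))
          (K.sym (K.*-assoc _ _ _))

      numerator-split : ∀ {lo} k {l} (M : Atoms lo (k ℕ.+ l)) y →
        let (M₁ , M₂) = splitAtoms k M in
        numerator M y K.≈ numerator M₁ y K.* denominator M₂ y K.+ denominator M₁ y K.* numerator M₂ y
      numerator-split zero    M y = S.solve 2 (λ p q → q := :0 :* p :+ :1 :* q) K.refl (denominator M y) (numerator M y)
      numerator-split (suc k) (cons d c lo<d _ M) y =
        K.trans (K.+-cong (K.*-congˡ (denominator-split k M y)) (K.*-congˡ (numerator-split k M y)))
          (K.trans (split-step _ _ _ _ _ _)
            (K.sym (K.+-cong (K.*-congˡ (denominator-weaken lo<d (proj₂ (splitAtoms k M)) y))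
                             (K.*-congˡ (numerator-weaken lo<d (proj₂ (splitAtoms k M)) y)))))

      denominator-reweight : ∀ {lo k α β} (α≤lo : α ≤ʳ lo) (β≤lo : β ≤ʳ lo) (M : Atoms lo k) y →
        denominator (reweight α≤lo β≤lo M) y K.≈ denominator M y
      denominator-reweight α≤lo β≤lo []               y = K.refl
      denominator-reweight α≤lo β≤lo (cons _ _ _ _ M) y = K.*-congˡ (denominator-reweight _ _ M y)

      -- Term by term, `(y + α) / (y + β)` times `c / (y + d)` splits into `c (d - α) / (d - β)`
      -- over `y + d` and `(α - β) c / (d - β)` over `y + β`; the latter add up to the residue. With
      -- denominators cleared, the identity holds at the poles as well.
      numerator-reweight : ∀ {lo k α β} (α≤lo : α ≤ʳ lo) (β≤lo : β ≤ʳ lo) (M : Atoms lo k) y →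
        (y K.+ ι α) K.* numerator M y K.≈
        (y K.+ ι β) K.* numerator (reweight α≤lo β≤lo M) y K.+
          (ι α K.- ι β) K.* ι (residue β≤lo M) K.* denominator M y
      numerator-reweight {α = α} {β} α≤lo β≤lo [] y = K.sym (K.trans
        (K.+-congˡ (K.*-congʳ (K.*-congˡ ι.0#-homo)))
        (S.solve 3 (λ y a b → (y :+ b) :* :0 :+ (a :- b) :* :0 :* :1 := (y :+ a) :* :0) K.refl y (ι α) (ι β)))
      numerator-reweight {α = α} {β} α≤lo β≤lo (cons d c lo<d _ M) y = begin
        (y K.+ a) K.* (ι c K.* p K.+ (y K.+ ι d) K.* q)
          ≈⟨ expand-head (y K.+ a) (ι c) p (y K.+ ι d) q ⟩
        (y K.+ a) K.* ι c K.* p K.+ (y K.+ ι d) K.* ((y K.+ a) K.* q)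
          ≈⟨ K.+-cong (K.*-congʳ (K.*-congˡ c≈)) (K.*-congˡ (numerator-reweight _ _ M y)) ⟩
        (y K.+ a) K.* (v K.* (ι d K.- b)) K.* p K.+
          (y K.+ ι d) K.* ((y K.+ b) K.* q′ K.+ (a K.- b) K.* m K.* p)
          ≈⟨ exchange y a b v p (ι d) q′ m ⟩
        (y K.+ b) K.* (v K.* (ι d K.- a) K.* p K.+ (y K.+ ι d) K.* q′) K.+
          (a K.- b) K.* (v K.+ m) K.* ((y K.+ ι d) K.* p)
          ≈⟨ K.+-cong (K.*-congˡ (K.+-congʳ (K.*-cong c′≈ (denominator-reweight _ _ M y))))
                      (K.*-congʳ (K.*-congˡ (ι.+-homo _ _))) ⟨
        (y K.+ b) K.* (ι (c * r * (d - α)) K.* denominator (reweight _ _ M) y K.+ (y K.+ ι d) K.* q′) K.+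
          (a K.- b) K.* ι (c * r + residue _ M) K.* ((y K.+ ι d) K.* p) ∎
        where
        r : ℝ
        a b v m p q q′ : K.Carrier
        r = gap⁻¹ β≤lo lo<d
        a = ι α
        b = ι β
        v = ι (c * r)
        m = ι (residue (inj₁ (≤-<-trans β≤lo lo<d)) M)
        p = denominator M y
        q = numerator M y
        q′ = numerator (reweight (inj₁ (≤-<-trans α≤lo lo<d)) (inj₁ (≤-<-trans β≤lo lo<d)) M) y
        c′≈ : ι (c * r * (d - α)) K.≈ v K.* (ι d K.- a)
        c′≈ = K.trans (ι.*-homo _ _) (K.*-congˡ (ι-diff d α))
        c≈ : ι c K.≈ v K.* (ι d K.- b)
        c≈ = begin
          ι c                  ≈⟨ ι.⟦⟧-cong (weight-factor c β≤lo lo<d) ⟩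
          ι (c * r * (d - β))  ≈⟨ ι.*-homo _ _ ⟩
          v K.* ι (d - β)      ≈⟨ K.*-congˡ (ι-diff d β) ⟩
          v K.* (ι d K.- b)    ∎

    opaque
      -- One step from the partial fractions of Π(y + b) / Π(y + e) to those
      -- of the same quotient with one more interlacing pair e < b in front.
      prepend-pair : ∀ {k e b} → e < b → (M : Atoms b k) →
        ∃ λ c → ∃ λ (M′ : Atoms b k) → 0# < c × (∀ y →
          denominator M′ y K.≈ denominator M y ×
          (y K.+ ι b) K.* (denominator M y K.+ numerator M y) K.≈
          (y K.+ ι e) K.* (denominator M′ y K.+ numerator M′ y) K.+ ι c K.* denominator M′ y)
      prepend-pair {k} {e} {b} e<b M =
        c , M′ , *-positive (<⇒diff-pos e<b) (+-residue-pos (inj₁ e<b) M 0<1) ,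
        λ y → denominator-reweight _ _ M y , step y
        where
        c : ℝ
        -- The residue at `y = - e` of `(y + b) / (y + e)` times `1 + Σ`, positive because `e < b`
        -- and all nodes of `M` exceed `b`.
        c = (b - e) * (1# + residue (inj₁ e<b) M)
        M′ : Atoms b k
        M′ = reweight (inj₂ refl) (inj₁ e<b) M
        m : K.Carrier
        m = ι (residue (inj₁ e<b) M)
        c≈ : ι c K.≈ (ι b K.- ι e) K.* (K.1# K.+ m)
        c≈ = K.trans (ι.*-homo _ _) (K.*-cong (ι-diff b e) (K.trans (ι.+-homo _ _) (K.+-congʳ ι.1#-homo)))
        step : ∀ y → (y K.+ ι b) K.* (denominator M y K.+ numerator M y) K.≈
          (y K.+ ι e) K.* (denominator M′ y K.+ numerator M′ y) K.+ ι c K.* denominator M′ y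
        step y = begin
          (y K.+ ι b) K.* (p K.+ q)
            ≈⟨ K.distribˡ _ _ _ ⟩
          (y K.+ ι b) K.* p K.+ (y K.+ ι b) K.* q
            ≈⟨ K.+-congˡ (numerator-reweight (inj₂ refl) (inj₁ e<b) M y) ⟩
          (y K.+ ι b) K.* p K.+ ((y K.+ ι e) K.* q′ K.+ (ι b K.- ι e) K.* m K.* p)
            ≈⟨ split-pole y (ι b) (ι e) p q′ m ⟩
          (y K.+ ι e) K.* (p K.+ q′) K.+ (ι b K.- ι e) K.* (K.1# K.+ m) K.* p
            ≈⟨ K.+-cong (K.*-congˡ (K.+-congʳ (denominator-reweight _ _ M y)))
                        (K.*-cong c≈ (denominator-reweight _ _ M y)) ⟨
          (y K.+ ι e) K.* (denominator M′ y K.+ q′) K.+ ι c K.* denominator M′ y ∎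
          where
          p q q′ : K.Carrier
          p = denominator M y
          q = numerator M y
          q′ = numerator M′ y

    opaque
      -- The factors `(y + b) / (y + e)` are multiplied in from the largest pair down, so each new
      -- pair lies below all nodes found so far and the reweighting keeps the weights positive.
      interlaced⇒atoms : ∀ {lo k} (I : Interlaced lo k) → ∃ λ (M : Atoms lo k) → ∀ y →
        denominator M y K.≈ lowerProduct I y ×
        denominator M y K.+ numerator M y K.≈ upperProduct I y
      interlaced⇒atoms [] = [] , λ y → K.refl , K.+-identityʳ _
      interlaced⇒atoms (cons e b lo<e e<b I) with interlaced⇒atoms I
      ... | M₀ , eqs₀ with prepend-pair e<b M₀
      ...   | c , M′ , 0<c , eqs = cons e c lo<e 0<c (weaken e<b M′) , λ y →
        K.*-congˡ (K.trans (denominator-weaken e<b M′ y)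
          (K.trans (proj₁ (eqs y)) (proj₁ (eqs₀ y)))) , upper y
        where
        upper : ∀ y → (y K.+ ι e) K.* denominator (weaken e<b M′) y K.+
          (ι c K.* denominator (weaken e<b M′) y K.+ (y K.+ ι e) K.* numerator (weaken e<b M′) y) K.≈
          (y K.+ ι b) K.* upperProduct I y
        upper y = begin
          (y K.+ ι e) K.* denominator (weaken e<b M′) y K.+
            (ι c K.* denominator (weaken e<b M′) y K.+ (y K.+ ι e) K.* numerator (weaken e<b M′) y)
            ≈⟨ K.+-cong (K.*-congˡ (denominator-weaken e<b M′ y))
                 (K.+-cong (K.*-congˡ (denominator-weaken e<b M′ y)) (K.*-congˡ (numerator-weaken e<b M′ y))) ⟩
          (y K.+ ι e) K.* p K.+ (ι c K.* p K.+ (y K.+ ι e) K.* q)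
            ≈⟨ factor-out (y K.+ ι e) p (ι c) q ⟩
          (y K.+ ι e) K.* (p K.+ q) K.+ ι c K.* p
            ≈⟨ proj₂ (eqs y) ⟨
          (y K.+ ι b) K.* (denominator M₀ y K.+ numerator M₀ y)
            ≈⟨ K.*-congˡ (proj₂ (eqs₀ y)) ⟩
          (y K.+ ι b) K.* upperProduct I y ∎
          where
          p q : K.Carrier
          p = denominator M′ y
          q = numerator M′ y

  module Real = Evaluation commutativeRing (λ x → x) (isRingHomomorphism (CommutativeRing.rawRing commutativeRing) refl)

-- A zero between the first two poles.

module FirstRoot (𝓡 : CompleteOrderedField) where
  open Reals 𝓡
  open OrderedField 𝓡
  open PartialFractions 𝓡
  open Evaluation commutativeRing (λ x → x) (isRingHomomorphism (CommutativeRing.rawRing commutativeRing) refl)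
  open IntegerCoefficients commutativeRing

  opaque
    -- In the variable `x = - y` the poles sit at the nodes themselves.
    denominator-polynomial : ∀ {lo k} (M : Atoms lo k) → IsPolynomial (λ x → denominator M (- x))
    denominator-polynomial []               = const 1#
    denominator-polynomial (cons d c _ _ M) = ((⊖ id) ⊕ const d) ⊗ denominator-polynomial M

    numerator-polynomial : ∀ {lo k} (M : Atoms lo k) → IsPolynomial (λ x → numerator M (- x))
    numerator-polynomial []               = const 0#
    numerator-polynomial (cons d c _ _ M) =
      (const c ⊗ denominator-polynomial M) ⊕ (((⊖ id) ⊕ const d) ⊗ numerator-polynomial M)

    denominator-pos : ∀ {lo k x} → x ≤ʳ lo → (M : Atoms lo k) → 0# < denominator M (- x)
    denominator-pos x≤lo []                  = 0<1
    denominator-pos x≤lo (cons d c lo<d _ M) =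
      *-positive (pos-resp (+-comm _ _) (gap-pos x≤lo lo<d))
        (denominator-pos (inj₁ (≤-<-trans x≤lo lo<d)) M)

  private
    opaque
      -- The sign change of the cleared numerator `w p + (d - x) q`: at `x = d` only `w p` survives,
      -- and at `x = d₂` only the term of weight `c₂`, with the negative factor `d - d₂`.
      at-left : ∀ w p d q → w * p ≈ w * p + (- d + d) * q
      at-left = solve 4 (λ w p d q → w :* p := w :* p :+ (:- d :+ d) :* q) refl

      at-right : ∀ w p d e c q →
        (e - d) * (c * p) ≈ 0# - (w * ((- e + e) * p) + (- e + d) * (c * p + (- e + e) * q))
      at-right = solve 6 (λ w p d e c q →
        (e :- d) :* (c :* p) := :0 :- (w :* ((:- e :+ e) :* p) :+ (:- e :+ d) :* (c :* p :+ (:- e :+ e) :* q))) refl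

      -- Reweighting with the pole dropped at `- e` turns the numerator there into a multiple of the
      -- residue `m`. Once the positive denominator is cancelled, vanishing at `e` reads
      -- `w = (e - d) m`.
      at-root : ∀ w p d e q m →
        p * (w - (e - d) * m) ≈ w * p + ((- e + e) * q + (d - e) * m * p)
      at-root = solve 6 (λ w p d e q m →
        p :* (w :- (e :- d) :* m) := w :* p :+ ((:- e :+ e) :* q :+ (d :- e) :* m :* p)) refl

      diff≈0 : ∀ {x y} → x - y ≈ 0# → x ≈ y
      diff≈0 {x} {y} x-y≈0 = trans (solve 2 (λ x y → x := x :- y :+ y) refl x y)
        (trans (+-congʳ x-y≈0) (+-identityˡ y))

  opaque
    -- A zero of w / (y + d) + Σᵢ cᵢ / (y + dᵢ) between its first two poles.
    first-root : ∀ {k} d w → 0# < w → ∀ d₂ c₂ (d<d₂ : d < d₂) (0<c₂ : 0# < c₂) (M : Atoms d₂ k) →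
      ∃ λ e → ∃ λ (d<e : d < e) → ∃ λ (e<d₂ : e < d₂) →
      w ≈ (e - d) * residue (inj₂ refl) (cons {e} d₂ c₂ e<d₂ 0<c₂ M)
    first-root {k} d w 0<w d₂ c₂ d<d₂ 0<c₂ M with
      intermediate-value
        ((const w ⊗ denominator-polynomial N) ⊕ (((⊖ id) ⊕ const d) ⊗ numerator-polynomial N))
        d<d₂
        (pos-resp (at-left w (denominator N (- d)) d (numerator N (- d)))
          (*-positive 0<w (denominator-pos (inj₂ refl) N)))
        (diff-pos⇒< (pos-resp (at-right w (denominator M (- d₂)) d d₂ c₂ (numerator M (- d₂)))
          (*-positive (<⇒diff-pos d<d₂) (*-positive 0<c₂ (denominator-pos (inj₂ refl) M)))))
      where
      N : Atoms d (suc k)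
      N = cons d₂ c₂ d<d₂ 0<c₂ M
    ... | e , d<e , e<d₂ , root = e , d<e , e<d₂ , diff≈0 (*-cancel-pos (denominator-pos (inj₂ refl) N)
      (trans (at-root w _ d e _ _)
        (trans (+-congˡ (sym (numerator-reweight (inj₁ d<e) (inj₂ refl) N (- e)))) root)))
      where
      N : Atoms e (suc k)
      N = cons d₂ c₂ e<d₂ 0<c₂ M

-- Factoring the numerator of partial fractions.

module Factorisation
  (𝓡 : CompleteOrderedField) (K : CommutativeRing 0ℓ 0ℓ)
  (ι : CompleteOrderedField.Carrier 𝓡 → CommutativeRing.Carrier K)
  (ι-hom : IsRingHomomorphism (CommutativeRing.rawRing (CompleteOrderedField.commutativeRing 𝓡))
                              (CommutativeRing.rawRing K) ι)
  where
  open Reals 𝓡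
  open OrderedField 𝓡
  open PartialFractions 𝓡
  open Evaluation K ι ι-hom
  open FirstRoot 𝓡 using (first-root)
  private
    module K = CommutativeRing K
    module ι = IsRingHomomorphism ι-hom
    open IntegerCoefficients K renaming (solve to solveᴷ)

    opaque
      absorb : ∀ w p u q d e m → w K.≈ (e K.- d) K.* m →
        w K.* p K.+ (u K.* q K.+ (d K.- e) K.* m K.* p) K.≈ u K.* q
      absorb w p u q d e m w≈ = K.trans (K.+-congʳ (K.*-congʳ w≈))
        (solveᴷ 6 (λ p u q d e m → (e :- d) :* m :* p :+ (u :* q :+ (d :- e) :* m :* p) := u :* q)
          K.refl p u q d e m)

      left-commute : ∀ u w p → u K.* (w K.* p) K.≈ w K.* (u K.* p)
      left-commute = solveᴷ 3 (λ u w p → u :* (w :* p) := w :* (u :* p)) K.refl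

  opaque
    -- Reweighting writes `y + d` times the old numerator as `y + e` times a new one plus a multiple
    -- of the denominator; `e` is the zero for which this multiple cancels `w` times the
    -- denominator. The new numerator has the original shape, with `d₂` in the role of `d`, so the
    -- step can be repeated.
    peel-pole : ∀ {k} d w → 0# < w → ∀ d₂ c₂ (d<d₂ : d < d₂) (0<c₂ : 0# < c₂) (M : Atoms d₂ k) →
      ∃ λ e → ∃₂ λ c (N : Atoms d₂ k) → d < e × e < d₂ × 0# < c × (∀ y →
        denominator N y K.≈ denominator M y ×
        ι w K.* denominator (cons d₂ c₂ d<d₂ 0<c₂ M) y K.+
          (y K.+ ι d) K.* numerator (cons d₂ c₂ d<d₂ 0<c₂ M) y K.≈
        (y K.+ ι e) K.* (ι c K.* denominator N y K.+ (y K.+ ι d₂) K.* numerator N y))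
    peel-pole d w 0<w d₂ c₂ d<d₂ 0<c₂ M with first-root d w 0<w d₂ c₂ d<d₂ 0<c₂ M
    ... | e , d<e , e<d₂ , w≈ = e , _ , reweight _ _ M , d<e , e<d₂ ,
      *-positive (*-positive 0<c₂ (gap⁻¹-pos (inj₂ refl) e<d₂)) (gap-pos (inj₁ d<e) e<d₂) , λ y →
      denominator-reweight _ _ M y ,
      K.trans
        (K.+-congˡ (numerator-reweight (inj₁ d<e) (inj₂ refl) (cons {e} d₂ c₂ e<d₂ 0<c₂ M) y))
        (absorb _ _ _ _ (ι d) (ι e) _
          (K.trans (ι.⟦⟧-cong w≈) (K.trans (ι.*-homo _ _) (K.*-congʳ (ι-diff e d)))))

  opaque
    -- Factors `w / (y + d) + Σ cᵢ / (y + dᵢ)`. Each zero is paired with the node above it, while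
    -- `d` only bounds the pairs from below. As the leading coefficient, `W` is the total weight.
    atoms⇒interlaced : ∀ {d k} w → 0# < w → (M : Atoms d k) →
      ∃ λ (I : Interlaced d k) → ∃ λ W → 0# < W × (∀ y →
        ι w K.* denominator M y K.+ (y K.+ ι d) K.* numerator M y K.≈ ι W K.* lowerProduct I y ×
        denominator M y K.≈ upperProduct I y)
    atoms⇒interlaced w 0<w [] = [] , w , 0<w , λ y →
      K.trans (K.+-congˡ (K.zeroʳ _)) (K.+-identityʳ _) , K.refl
    atoms⇒interlaced {d} w 0<w (cons d₂ c₂ d<d₂ 0<c₂ M)
      with peel-pole d w 0<w d₂ c₂ d<d₂ 0<c₂ M
    ... | e , c , N , d<e , e<d₂ , 0<c , eqs with atoms⇒interlaced c 0<c N
    ...   | I , W , 0<W , eqs′ = cons e d₂ d<e e<d₂ I , W , 0<W , λ y →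
      K.trans (proj₂ (eqs y)) (K.trans (K.*-congˡ (proj₁ (eqs′ y))) (left-commute _ _ _)) ,
      K.*-congˡ (K.trans (K.sym (proj₁ (eqs y))) (proj₂ (eqs′ y)))

-- Balanced trees and the realisation of partial fractions by them.

data Tree (n : ℕ) : Set where
  leaf : Fin n → Tree n
  join : Tree n → Tree n → Tree n

root : ∀ {n} → Tree n → Fin n
root (leaf v)   = v
root (join s t) = root s

-- Balanced t 1ℙ k : t has 2k + 1 vertices;  Balanced t 0ℙ k : t has 2k + 2
-- vertices. An odd branch t is only ever attached to an odd tree s.
data Balanced {n} : Tree n → Parity → ℕ → Set where
  leaf      : ∀ {v} → Balanced (leaf v) 1ℙ 0
  odd-odd   : ∀ {s t k l} → Balanced s 1ℙ k → Balanced t 1ℙ l → Balanced (join s t) 0ℙ (k ℕ.+ l)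
  odd-even  : ∀ {s t k l} → Balanced s 1ℙ k → Balanced t 0ℙ l → Balanced (join s t) 1ℙ (k ℕ.+ suc l)
  even-even : ∀ {s t k l} → Balanced s 0ℙ k → Balanced t 0ℙ l → Balanced (join s t) 0ℙ (k ℕ.+ suc l)

module Realisation
  (𝓡 : CompleteOrderedField) (K : CommutativeRing 0ℓ 0ℓ)
  (ι : CompleteOrderedField.Carrier 𝓡 → CommutativeRing.Carrier K)
  (ι-hom : IsRingHomomorphism (CommutativeRing.rawRing (CompleteOrderedField.commutativeRing 𝓡))
                              (CommutativeRing.rawRing K) ι)
  where
  open Reals 𝓡
  open OrderedField 𝓡
  open PartialFractions 𝓡
  open Evaluation K ι ι-hom
  open Factorisation 𝓡 K ι ι-hom
  private
    module K = CommutativeRing K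
    module ι = IsRingHomomorphism ι-hom
    open IntegerCoefficients K renaming (solve to solveᴷ)

  Weights : ∀ {n} → Tree n → Set
  Weights (leaf v)   = ⊤
  Weights (join s t) = (∃ λ a → 0# < a) × Weights s × Weights t

  -- With A the weighted skew-symmetric matrix of t, these are det(z − A) and
  -- the same determinant with the row and column of the root deleted.
  charPoly rootMinor : ∀ {n} (t : Tree n) → Weights t → K.Carrier → K.Carrier
  charPoly (leaf v)   _                   z = z
  charPoly (join s t) ((a , _) , ws , wt) z =
    charPoly s ws z K.* charPoly t wt z K.+ ι a K.* ι a K.* (rootMinor s ws z K.* rootMinor t wt z)
  rootMinor (leaf v)   _             z = K.1#
  rootMinor (join s t) (_ , ws , wt) z = rootMinor s ws z K.* charPoly t wt z

  private
    opaque
      0ι : ∀ y → y K.+ ι 0# K.≈ y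
      0ι y = K.trans (K.+-congˡ ι.0#-homo) (K.+-identityʳ y)

      ι-sqrt : ∀ {r W} → r * r ≈ W → ι r K.* ι r K.≈ ι W
      ι-sqrt eq = K.trans (K.sym (ι.*-homo _ _)) (ι.⟦⟧-cong eq)

  -- A branch t attached to s absorbs the part Q / P of the partial fractions
  -- of s: the two lemmas provide the data for t with a² rootMinor = Q and
  -- charPoly = P, up to factors of z.
  opaque
    odd-branch : ∀ {k} c → 0# < c → (M : Atoms 0# k) →
      ∃ λ a → 0# < a × ∃ λ (N : Atoms 0# k) → ∀ y →
        ι c K.* denominator M y K.+ y K.* numerator M y K.≈ ι a K.* ι a K.* denominator N y ×
        denominator N y K.+ numerator N y K.≈ denominator M y
    odd-branch c 0<c M with atoms⇒interlaced c 0<c M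
    ... | I , W , 0<W , eqs with pos-sqrt 0<W | interlaced⇒atoms I
    ...   | a , 0<a , a²≈W | N , eqs′ = a , 0<a , N , λ y →
      K.trans (K.+-congˡ (K.*-congʳ (K.sym (0ι y))))
        (K.trans (proj₁ (eqs y)) (K.*-cong (K.sym (ι-sqrt a²≈W)) (K.sym (proj₁ (eqs′ y))))) ,
      K.trans (proj₂ (eqs′ y)) (K.sym (proj₂ (eqs y)))

    even-branch : ∀ {k} (M : Atoms 0# (suc k)) →
      ∃ λ a → 0# < a × ∃ λ c → 0# < c × ∃ λ (N : Atoms 0# k) → ∀ y →
        numerator M y K.≈ ι a K.* ι a K.* denominator N y ×
        y K.* (denominator N y K.+ numerator N y) K.+ ι c K.* denominator N y K.≈ denominator M y
    even-branch (cons d c 0<d 0<c M) with atoms⇒interlaced c 0<c M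
    ... | I , W , 0<W , eqs with pos-sqrt 0<W | interlaced⇒atoms I
    -- The pair `0 < d` supplies the factor `(y + d) / y`; its pole is the node 0 that an even
    -- branch must have, with weight `c₀`.
    ...   | a , 0<a , a²≈W | N₀ , eqs₀ with prepend-pair 0<d N₀
    ...     | c₀ , N , 0<c₀ , eqs′ = a , 0<a , c₀ , 0<c₀ , weaken 0<d N , λ y →
      K.trans (proj₁ (eqs y)) (K.*-cong (K.sym (ι-sqrt a²≈W)) (K.sym
        (K.trans (denominator-weaken 0<d N y) (K.trans (proj₁ (eqs′ y)) (proj₁ (eqs₀ y)))))) ,
      K.trans
        (K.+-cong (K.*-cong (K.sym (0ι y)) (K.+-cong (denominator-weaken 0<d N y) (numerator-weaken 0<d N y)))
          (K.*-congˡ (denominator-weaken 0<d N y)))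
        (K.trans (K.sym (proj₂ (eqs′ y)))
          (K.*-congˡ (K.trans (proj₂ (eqs₀ y)) (K.sym (proj₂ (eqs y))))))

  -- In both cases `charPoly / rootMinor` is `z (1 + Σ cᵢ / (y + dᵢ))` at `y = z²`. For even order
  -- the sum includes the node 0, whose weight `c` is kept apart because atoms above `0#` have
  -- positive nodes. Quantifying over all atoms lets a branch accept whatever is handed to it.
  Realises : ∀ {n} → Tree n → Parity → ℕ → Set
  Realises t 1ℙ k = (M : Atoms 0# k) → ∃ λ (w : Weights t) → ∀ z →
    rootMinor t w z K.≈ denominator M (z K.* z) ×
    charPoly t w z K.≈ z K.* (denominator M (z K.* z) K.+ numerator M (z K.* z))
  Realises t 0ℙ k = ∀ c → 0# < c → (M : Atoms 0# k) → ∃ λ (w : Weights t) → ∀ z →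
    rootMinor t w z K.≈ z K.* denominator M (z K.* z) ×
    charPoly t w z K.≈ z K.* z K.* (denominator M (z K.* z) K.+ numerator M (z K.* z)) K.+
                       ι c K.* denominator M (z K.* z)

  private
    opaque
      rearrange : ∀ a f g → a K.* a K.* (f K.* g) K.≈ f K.* (a K.* a K.* g)
      rearrange = solveᴷ 3 (λ a f g → a :* a :* (f :* g) := f :* (a :* a :* g)) K.refl

      odd-odd-char : ∀ z c p₁ q₁ p₂ q₂ →
        z K.* (p₁ K.+ q₁) K.* (z K.* p₂) K.+ p₁ K.* (c K.* p₂ K.+ z K.* z K.* q₂) K.≈
        z K.* z K.* (p₁ K.* p₂ K.+ (q₁ K.* p₂ K.+ p₁ K.* q₂)) K.+ c K.* (p₁ K.* p₂)
      odd-odd-char = solveᴷ 6 (λ z c p₁ q₁ p₂ q₂ →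
        z :* (p₁ :+ q₁) :* (z :* p₂) :+ p₁ :* (c :* p₂ :+ z :* z :* q₂) :=
        z :* z :* (p₁ :* p₂ :+ (q₁ :* p₂ :+ p₁ :* q₂)) :+ c :* (p₁ :* p₂)) K.refl

      odd-even-char : ∀ z p₁ q₁ p₂ q₂ →
        z K.* (p₁ K.+ q₁) K.* p₂ K.+ p₁ K.* (z K.* q₂) K.≈
        z K.* (p₁ K.* p₂ K.+ (q₁ K.* p₂ K.+ p₁ K.* q₂))
      odd-even-char = solveᴷ 5 (λ z p₁ q₁ p₂ q₂ →
        z :* (p₁ :+ q₁) :* p₂ :+ p₁ :* (z :* q₂) :=
        z :* (p₁ :* p₂ :+ (q₁ :* p₂ :+ p₁ :* q₂))) K.refl

      even-even-char : ∀ z c p₁ q₁ p₂ q₂ →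
        (z K.* z K.* (p₁ K.+ q₁) K.+ c K.* p₁) K.* p₂ K.+ z K.* p₁ K.* (z K.* q₂) K.≈
        z K.* z K.* (p₁ K.* p₂ K.+ (q₁ K.* p₂ K.+ p₁ K.* q₂)) K.+ c K.* (p₁ K.* p₂)
      even-even-char = solveᴷ 6 (λ z c p₁ q₁ p₂ q₂ →
        (z :* z :* (p₁ :+ q₁) :+ c :* p₁) :* p₂ :+ z :* p₁ :* (z :* q₂) :=
        z :* z :* (p₁ :* p₂ :+ (q₁ :* p₂ :+ p₁ :* q₂)) :+ c :* (p₁ :* p₂)) K.refl

      left-swap : ∀ p z q → p K.* (z K.* q) K.≈ z K.* (p K.* q)
      left-swap = solveᴷ 3 (λ p z q → p :* (z :* q) := z :* (p :* q)) K.refl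

      minor-factor : ∀ {a f g h q} → h K.≈ a K.* a K.* g → f K.≈ q →
        a K.* a K.* (f K.* g) K.≈ q K.* h
      minor-factor h≈ f≈ = K.trans (rearrange _ _ _) (K.*-cong f≈ (K.sym h≈))

      minor-factor-z : ∀ {a f g h q z} → h K.≈ a K.* a K.* g → f K.≈ q →
        a K.* a K.* (f K.* (z K.* g)) K.≈ q K.* (z K.* h)
      minor-factor-z h≈ f≈ = K.trans (K.*-congˡ (left-swap _ _ _)) (K.trans (left-swap _ _ _)
        (K.trans (K.*-congˡ (minor-factor h≈ f≈)) (left-swap _ _ _)))

  opaque
    -- The first `k` atoms go to `s` and the rest to the branch. The weight `c` at the node 0 goes
    -- to the branch if that is odd, and otherwise stays with the even tree `s`. An even branch
    -- takes over `l + 1` poles, but has itself only `l` positive nodes besides 0.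
    realise : ∀ {n} {t : Tree n} {p k} → Balanced t p k → Realises t p k
    realise leaf [] = tt , λ z → K.refl , K.sym (K.trans (K.*-congˡ (K.+-identityʳ _)) (K.*-identityʳ z))
    realise (odd-odd {k = k} bs bt) c 0<c M
      with splitAtoms k M | denominator-split k M | numerator-split k M
    ... | M₁ , M₂ | den | num with odd-branch c 0<c M₂ | realise bs M₁
    ...   | a , 0<a , N , eqs | ws , eqs₁ with realise bt N
    ...     | wt , eqs₂ = ((a , 0<a) , ws , wt) , λ z →
      let y = z K.* z
          gt = K.trans (proj₂ (eqs₂ z)) (K.*-congˡ (proj₂ (eqs y))) in
      K.trans (K.*-cong (proj₁ (eqs₁ z)) gt) (K.trans (left-swap _ _ _) (K.*-congˡ (K.sym (den y)))) ,
      K.trans (K.+-cong (K.*-cong (proj₂ (eqs₁ z)) gt)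
          (minor-factor (K.trans (proj₁ (eqs y)) (K.*-congˡ (K.sym (proj₁ (eqs₂ z))))) (proj₁ (eqs₁ z))))
        (K.trans (odd-odd-char _ _ _ _ _ _)
          (K.sym (K.+-cong (K.*-congˡ (K.+-cong (den y) (num y))) (K.*-congˡ (den y)))))
    realise (odd-even {k = k} bs bt) M
      with splitAtoms k M | denominator-split k M | numerator-split k M
    ... | M₁ , M₂ | den | num with even-branch M₂ | realise bs M₁
    ...   | a , 0<a , c , 0<c , N , eqs | ws , eqs₁ with realise bt c 0<c N
    ...     | wt , eqs₂ = ((a , 0<a) , ws , wt) , λ z →
      let y = z K.* z
          gt = K.trans (proj₂ (eqs₂ z)) (proj₂ (eqs y)) in
      K.trans (K.*-cong (proj₁ (eqs₁ z)) gt) (K.sym (den y)) ,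
      K.trans (K.+-cong (K.*-cong (proj₂ (eqs₁ z)) gt)
          (K.trans (K.*-congˡ (K.*-congˡ (proj₁ (eqs₂ z)))) (minor-factor-z (proj₁ (eqs y)) (proj₁ (eqs₁ z)))))
        (K.trans (odd-even-char _ _ _ _ _) (K.sym (K.*-congˡ (K.+-cong (den y) (num y)))))
    realise (even-even {k = k} bs bt) c 0<c M
      with splitAtoms k M | denominator-split k M | numerator-split k M
    ... | M₁ , M₂ | den | num with even-branch M₂ | realise bs c 0<c M₁
    ...   | a , 0<a , c′ , 0<c′ , N , eqs | ws , eqs₁ with realise bt c′ 0<c′ N
    ...     | wt , eqs₂ = ((a , 0<a) , ws , wt) , λ z →
      let y = z K.* z
          gt = K.trans (proj₂ (eqs₂ z)) (proj₂ (eqs y)) in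
      K.trans (K.*-cong (proj₁ (eqs₁ z)) gt) (K.trans (K.*-assoc _ _ _) (K.*-congˡ (K.sym (den y)))) ,
      K.trans (K.+-cong (K.*-cong (proj₂ (eqs₁ z)) gt)
          (K.trans (K.*-congˡ (K.*-congˡ (proj₁ (eqs₂ z)))) (minor-factor-z (proj₁ (eqs y)) (proj₁ (eqs₁ z)))))
        (K.trans (even-even-char _ _ _ _ _ _)
          (K.sym (K.+-cong (K.*-congˡ (K.+-cong (den y) (num y))) (K.*-congˡ (den y)))))

    realise-odd : ∀ {n} {t : Tree n} {k} → Balanced t 1ℙ k → (I : Interlaced 0# k) →
      ∃ λ (w : Weights t) → ∀ z →
        rootMinor t w z K.≈ lowerProduct I (z K.* z) ×
        charPoly t w z K.≈ z K.* upperProduct I (z K.* z)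
    realise-odd b I with interlaced⇒atoms I
    ... | M , eqs with realise b M
    ...   | w , eqs′ = w , λ z →
      K.trans (proj₁ (eqs′ z)) (proj₁ (eqs (z K.* z))) ,
      K.trans (proj₂ (eqs′ z)) (K.*-congˡ (proj₂ (eqs (z K.* z))))

    -- The surplus factor `y + d` of the characteristic polynomial is matched with a factor `y`
    -- below, and the residue at that pole is the weight `c` at the node 0.
    realise-even : ∀ {n} {t : Tree n} {k d} → Balanced t 0ℙ k → 0# < d → (I : Interlaced d k) →
      ∃ λ (w : Weights t) → ∀ z →
        rootMinor t w z K.≈ z K.* lowerProduct I (z K.* z) ×
        charPoly t w z K.≈ (z K.* z K.+ ι d) K.* upperProduct I (z K.* z)
    realise-even b 0<d I with interlaced⇒atoms I
    ... | M₀ , eqs with prepend-pair 0<d M₀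
    ...   | c , M , 0<c , eqs′ with realise b c 0<c (weaken 0<d M)
    ...     | w , eqs″ = w , λ z →
      let y = z K.* z
          p = denominator-weaken 0<d M y
          q = numerator-weaken 0<d M y in
      K.trans (proj₁ (eqs″ z)) (K.*-congˡ (K.trans p (K.trans (proj₁ (eqs′ y)) (proj₁ (eqs y))))) ,
      K.trans (proj₂ (eqs″ z))
        (K.trans (K.+-cong (K.*-cong (K.sym (0ι y)) (K.+-cong p q)) (K.*-congˡ p))
          (K.trans (K.sym (proj₂ (eqs′ y))) (K.*-congˡ (proj₂ (eqs y)))))

infix 4 _∈ᵗ_ _∈ᵗ?_
_∈ᵗ_ : ∀ {n} → Fin n → Tree n → Set
v ∈ᵗ leaf u   = v ≡ u
v ∈ᵗ join s t = v ∈ᵗ s ⊎ v ∈ᵗ t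

_∈ᵗ?_ : ∀ {n} (v : Fin n) t → Dec (v ∈ᵗ t)
v ∈ᵗ? leaf u   = v Fin.≟ u
v ∈ᵗ? join s t = (v ∈ᵗ? s) ⊎-dec (v ∈ᵗ? t)

root∈ : ∀ {n} (t : Tree n) → root t ∈ᵗ t
root∈ (leaf v)   = ≡.refl
root∈ (join s t) = inj₁ (root∈ s)

Disjoint : ∀ {n} → Tree n → Tree n → Set
Disjoint s t = ∀ {v} → v ∈ᵗ s → ¬ (v ∈ᵗ t)

Simple : ∀ {n} → Tree n → Set
Simple (leaf v)   = ⊤
Simple (join s t) = Simple s × Simple t × Disjoint s t

-- The weighted matrix, solutions away from the root, and eigenvalues.

module WeightedMatrix
  (𝓡 : CompleteOrderedField) (K : CommutativeRing 0ℓ 0ℓ)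
  (ι : CompleteOrderedField.Carrier 𝓡 → CommutativeRing.Carrier K)
  (ι-hom : IsRingHomomorphism (CommutativeRing.rawRing (CompleteOrderedField.commutativeRing 𝓡))
                              (CommutativeRing.rawRing K) ι)
  where
  open Reals 𝓡
  open OrderedField 𝓡
  open Realisation 𝓡 K ι ι-hom

  -- Recursive in both indices, so that it unfolds together with `sum`.
  δ : ∀ {n} → Fin n → Fin n → ℝ
  δ zero    zero    = 1#
  δ zero    (suc j) = 0#
  δ (suc i) zero    = 0#
  δ (suc i) (suc j) = δ i j

  δ-refl : ∀ {n} (i : Fin n) → δ i i ≡ 1#
  δ-refl zero    = ≡.refl
  δ-refl (suc i) = δ-refl i

  δ-≢ : ∀ {n} {i j : Fin n} → i ≢ j → δ i j ≡ 0#
  δ-≢ {i = zero}  {zero}  i≢j = ⊥-elim (i≢j ≡.refl)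
  δ-≢ {i = zero}  {suc j} i≢j = ≡.refl
  δ-≢ {i = suc i} {zero}  i≢j = ≡.refl
  δ-≢ {i = suc i} {suc j} i≢j = δ-≢ (i≢j ∘ ≡.cong suc)

  edge : ∀ {n} → ℝ → Fin n → Fin n → Matrix n
  edge a w u i j = a * (δ w i * δ u j - δ u i * δ w j)

  matrix : ∀ {n} (t : Tree n) → Weights t → Matrix n
  matrix (leaf v)   _                   i j = 0#
  matrix (join s t) ((a , _) , ws , wt) i j =
    matrix s ws i j + matrix t wt i j + edge a (root s) (root t) i j

  private
    module RealSolver where
      open IntegerCoefficients commutativeRing

      opaque
        edge-skew-eq : ∀ a p q r s → a * (p * q - r * s) ≈ - (a * (s * r - q * p))
        edge-skew-eq = solve 5 (λ a p q r s → a :* (p :* q :- r :* s) := :- (a :* (s :* r :- q :* p))) refl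

        -‿+₃ : ∀ x y z → - x + - y + - z ≈ - (x + y + z)
        -‿+₃ = solve 3 (λ x y z → :- x :+ :- y :+ :- z := :- (x :+ y :+ z)) refl

        edge-zero-eq : ∀ a p q → a * (0# * p - 0# * q) ≈ 0#
        edge-zero-eq = solve 3 (λ a p q → a :* (:0 :* p :- :0 :* q) := :0) refl

        0+0+0 : 0# + 0# + 0# ≈ 0#
        0+0+0 = solve 0 (:0 :+ :0 :+ :0 := :0) refl
    open RealSolver

  opaque
    matrix-skew : ∀ {n} (t : Tree n) w → SkewSymmetric (matrix t w)
    matrix-skew (leaf v)   _                   i j = sym (trans (sym (+-identityˡ _)) (-‿inverseʳ 0#))
    matrix-skew (join s t) ((a , _) , ws , wt) i j = trans
      (+-cong (+-cong (matrix-skew s ws i j) (matrix-skew t wt i j))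
        (edge-skew-eq a (δ (root s) i) (δ (root t) j) (δ (root t) i) (δ (root s) j)))
      (-‿+₃ _ _ _)

    edge-row : ∀ {n} a {w u i : Fin n} j → w ≢ i → u ≢ i → edge a w u i j ≈ 0#
    edge-row a {w} {u} {i} j w≢i u≢i = trans
      (*-congˡ (+-cong (*-congʳ (reflexive (δ-≢ w≢i))) (-‿cong (*-congʳ (reflexive (δ-≢ u≢i))))))
      (edge-zero-eq a (δ u j) (δ w j))

    matrix-row : ∀ {n} (t : Tree n) w {i} j → ¬ (i ∈ᵗ t) → matrix t w i j ≈ 0#
    matrix-row (leaf v)   _                   j i∉t = refl
    matrix-row (join s t) ((a , _) , ws , wt) j i∉t = trans
      (+-cong (+-cong (matrix-row s ws j (i∉t ∘ inj₁)) (matrix-row t wt j (i∉t ∘ inj₂)))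
        (edge-row a {root s} {root t} j (λ { ≡.refl → i∉t (inj₁ (root∈ s)) }) (λ { ≡.refl → i∉t (inj₂ (root∈ t)) })))
      0+0+0

    matrix-column : ∀ {n} (t : Tree n) w i {j} → ¬ (j ∈ᵗ t) → matrix t w i j ≈ 0#
    matrix-column t w i {j} j∉t = trans (matrix-skew t w i j)
      (trans (-‿cong (matrix-row t w i j∉t)) (trans (sym (+-identityˡ _)) (-‿inverseʳ 0#)))

  private
    module K = CommutativeRing K
    module ι = IsRingHomomorphism ι-hom
    open IntegerCoefficients K renaming (solve to solveᴷ)
    open SemiringSum K.semiring using (*-distribˡ-sum)
  open CommutativeMonoidSum K.+-commutativeMonoid using (sum; ∑-distrib-+; sum-cong-≋; sum-replicate-zero; sum-remove)

  e : ∀ {n} → Fin n → Fin n → K.Carrier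
  e i j = ι (δ i j)

  apply : ∀ {n} (t : Tree n) → Weights t → Vector K.Carrier n → Vector K.Carrier n
  apply t w x i = sum (λ j → ι (matrix t w i j) K.* x j)

  opaque
    sum-zero : ∀ {n} {f : Vector K.Carrier n} → (∀ i → f i K.≈ K.0#) → sum f K.≈ K.0#
    sum-zero {n} f≈0 = K.trans (sum-cong-≋ f≈0) (sum-replicate-zero n)

    sum-e : ∀ {n} u (x : Vector K.Carrier n) → sum (λ j → e u j K.* x j) K.≈ x u
    sum-e zero    x = K.trans
      (K.+-cong (K.trans (K.*-congʳ ι.1#-homo) (K.*-identityˡ _))
                (sum-zero (λ j → K.trans (K.*-congʳ ι.0#-homo) (K.zeroˡ (x (suc j))))))
      (K.+-identityʳ _)
    sum-e (suc u) x = K.trans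
      (K.+-cong (K.trans (K.*-congʳ ι.0#-homo) (K.zeroˡ _)) (sum-e u (x ∘ suc)))
      (K.+-identityˡ _)

    e-refl : ∀ {n} (i : Fin n) → e i i K.≈ K.1#
    e-refl i = K.trans (ι.⟦⟧-cong (reflexive (δ-refl i))) ι.1#-homo

    e-≢ : ∀ {n} {i j : Fin n} → i ≢ j → e i j K.≈ K.0#
    e-≢ i≢j = K.trans (ι.⟦⟧-cong (reflexive (δ-≢ i≢j))) ι.0#-homo

    apply-outside : ∀ {n} (t : Tree n) w x {i} → ¬ (i ∈ᵗ t) → apply t w x i K.≈ K.0#
    apply-outside t w x i∉t = sum-zero λ j →
      K.trans (K.*-congʳ (K.trans (ι.⟦⟧-cong (matrix-row t w j i∉t)) ι.0#-homo)) (K.zeroˡ (x j))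

    apply-vanishing : ∀ {n} (t : Tree n) w {x} → (∀ {j} → j ∈ᵗ t → x j K.≈ K.0#) → ∀ i → apply t w x i K.≈ K.0#
    apply-vanishing t w {x} x≈0 i = sum-zero term
      where
      term : ∀ j → ι (matrix t w i j) K.* x j K.≈ K.0#
      term j with j ∈ᵗ? t
      ... | yes j∈t = K.trans (K.*-congˡ (x≈0 j∈t)) (K.zeroʳ _)
      ... | no  j∉t = K.trans (K.*-congʳ (K.trans (ι.⟦⟧-cong (matrix-column t w i j∉t)) ι.0#-homo)) (K.zeroˡ (x j))

  private
    opaque
      combine-terms : ∀ m c d x y → m K.* (c K.* x K.+ d K.* y) K.≈ c K.* (m K.* x) K.+ d K.* (m K.* y)
      combine-terms = solveᴷ 5 (λ m c d x y → m :* (c :* x :+ d :* y) := c :* (m :* x) :+ d :* (m :* y)) K.refl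

      join-terms : ∀ m m′ a p q r s x →
        (m K.+ m′ K.+ a K.* (p K.* q K.- r K.* s)) K.* x K.≈
        m K.* x K.+ m′ K.* x K.+ (a K.* p K.* (q K.* x) K.+ (K.- (a K.* r)) K.* (s K.* x))
      join-terms = solveᴷ 8 (λ m m′ a p q r s x →
        (m :+ m′ :+ a :* (p :* q :- r :* s)) :* x :=
        m :* x :+ m′ :* x :+ (a :* p :* (q :* x) :+ (:- (a :* r)) :* (s :* x))) K.refl

  opaque
    apply-linear : ∀ {n} (t : Tree n) w c d x y i →
      apply t w (λ j → c K.* x j K.+ d K.* y j) i K.≈ c K.* apply t w x i K.+ d K.* apply t w y i
    apply-linear t w c d x y i = K.trans
      (sum-cong-≋ (λ j → combine-terms (ι (matrix t w i j)) c d (x j) (y j)))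
      (K.trans (∑-distrib-+ (λ j → c K.* (ι (matrix t w i j) K.* x j)) (λ j → d K.* (ι (matrix t w i j) K.* y j)))
        (K.+-cong (K.sym (*-distribˡ-sum c (λ j → ι (matrix t w i j) K.* x j)))
                  (K.sym (*-distribˡ-sum d (λ j → ι (matrix t w i j) K.* y j)))))

    ι-edge : ∀ {n} a (w u i j : Fin n) →
      ι (edge a w u i j) K.≈ ι a K.* (e w i K.* e u j K.- e u i K.* e w j)
    ι-edge a w u i j = K.trans (ι.*-homo _ _) (K.*-congˡ
      (K.trans (ι.+-homo _ _) (K.+-cong (ι.*-homo _ _)
        (K.trans (ι.-‿homo _) (K.-‿cong (ι.*-homo _ _))))))

    apply-join : ∀ {n} (s t : Tree n) a pos ws wt x i →
      apply (join s t) ((a , pos) , ws , wt) x i K.≈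
      apply s ws x i K.+ apply t wt x i K.+
        (ι a K.* e (root s) i K.* x (root t) K.+ (K.- (ι a K.* e (root t) i)) K.* x (root s))
    apply-join {n} s t a pos ws wt x i = K.trans
      (sum-cong-≋ (λ j → K.trans
        (K.*-congʳ (K.trans (ι.+-homo _ _) (K.+-cong (ι.+-homo _ _) (ι-edge a (root s) (root t) i j))))
        (join-terms _ _ _ _ _ _ _ (x j))))
      (K.trans (∑-distrib-+ (λ j → As j K.+ At j) (λ j → c K.* Es j K.+ d K.* Et j))
        (K.+-cong (∑-distrib-+ As At)
          (K.trans (∑-distrib-+ (λ j → c K.* Es j) (λ j → d K.* Et j))
            (K.+-cong
              (K.trans (K.sym (*-distribˡ-sum c Es)) (K.*-congˡ (sum-e (root t) x)))
              (K.trans (K.sym (*-distribˡ-sum d Et)) (K.*-congˡ (sum-e (root s) x)))))))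
      where
      c d : K.Carrier
      c = ι a K.* e (root s) i
      d = K.- (ι a K.* e (root t) i)
      As At Es Et : Vector K.Carrier n
      As j = ι (matrix s ws i j) K.* x j
      At j = ι (matrix t wt i j) K.* x j
      Es j = e (root t) j K.* x j
      Et j = e (root s) j K.* x j

    apply-leaf : ∀ {n} (v : Fin n) x i → apply (leaf v) tt x i K.≈ K.0#
    apply-leaf v x i = sum-zero {f = λ j → ι 0# K.* x j} (λ j → K.trans (K.*-congʳ ι.0#-homo) (K.zeroˡ (x j)))

  -- (z − A) x is ρ at the root of t and 0 at its other vertices.
  SolvesAt : ∀ {n} (t : Tree n) → Weights t → K.Carrier → K.Carrier → Vector K.Carrier n → Set
  SolvesAt t w z ρ x = ∀ {i} → i ∈ᵗ t → z K.* x i K.≈ apply t w x i K.+ ρ K.* e (root t) i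

  private
    opaque
      -- The explicit zeros are what each partial solution contributes on the other part; with them
      -- the right-hand side has the shape produced by `apply-join` and `apply-linear`.
      join-eq : ∀ z xs xt os ot ew eu a fs gs ft gt →
        z K.* xs K.≈ os K.+ gs K.* ew → z K.* xt K.≈ ot K.+ gt K.* eu →
        z K.* (gt K.* xs K.+ (K.- (a K.* fs)) K.* xt) K.≈
        (gt K.* os K.+ (K.- (a K.* fs)) K.* K.0#) K.+ (gt K.* K.0# K.+ (K.- (a K.* fs)) K.* ot) K.+
          (a K.* ew K.* (gt K.* K.0# K.+ (K.- (a K.* fs)) K.* ft) K.+
            (K.- (a K.* eu)) K.* (gt K.* fs K.+ (K.- (a K.* fs)) K.* K.0#)) K.+
          (gs K.* gt K.+ a K.* a K.* (fs K.* ft)) K.* ew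
      join-eq z xs xt os ot ew eu a fs gs ft gt eqs eqt = K.trans
        (solveᴷ 6 (λ z xs xt a fs gt → z :* (gt :* xs :+ (:- (a :* fs)) :* xt) :=
          gt :* (z :* xs) :+ (:- (a :* fs)) :* (z :* xt)) K.refl z xs xt a fs gt)
        (K.trans (K.+-cong (K.*-congˡ eqs) (K.*-congˡ eqt))
          (solveᴷ 9 (λ os ot ew eu a fs gs ft gt →
            gt :* (os :+ gs :* ew) :+ (:- (a :* fs)) :* (ot :+ gt :* eu) :=
            (gt :* os :+ (:- (a :* fs)) :* :0) :+ (gt :* :0 :+ (:- (a :* fs)) :* ot) :+
              (a :* ew :* (gt :* :0 :+ (:- (a :* fs)) :* ft) :+
                (:- (a :* eu)) :* (gt :* fs :+ (:- (a :* fs)) :* :0)) :+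
              (gs :* gt :+ a :* a :* (fs :* ft)) :* ew)
            K.refl os ot ew eu a fs gs ft gt))

      combination-zero : ∀ {x y} c d → x K.≈ K.0# → y K.≈ K.0# → c K.* x K.+ d K.* y K.≈ K.0#
      combination-zero c d x≈0 y≈0 = K.trans (K.+-cong (K.*-congˡ x≈0) (K.*-congˡ y≈0))
        (solveᴷ 2 (λ c d → c :* :0 :+ d :* :0 := :0) K.refl c d)

      outside-eq : ∀ z p → z K.* K.0# K.≈ K.0# K.+ p K.* K.0#
      outside-eq = solveᴷ 2 (λ z p → z :* :0 := :0 :+ p :* :0) K.refl

  ∉⇒root≢ : ∀ {n} (t : Tree n) {i} → ¬ (i ∈ᵗ t) → root t ≢ i
  ∉⇒root≢ t i∉t ≡.refl = i∉t (root∈ t)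

  opaque
    -- On a join take `gt * xs - a * fs * xt`: at the root of `t` the defect `- a * fs * gt` is
    -- cancelled by the edge term, and at the root of `s` the two contributions add up to
    -- `charPoly`. This is the root column of the adjugate of `z - A`.
    canonical-solution : ∀ {n} (t : Tree n) (w : Weights t) z → Simple t →
      ∃ λ (x : Vector K.Carrier n) → (∀ {i} → ¬ (i ∈ᵗ t) → x i K.≈ K.0#) ×
        x (root t) K.≈ rootMinor t w z × SolvesAt t w z (charPoly t w z) x
    canonical-solution (leaf v) w z _ = e v , (λ i∉ → e-≢ {i = v} (λ { ≡.refl → i∉ ≡.refl })) , e-refl v ,
      λ { ≡.refl → K.sym (K.trans (K.+-congʳ (apply-leaf v (e v) v)) (K.+-identityˡ _)) }
    canonical-solution {n} (join s t) ((a , pos) , ws , wt) z (simple-s , simple-t , disjoint)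
      with canonical-solution s ws z simple-s | canonical-solution t wt z simple-t
    ... | xs , xs-off , xs-root , xs-solves | xt , xt-off , xt-root , xt-solves =
      x , off , x-root , λ {i} _ → solves i
      where
      fs gs ft gt d : K.Carrier
      fs = rootMinor s ws z
      gs = charPoly s ws z
      ft = rootMinor t wt z
      gt = charPoly t wt z
      d  = K.- (ι a K.* fs)
      x : Vector K.Carrier n
      x i = gt K.* xs i K.+ d K.* xt i
      off : ∀ {i} → ¬ (i ∈ᵗ join s t) → x i K.≈ K.0#
      off i∉ = combination-zero gt d (xs-off (i∉ ∘ inj₁)) (xt-off (i∉ ∘ inj₂))
      xt-on-s : ∀ {i} → i ∈ᵗ s → xt i K.≈ K.0#
      xt-on-s i∈s = xt-off (disjoint i∈s)
      xs-on-t : ∀ {i} → i ∈ᵗ t → xs i K.≈ K.0#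
      xs-on-t i∈t = xs-off (λ i∈s → disjoint i∈s i∈t)
      x-root-t : x (root t) K.≈ gt K.* K.0# K.+ d K.* ft
      x-root-t = K.+-cong (K.*-congˡ (xs-on-t (root∈ t))) (K.*-congˡ xt-root)
      x-root-s : x (root s) K.≈ gt K.* fs K.+ d K.* K.0#
      x-root-s = K.+-cong (K.*-congˡ xs-root) (K.*-congˡ (xt-on-s (root∈ s)))
      x-root : x (root s) K.≈ fs K.* gt
      x-root = K.trans x-root-s (solveᴷ 3 (λ f g d → g :* f :+ d :* :0 := f :* g) K.refl fs gt d)
      -- Off `r` both sides vanish, so the equations of the two parts hold at every index and can be
      -- combined.
      everywhere : ∀ (r : Tree n) (w : Weights r) (y : Vector K.Carrier n) p → (∀ {i} → ¬ (i ∈ᵗ r) → y i K.≈ K.0#) →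
        SolvesAt r w z p y → ∀ i → z K.* y i K.≈ apply r w y i K.+ p K.* e (root r) i
      everywhere r w y p y-off solves i with i ∈ᵗ? r
      ... | yes i∈r = solves i∈r
      ... | no  i∉r = K.trans (K.*-congˡ (y-off i∉r)) (K.trans (outside-eq z p)
        (K.sym (K.+-cong (apply-outside r w y i∉r) (K.*-congˡ (e-≢ (∉⇒root≢ r i∉r))))))
      solves : ∀ i → z K.* x i K.≈ apply (join s t) ((a , pos) , ws , wt) x i K.+
                 (gs K.* gt K.+ ι a K.* ι a K.* (fs K.* ft)) K.* e (root s) i
      solves i = K.trans
        (join-eq z (xs i) (xt i) (apply s ws xs i) (apply t wt xt i) (e (root s) i) (e (root t) i)
          (ι a) fs gs ft gt (everywhere s ws xs gs xs-off xs-solves i) (everywhere t wt xt gt xt-off xt-solves i))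
        (K.+-congʳ (K.sym (K.trans (apply-join s t a pos ws wt x i)
          (K.+-cong
            (K.+-cong
              (K.trans (apply-linear s ws gt d xs xt i) (K.+-congˡ (K.*-congˡ (apply-vanishing s ws xt-on-s i))))
              (K.trans (apply-linear t wt gt d xs xt i) (K.+-congʳ (K.*-congˡ (apply-vanishing t wt xs-on-t i)))))
            (K.+-cong (K.*-congˡ x-root-t) (K.*-congˡ x-root-s))))))

  private
    opaque
      s-part : ∀ o a ew xu xw ρ →
        o K.+ K.0# K.+ (a K.* ew K.* xu K.+ (K.- (a K.* K.0#)) K.* xw) K.+ ρ K.* ew K.≈
        o K.+ (ρ K.+ a K.* xu) K.* ew
      s-part = solveᴷ 6 (λ o a ew xu xw ρ →
        o :+ :0 :+ (a :* ew :* xu :+ (:- (a :* :0)) :* xw) :+ ρ :* ew := o :+ (ρ :+ a :* xu) :* ew) K.refl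

      t-part : ∀ o a eu xu xw ρ →
        K.0# K.+ o K.+ (a K.* K.0# K.* xu K.+ (K.- (a K.* eu)) K.* xw) K.+ ρ K.* K.0# K.≈
        o K.+ (K.- (a K.* xw)) K.* eu
      t-part = solveᴷ 6 (λ o a eu xu xw ρ →
        :0 :+ o :+ (a :* :0 :* xu :+ (:- (a :* eu)) :* xw) :+ ρ :* :0 := o :+ (:- (a :* xw)) :* eu) K.refl

      -- Eliminates `xu` without dividing by anything that may be zero: multiplying the first
      -- relation by `gt` produces `xu * gt`, which the second one replaces.
      join-relation : ∀ xw xu a ρ fs gs ft gt →
        xw K.* gs K.≈ (ρ K.+ a K.* xu) K.* fs → xu K.* gt K.≈ (K.- (a K.* xw)) K.* ft →
        xw K.* (gs K.* gt K.+ a K.* a K.* (fs K.* ft)) K.≈ ρ K.* (fs K.* gt)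
      join-relation xw xu a ρ fs gs ft gt eqs eqt = K.trans
        (solveᴷ 6 (λ xw a fs gs ft gt → xw :* (gs :* gt :+ a :* a :* (fs :* ft)) :=
          xw :* gs :* gt :+ xw :* a :* a :* (fs :* ft)) K.refl xw a fs gs ft gt)
        (K.trans (K.+-congʳ (K.*-congʳ eqs))
        (K.trans (solveᴷ 7 (λ xw xu a ρ fs ft gt →
            (ρ :+ a :* xu) :* fs :* gt :+ xw :* a :* a :* (fs :* ft) :=
            ρ :* (fs :* gt) :+ a :* fs :* (xu :* gt) :+ xw :* a :* a :* (fs :* ft)) K.refl xw xu a ρ fs ft gt)
        (K.trans (K.+-congʳ (K.+-congˡ (K.*-congˡ eqt)))
          (solveᴷ 6 (λ xw a ρ fs ft gt →
            ρ :* (fs :* gt) :+ a :* fs :* ((:- (a :* xw)) :* ft) :+ xw :* a :* a :* (fs :* ft) :=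
            ρ :* (fs :* gt)) K.refl xw a ρ fs ft gt))))

  opaque
    -- Each part sees the other through a single edge, which acts at its root and so only changes
    -- the right-hand side there.
    solves-left : ∀ {n} (s t : Tree n) a pos ws wt z ρ x → Disjoint s t →
      SolvesAt (join s t) ((a , pos) , ws , wt) z ρ x → SolvesAt s ws z (ρ K.+ ι a K.* x (root t)) x
    solves-left s t a pos ws wt z ρ x disjoint solves {i} i∈s = K.trans (solves (inj₁ i∈s))
      (K.trans (K.+-congʳ (K.trans (apply-join s t a pos ws wt x i)
          (K.+-cong (K.+-congˡ (apply-outside t wt x (disjoint i∈s)))
            (K.+-congˡ (K.*-congʳ (K.-‿cong (K.*-congˡ (e-≢ (∉⇒root≢ t (disjoint i∈s))))))))))
        (s-part _ _ _ _ _ _))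

    solves-right : ∀ {n} (s t : Tree n) a pos ws wt z ρ x → Disjoint s t →
      SolvesAt (join s t) ((a , pos) , ws , wt) z ρ x → SolvesAt t wt z (K.- (ι a K.* x (root s))) x
    solves-right s t a pos ws wt z ρ x disjoint solves {i} i∈t = K.trans (solves (inj₂ i∈t))
      (K.trans (K.+-cong (K.trans (apply-join s t a pos ws wt x i)
          (K.+-cong (K.+-congʳ (apply-outside s ws x i∉s))
            (K.+-congʳ (K.*-congʳ (K.*-congˡ (e-≢ (∉⇒root≢ s i∉s)))))))
          (K.*-congˡ (e-≢ (∉⇒root≢ s i∉s))))
        (t-part _ _ _ _ _ _))
      where
      i∉s : ¬ (i ∈ᵗ s)
      i∉s i∈s = disjoint i∈s i∈t

    root-relation : ∀ {n} (t : Tree n) w z ρ x → Simple t → SolvesAt t w z ρ x →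
      x (root t) K.* charPoly t w z K.≈ ρ K.* rootMinor t w z
    root-relation (leaf v) w z ρ x _ solves = K.trans (K.*-comm _ _) (K.trans (solves ≡.refl)
      (K.trans (K.+-cong (apply-leaf v x v) (K.*-congˡ (e-refl v)))
        (K.+-identityˡ _)))
    root-relation (join s t) ((a , pos) , ws , wt) z ρ x (simple-s , simple-t , disjoint) solves =
      join-relation _ _ _ _ _ _ _ _
        (root-relation s ws z _ x simple-s (solves-left s t a pos ws wt z ρ x disjoint solves))
        (root-relation t wt z _ x simple-t (solves-right s t a pos ws wt z ρ x disjoint solves))

  module Spectrum
    (zero-product : ∀ z w → z K.* w K.≈ K.0# → z K.≈ K.0# ⊎ w K.≈ K.0#)
    (ι-pos : ∀ {a} → 0# < a → ¬ (ι a K.≈ K.0#))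
    where

    Nondegenerate : ∀ {n} (t : Tree n) → Weights t → K.Carrier → Set
    Nondegenerate t w z = ¬ (rootMinor t w z K.≈ K.0# × charPoly t w z K.≈ K.0#)

    private
      opaque
        *-zeroˡ′ : ∀ {x} y → x K.≈ K.0# → x K.* y K.≈ K.0#
        *-zeroˡ′ y x≈0 = K.trans (K.*-congʳ x≈0) (K.zeroˡ y)

        *-zeroʳ′ : ∀ x {y} → y K.≈ K.0# → x K.* y K.≈ K.0#
        *-zeroʳ′ x y≈0 = K.trans (K.*-congˡ y≈0) (K.zeroʳ x)

        +-zero : ∀ {x y} → x K.≈ K.0# → y K.≈ K.0# → x K.+ y K.≈ K.0#
        +-zero x≈0 y≈0 = K.trans (K.+-cong x≈0 y≈0) (K.+-identityˡ _)

        -‿zero : ∀ {x} → x K.≈ K.0# → K.- x K.≈ K.0#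
        -‿zero x≈0 = K.trans (K.-‿cong x≈0) (solveᴷ 0 (:- :0 := :0) K.refl)

    opaque
      -- With the root value and `ρ` zero, the relations of the two parts give `xu * gt = 0` and
      -- `a * xu * fs = 0`. If `xu` were nonzero, `gt` and `fs` would vanish, hence also `fs * gt`
      -- and `gs * gt + a² fs ft`, against nondegeneracy. The same two formulas pass nondegeneracy
      -- on to both parts.
      vanishes : ∀ {n} (t : Tree n) w z ρ x → Simple t → Nondegenerate t w z → SolvesAt t w z ρ x →
        x (root t) K.≈ K.0# → ρ K.≈ K.0# → ∀ {i} → i ∈ᵗ t → x i K.≈ K.0#
      vanishes (leaf v) w z ρ x _ _ _ xr≈0 _ ≡.refl = xr≈0
      vanishes (join s t) ((a , pos) , ws , wt) z ρ x (simple-s , simple-t , disjoint) nondeg solves xw≈0 ρ≈0 =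
        [ vanishes s ws z _ x simple-s nondeg-s solves-s xw≈0 (+-zero ρ≈0 (*-zeroʳ′ _ xu≈0))
        , vanishes t wt z _ x simple-t nondeg-t solves-t xu≈0 (-‿zero (*-zeroʳ′ _ xw≈0)) ]′
        where
        fs gs ft gt : K.Carrier
        fs = rootMinor s ws z
        gs = charPoly s ws z
        ft = rootMinor t wt z
        gt = charPoly t wt z
        nondeg-s : Nondegenerate s ws z
        nondeg-s (fs≈0 , gs≈0) = nondeg (*-zeroˡ′ gt fs≈0 ,
          +-zero (*-zeroˡ′ gt gs≈0) (*-zeroʳ′ _ (*-zeroˡ′ ft fs≈0)))
        nondeg-t : Nondegenerate t wt z
        nondeg-t (ft≈0 , gt≈0) = nondeg (*-zeroʳ′ fs gt≈0 ,
          +-zero (*-zeroʳ′ gs gt≈0) (*-zeroʳ′ _ (*-zeroʳ′ fs ft≈0)))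
        solves-s : SolvesAt s ws z (ρ K.+ ι a K.* x (root t)) x
        solves-s = solves-left s t a pos ws wt z ρ x disjoint solves
        solves-t : SolvesAt t wt z (K.- (ι a K.* x (root s))) x
        solves-t = solves-right s t a pos ws wt z ρ x disjoint solves
        xu≈0 : x (root t) K.≈ K.0#
        xu≈0 with zero-product (x (root t)) gt
          (K.trans (root-relation t wt z _ x simple-t solves-t) (*-zeroˡ′ ft (-‿zero (*-zeroʳ′ _ xw≈0))))
        ... | inj₁ xu≈0 = xu≈0
        ... | inj₂ gt≈0 with zero-product (ρ K.+ ι a K.* x (root t)) fs
          (K.trans (K.sym (root-relation s ws z _ x simple-s solves-s)) (*-zeroˡ′ gs xw≈0))
        ...   | inj₂ fs≈0 = ⊥-elim (nondeg (*-zeroˡ′ gt fs≈0 ,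
                  +-zero (*-zeroʳ′ gs gt≈0) (*-zeroʳ′ _ (*-zeroˡ′ ft fs≈0))))
        ...   | inj₁ axu≈0 with zero-product (ι a) (x (root t))
                  (K.trans (K.sym (K.+-identityˡ _)) (K.trans (K.+-congʳ (K.sym ρ≈0)) axu≈0))
        ...     | inj₁ a≈0  = ⊥-elim (ι-pos pos a≈0)
        ...     | inj₂ xu≈0 = xu≈0

    Spanning : ∀ {n} → Tree n → Set
    Spanning t = ∀ v → v ∈ᵗ t

    -- Over the complex numbers this unfolds to `IsEigenvalue`.
    IsEigenvalueOf : ∀ {n} → Matrix n → K.Carrier → Set
    IsEigenvalueOf {n} A z = ∃ λ (x : Vector K.Carrier n) →
      ¬ (∀ i → x i K.≈ K.0#) × (∀ i → sum (λ j → ι (A i j) K.* x j) K.≈ z K.* x i)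

    opaque
      -- An eigenvector solves the system with `ρ = 0`, so its root value times `charPoly` is 0, and
      -- `vanishes` rules out a zero root value. Conversely, the canonical solution is an
      -- eigenvector: its root value is `rootMinor`, which is nonzero by nondegeneracy.
      eigenvalue⇔ : ∀ {n} (t : Tree n) w z → Simple t → Spanning t → Nondegenerate t w z →
        IsEigenvalueOf (matrix t w) z ⇔ (charPoly t w z K.≈ K.0#)
      eigenvalue⇔ t w z simple spanning nondeg = mk⇔ to from
        where
        to : IsEigenvalueOf (matrix t w) z → charPoly t w z K.≈ K.0#
        to (x , x≉0 , Ax≈zx) = conclude (zero-product (x (root t)) (charPoly t w z)
          (K.trans (root-relation t w z K.0# x simple solves) (K.zeroˡ _)))
          where
          solves : SolvesAt t w z K.0# x
          solves {i} _ = K.trans (K.sym (Ax≈zx i)) (K.sym (K.trans (K.+-congˡ (K.zeroˡ _)) (K.+-identityʳ _)))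
          conclude : x (root t) K.≈ K.0# ⊎ charPoly t w z K.≈ K.0# → charPoly t w z K.≈ K.0#
          conclude (inj₂ g≈0)  = g≈0
          conclude (inj₁ xr≈0) = ⊥-elim (x≉0 (λ i →
            vanishes t w z K.0# x simple nondeg solves xr≈0 K.refl (spanning i)))
        from : charPoly t w z K.≈ K.0# → IsEigenvalueOf (matrix t w) z
        from g≈0 with canonical-solution t w z simple
        ... | x , _ , xr≈f , solves = x , (λ x≈0 → nondeg (K.trans (K.sym xr≈f) (x≈0 (root t)) , g≈0)) ,
          λ i → K.sym (K.trans (solves (spanning i)) (K.trans (K.+-congˡ (*-zeroˡ′ _ g≈0)) (K.+-identityʳ _)))

      apply-delete : ∀ {m} (t : Tree (suc m)) w v x i → x v K.≈ K.0# →
        apply t w x i K.≈ sum (λ j → ι (matrix t w i (punchIn v j)) K.* x (punchIn v j))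
      apply-delete t w v x i xv≈0 = K.trans (sum-remove {i = v} (λ j → ι (matrix t w i j) K.* x j))
        (K.trans (K.+-congʳ (*-zeroʳ′ _ xv≈0)) (K.+-identityˡ _))

      e-punchIn : ∀ {m} (v : Fin (suc m)) k → e v (punchIn v k) K.≈ K.0#
      e-punchIn v k = e-≢ (λ v≡ → Fin.punchInᵢ≢i v k (≡.sym v≡))

      -- The value 0 at the root leaves the equations at the other vertices unchanged, and `ρ` is
      -- chosen as the defect at the root.
      extend-eigenvector : ∀ {m} (t : Tree (suc m)) w z (x : Vector K.Carrier m) →
        (∀ k → sum (λ j → ι (delete (matrix t w) (root t) k j) K.* x j) K.≈ z K.* x k) →
        ∃₂ λ ρ y → y (root t) K.≈ K.0# × (∀ k → y (punchIn (root t) k) K.≈ x k) × SolvesAt t w z ρ y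
      extend-eigenvector {m} t w z x Ax≈zx = ρ , y , yv≈0 , y≈x , λ {i} _ → solves i
        where
        v : Fin (suc m)
        v = root t
        y : Vector K.Carrier (suc m)
        y = insertAt x v K.0#
        ρ : K.Carrier
        ρ = K.- apply t w y v
        yv≈0 : y v K.≈ K.0#
        yv≈0 = K.reflexive (insertAt-lookup x v K.0#)
        y≈x : ∀ k → y (punchIn v k) K.≈ x k
        y≈x k = K.reflexive (insertAt-punchIn x v K.0# k)
        away : ∀ k → z K.* y (punchIn v k) K.≈ apply t w y (punchIn v k) K.+ ρ K.* e v (punchIn v k)
        away k = K.trans (K.*-congˡ (y≈x k)) (K.trans (K.sym (Ax≈zx k)) (K.sym
          (K.trans (K.+-cong
              (K.trans (apply-delete t w v y (punchIn v k) yv≈0)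
                (sum-cong-≋ {x = λ j → ι (matrix t w (punchIn v k) (punchIn v j)) K.* y (punchIn v j)}
                            {y = λ j → ι (matrix t w (punchIn v k) (punchIn v j)) K.* x j}
                            (λ j → K.*-congˡ (y≈x j))))
              (*-zeroʳ′ ρ (e-punchIn v k)))
            (K.+-identityʳ _))))
        solves : ∀ i → z K.* y i K.≈ apply t w y i K.+ ρ K.* e v i
        solves i with v Fin.≟ i
        ... | yes ≡.refl = K.trans (*-zeroʳ′ z yv≈0)
          (K.sym (K.trans (K.+-congˡ (K.trans (K.*-congˡ (e-refl v)) (K.*-identityʳ ρ))) (K.-‿inverseʳ _)))
        ... | no v≢i = ≡.subst (λ i → z K.* y i K.≈ apply t w y i K.+ ρ K.* e v i)
                         (Fin.punchIn-punchOut v≢i) (away (punchOut v≢i))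

      -- The roles of root value and `ρ` are exchanged: the extended eigenvector is 0 at the root,
      -- so `ρ` times `rootMinor` is 0, and `vanishes` rules out `ρ = 0`. Conversely, if `rootMinor`
      -- is 0, the canonical solution is 0 at the root; were it 0 elsewhere too, `charPoly` would
      -- vanish as well.
      delete-eigenvalue⇔ : ∀ {m} (t : Tree (suc m)) w z → Simple t → Spanning t → Nondegenerate t w z →
        IsEigenvalueOf (delete (matrix t w) (root t)) z ⇔ (rootMinor t w z K.≈ K.0#)
      delete-eigenvalue⇔ {m} t w z simple spanning nondeg = mk⇔ to from
        where
        v : Fin (suc m)
        v = root t
        to : IsEigenvalueOf (delete (matrix t w) v) z → rootMinor t w z K.≈ K.0#
        to (x , x≉0 , Ax≈zx) with extend-eigenvector t w z x Ax≈zx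
        ... | ρ , y , yv≈0 , y≈x , solves with zero-product ρ (rootMinor t w z)
              (K.trans (K.sym (root-relation t w z ρ y simple solves)) (*-zeroˡ′ _ yv≈0))
        ...   | inj₂ f≈0 = f≈0
        ...   | inj₁ ρ≈0 = ⊥-elim (x≉0 (λ k → K.trans (K.sym (y≈x k))
          (vanishes t w z ρ y simple nondeg solves yv≈0 ρ≈0 (spanning (punchIn v k)))))
        from : rootMinor t w z K.≈ K.0# → IsEigenvalueOf (delete (matrix t w) v) z
        from f≈0 with canonical-solution t w z simple
        ... | x , _ , xv≈f , solves = x ∘ punchIn v , nonzero , eigen
          where
          xv≈0 : x v K.≈ K.0#
          xv≈0 = K.trans xv≈f f≈0
          eigen : ∀ k → sum (λ j → ι (matrix t w (punchIn v k) (punchIn v j)) K.* x (punchIn v j)) K.≈ z K.* x (punchIn v k)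
          eigen k = K.sym (K.trans (solves (spanning (punchIn v k)))
            (K.trans (K.+-cong (apply-delete t w v x (punchIn v k) xv≈0) (*-zeroʳ′ _ (e-punchIn v k)))
              (K.+-identityʳ _)))
          nonzero : ¬ (∀ k → x (punchIn v k) K.≈ K.0#)
          nonzero x≈0 = nondeg (f≈0 , K.trans (K.sym (K.*-identityʳ _)) (K.trans (K.*-congˡ (K.sym (e-refl v)))
            (K.trans (K.sym (K.+-identityˡ _)) (K.trans (K.+-congʳ (K.sym Axv≈0))
              (K.trans (K.sym (solves (root∈ t))) (*-zeroʳ′ z xv≈0))))))
            where
            Axv≈0 : apply t w x v K.≈ K.0#
            Axv≈0 = K.trans (apply-delete t w v x v xv≈0)
              (sum-zero {f = λ j → ι (matrix t w v (punchIn v j)) K.* x (punchIn v j)} (λ j → *-zeroʳ′ _ (x≈0 j)))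

-- Cardinality and parity of vertex sets.

∈─⇒∉ : ∀ {n} {p q : Subset n} {x} → x ∈ p ─ q → x ∉ q
∈─⇒∉ {p = _ ∷ p} {true ∷ q} ()          here
∈─⇒∉ {p = _ ∷ p} {_ ∷ q} (there x∈p─q) (there x∈q) = ∈─⇒∉ x∈p─q x∈q

∈-⇒≢ : ∀ {n} {p : Subset n} {x y} → x ∈ p Subset.- y → x ≢ y
∈-⇒≢ {y = y} x∈p-y ≡.refl = ∈─⇒∉ x∈p-y (x∈⁅x⁆ y)

∣─∣+∣∣ : ∀ {n} (p q : Subset n) → q ⊆ p → ∣ p ─ q ∣ ℕ.+ ∣ q ∣ ≡ ∣ p ∣
∣─∣+∣∣ []          []          q⊆p = ≡.refl
∣─∣+∣∣ (true  ∷ p) (true  ∷ q) q⊆p = ≡.trans (ℕ.+-suc _ _) (≡.cong suc (∣─∣+∣∣ p q (drop-∷-⊆ q⊆p)))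
∣─∣+∣∣ (true  ∷ p) (false ∷ q) q⊆p = ≡.cong suc (∣─∣+∣∣ p q (drop-∷-⊆ q⊆p))
∣─∣+∣∣ (false ∷ p) (true  ∷ q) q⊆p with q⊆p here
... | ()
∣─∣+∣∣ (false ∷ p) (false ∷ q) q⊆p = ∣─∣+∣∣ p q (drop-∷-⊆ q⊆p)

∈⇒∣∣>0 : ∀ {n} {p : Subset n} {x} → x ∈ p → 0 ℕ.< ∣ p ∣
∈⇒∣∣>0 x∈p = ℕ.≤-<-trans z≤n (x∈p⇒∣p-x∣<∣p∣ x∈p)

even+odd : ∀ {m n} → 2 ∣ m → 2 ∤ n → 2 ∤ m ℕ.+ n
even+odd 2∣m 2∤n 2∣m+n = 2∤n (∣m+n∣m⇒∣n 2∣m+n 2∣m)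

odd+even : ∀ {m n} → 2 ∤ m → 2 ∣ n → 2 ∤ m ℕ.+ n
odd+even {m} {n} 2∤m 2∣n 2∣m+n = 2∤m (∣m+n∣m⇒∣n (≡.subst (2 ∣_) (ℕ.+-comm m n) 2∣m+n) 2∣n)

order : Parity → ℕ → ℕ
order 1ℙ k = 1 ℕ.+ k ℕ.* 2
order 0ℙ k = 2 ℕ.+ k ℕ.* 2

order-odd : ∀ k → 2 ∤ order 1ℙ k
order-odd k 2∣1+2k with ∣1⇒≡1 (∣m+n∣m⇒∣n (≡.subst (2 ∣_) (ℕ.+-comm 1 (k ℕ.* 2)) 2∣1+2k) (n∣m*n k))
... | ()

order-even : ∀ k → 2 ∣ order 0ℙ k
order-even k = n∣m*n (suc k)

-- From NEB to balanced trees.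

module TreeDecomposition {n : ℕ} (G : Graph n) where
  open Subset using (_-_)
  open Graph G renaming (sym to ~-sym; irrefl to ~-irrefl)
  open DecMembership (Fin._≟_ {n}) using () renaming (_∈?_ to _∈ˡ?_)

  -- A walk together with its list of vertices, the form in which `IsCycle` takes it.
  data Path (S : Subset n) : Fin n → Fin n → List (Fin n) → Set where
    end  : ∀ {u} → u ∈ S → Path S u u (u ∷ [])
    step : ∀ {u v w L} → u ∈ S → u ~ v → Path S v w L → Path S u w (u ∷ L)

  path-suffix : ∀ {S u v L x} → Path S u v L → Unique L → x ∈ˡ L → ∃ λ L′ → Path S x v L′ × Unique L′
  path-suffix p@(end _)      uniq       (here ≡.refl) = _ , p , uniq
  path-suffix p@(step _ _ _) uniq       (here ≡.refl) = _ , p , uniq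
  path-suffix (step _ _ p)   (_ ∷ uniq) (there x∈L)   = path-suffix p uniq x∈L

  -- Loop erasure: if the new first vertex already lies on the simple path found for the rest, the
  -- path is cut back to its suffix from there.
  simplePath : ∀ {S u v} → v ∈ S → Star (Adjacent-in G S) u v → ∃ λ L → Path S u v L × Unique L
  simplePath v∈S ε = _ , end v∈S , [] ∷ []
  simplePath {u = u} v∈S ((u∈S , _ , u~x) ◅ walk) with simplePath v∈S walk
  ... | L , p , uniq with u ∈ˡ? L
  ...   | yes u∈L = path-suffix p uniq u∈L
  ...   | no  u∉L = u ∷ L , step u∈S u~x p , ¬Any⇒All¬ L u∉L ∷ uniq

  path-⊆ : ∀ {S u v L} → Path S u v L → All (_∈ S) L
  path-⊆ (end u∈S)      = u∈S ∷ []
  path-⊆ (step u∈S _ p) = u∈S ∷ path-⊆ p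

  path-linked : ∀ {S u v L x w} → x ~ u → Path S u v L → v ~ w → Linked _~_ (x ∷ (L ∷ʳ w))
  path-linked x~u (end _)        v~w = x~u ∷ v~w ∷ [-]
  path-linked x~u (step _ u~y p) v~w = x~u ∷ path-linked u~y p v~w

  path-length : ∀ {S u v L} → u ≢ v → Path S u v L → 2 ℕ.≤ length L
  path-length u≢v (end _)               = contradiction ≡.refl u≢v
  path-length u≢v (step _ _ (end _))      = s≤s (s≤s z≤n)
  path-length u≢v (step _ _ (step _ _ _)) = s≤s (s≤s z≤n)

  -- Otherwise a simple path from `u` to `u′` inside `S`, which avoids `w`, is closed to a cycle by
  -- the two edges at `w`.
  unique-neighbour : (∀ c → ¬ IsCycle G c) → ∀ {S w u u′} → w ∉ S → w ~ u → w ~ u′ → u′ ∈ S →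
    Star (Adjacent-in G S) u u′ → u ≡ u′
  unique-neighbour acyclic {S} {w} {u} {u′} w∉S w~u w~u′ u′∈S walk with u Fin.≟ u′
  ... | yes u≡u′ = u≡u′
  ... | no  u≢u′ with simplePath u′∈S walk
  ...   | L , p , uniq = contradiction
    (path-length u≢u′ p , All.map (λ { x∈S ≡.refl → w∉S x∈S }) (path-⊆ p) ∷ uniq ,
     path-linked w~u p (~-sym w~u′))
    (acyclic (w ∷ L))

  adjacent-sym : ∀ {S x y} → Adjacent-in G S x y → Adjacent-in G S y x
  adjacent-sym (x∈S , y∈S , x~y) = y∈S , x∈S , ~-sym x~y

  Closed : Subset n → Subset n → Set
  Closed S X = ∀ {x y} → x ∈ X → y ∈ S → x ~ y → y ∈ X

  closed-walk : ∀ {S X x y} → Closed S X → x ∈ X → Star (Adjacent-in G S) x y → y ∈ X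
  closed-walk closed x∈X ε                           = x∈X
  closed-walk closed x∈X ((_ , y∈S , x~y) ◅ walk) = closed-walk closed (closed x∈X y∈S x~y) walk

  private
    -- Adds a vertex of `S` adjacent to `X` as long as there is one. Every addition enlarges `X`,
    -- which has at most `n` vertices, so the budget `k` with `n ≤ k + ∣ X ∣` cannot run out.
    grow : ∀ k S u X → n ℕ.≤ k ℕ.+ ∣ X ∣ → u ∈ X → X ⊆ S →
      (∀ {x} → x ∈ X → Star (Adjacent-in G S) u x) →
      ∃ λ C → u ∈ C × C ⊆ S × (∀ {x} → x ∈ C → Star (Adjacent-in G S) u x) × Closed S C
    grow k S u X n≤k+∣X∣ u∈X X⊆S reach
      with Fin.any? (λ x → Fin.any? (λ y → (x ∈? X) ×-dec ((y ∈? S) ×-dec (¬? (y ∈? X) ×-dec (x ~? y)))))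
    ... | no stuck = X , u∈X , X⊆S , reach , closed
      where
      closed : Closed S X
      closed {x} {y} x∈X y∈S x~y with y ∈? X
      ... | yes y∈X = y∈X
      ... | no  y∉X = contradiction (x , y , x∈X , y∈S , y∉X , x~y) stuck
    ... | yes (x , y , x∈X , y∈S , y∉X , x~y) = continue k n≤k+∣X∣
      where
      X′ : Subset n
      X′ = X ∪ ⁅ y ⁆
      bigger : ∣ X ∣ ℕ.< ∣ X′ ∣
      bigger = p⊂q⇒∣p∣<∣q∣ ((λ x∈X → x∈p∪q⁺ (inj₁ x∈X)) , y , x∈p∪q⁺ (inj₂ (x∈⁅x⁆ y)) , y∉X)
      X′⊆S : X′ ⊆ S
      X′⊆S z∈X′ with x∈p∪q⁻ X ⁅ y ⁆ z∈X′
      ... | inj₁ z∈X = X⊆S z∈X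
      ... | inj₂ z∈y with x∈⁅y⁆⇒x≡y y z∈y
      ...   | ≡.refl = y∈S
      reach′ : ∀ {z} → z ∈ X′ → Star (Adjacent-in G S) u z
      reach′ z∈X′ with x∈p∪q⁻ X ⁅ y ⁆ z∈X′
      ... | inj₁ z∈X = reach z∈X
      ... | inj₂ z∈y with x∈⁅y⁆⇒x≡y y z∈y
      ...   | ≡.refl = reach x∈X ◅◅ ((X⊆S x∈X , y∈S , x~y) ◅ ε)
      continue : ∀ k → n ℕ.≤ k ℕ.+ ∣ X ∣ →
        ∃ λ C → u ∈ C × C ⊆ S × (∀ {x} → x ∈ C → Star (Adjacent-in G S) u x) × Closed S C
      continue zero    n≤∣X∣   = contradiction (∣p∣≤n X′) (ℕ.<⇒≱ (ℕ.≤-<-trans n≤∣X∣ bigger))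
      continue (suc k) n≤1+k+∣X∣ = grow k S u X′
        (ℕ.≤-trans n≤1+k+∣X∣ (ℕ.≤-trans (ℕ.≤-reflexive (≡.sym (ℕ.+-suc k ∣ X ∣))) (ℕ.+-monoʳ-≤ k bigger)))
        (x∈p∪q⁺ (inj₁ u∈X)) X′⊆S reach′

  component : ∀ S u → u ∈ S → ∃ λ C → IsComponent G S C × u ∈ C
  component S u u∈S with grow n S u ⁅ u ⁆ (ℕ.m≤m+n n _) (x∈⁅x⁆ u)
    (λ x∈ → ≡.subst (_∈ S) (≡.sym (x∈⁅y⁆⇒x≡y u x∈)) u∈S)
    (λ x∈ → ≡.subst (Star (Adjacent-in G S) u) (≡.sym (x∈⁅y⁆⇒x≡y u x∈)) ε)
  ... | C , u∈C , C⊆S , reach , closed = C , ((u , u∈C) , C⊆S , λ x x∈C y → mk⇔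
      (λ y∈C → reverse adjacent-sym (reach x∈C) ◅◅ reach y∈C)
      (closed-walk closed x∈C)) , u∈C

  component-closed : ∀ {S C} → IsComponent G S C → Closed S C
  component-closed (_ , C⊆S , conn) {x} {y} x∈C y∈S x~y =
    Equivalence.from (conn x x∈C y) ((C⊆S x∈C , y∈S , x~y) ◅ ε)

  restrict-walk : ∀ {S C x y} → Closed S C → x ∈ C → Star (Adjacent-in G S) x y → Star (Adjacent-in G C) x y
  restrict-walk closed x∈C ε                          = ε
  restrict-walk closed x∈C ((_ , y∈S , x~y) ◅ walk) with closed x∈C y∈S x~y
  ... | y∈C = (x∈C , y∈C , x~y) ◅ restrict-walk closed y∈C walk

  -- A form of NEB that survives detaching a branch, whereas the constructor `branch` asks for two
  -- vertices. For a single vertex the conditions on components hold vacuously; `reach` adds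
  -- connectedness.
  record Branching (S : Subset n) (w : Fin n) : Set where
    field
      root∈S   : w ∈ S
      reach    : ∀ {x} → x ∈ S → Star (Adjacent-in G S) w x
      odd      : 2 ∤ ∣ S ∣ → ∀ C → ¬ IsOddComponent G (S - w) C
      even     : 2 ∣ ∣ S ∣ → ∀ {C D} → IsOddComponent G (S - w) C → IsOddComponent G (S - w) D → C ≡ D
      branches : ∀ u → u ∈ S → w ~ u → ∀ C → IsComponent G (S - w) C → u ∈ C → NEB-on G C u

  NEB⇒branching : ∀ {S w} → NEB-on G S w → (∀ {x} → x ∈ S → Star (Adjacent-in G S) w x) → Branching S w
  NEB⇒branching (branch w∈S _ even odd branches) reach = record
    { root∈S   = w∈S
    ; reach    = reach
    ; odd      = odd
    ; even     = λ 2∣∣S∣ C-odd D-odd → let (_ , _ , unique) = even 2∣∣S∣ in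
                   ≡.trans (≡.sym (unique C-odd)) (unique D-odd)
    ; branches = branches
    }
  NEB⇒branching {S} {w} (single w∈S ∣S∣≡1) reach = record
    { root∈S   = w∈S
    ; reach    = reach
    ; odd      = λ _ C C-odd → no-component (proj₁ C-odd)
    ; even     = λ _ C-odd → ⊥-elim (no-component (proj₁ C-odd))
    ; branches = λ u _ _ C comp _ → ⊥-elim (no-component comp)
    }
    where
    no-component : ∀ {C} → ¬ IsComponent G (S - w) C
    no-component ((x , x∈C) , C⊆ , _) = ℕ.<-irrefl ≡.refl (ℕ.<-≤-trans
      (ℕ.≤-<-trans (∈⇒∣∣>0 (C⊆ x∈C)) (x∈p⇒∣p-x∣<∣p∣ w∈S)) (ℕ.≤-reflexive ∣S∣≡1))

  module Detach {S w} (B : Branching S w) {u C} (u∈S : u ∈ S) (w~u : w ~ u)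
    (comp : IsComponent G (S - w) C) (u∈C : u ∈ C) where
    open Branching B

    C⊆S-w : C ⊆ S - w
    C⊆S-w = proj₁ (proj₂ comp)

    C⊆S : C ⊆ S
    C⊆S x∈C = p─q⊆p S ⁅ w ⁆ (C⊆S-w x∈C)

    w∉C : w ∉ C
    w∉C w∈C = ∈-⇒≢ (C⊆S-w w∈C) ≡.refl

    closed : Closed (S - w) C
    closed = component-closed comp

    ∣S∣≡ : ∣ S ─ C ∣ ℕ.+ ∣ C ∣ ≡ ∣ S ∣
    ∣S∣≡ = ∣─∣+∣∣ S C C⊆S

    exit : ∀ {x y} → x ∈ S → y ∈ C → x ~ y → x ∈ C ⊎ x ≡ w
    exit {x} x∈S y∈C x~y with x Fin.≟ w
    ... | yes x≡w = inj₂ x≡w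
    ... | no  x≢w = inj₁ (closed y∈C (x∈p∧x≢y⇒x∈p-y x∈S x≢w) (~-sym x~y))

    branch-rest : ∀ {x y} → x ∈ S ─ C → y ∈ C → x ~ y → x ≡ w
    branch-rest x∈S─C y∈C x~y with exit (p─q⊆p S C x∈S─C) y∈C x~y
    ... | inj₁ x∈C = contradiction x∈C (∈─⇒∉ x∈S─C)
    ... | inj₂ x≡w = x≡w

    -- Excursions of a walk into C leave and re-enter S ─ C through w.
    cut-walk : ∀ {x y} → x ∈ C ⊎ (x ∈ S ─ C × Star (Adjacent-in G (S ─ C)) w x) → Star (Adjacent-in G S) x y →
      y ∉ C → Star (Adjacent-in G (S ─ C)) w y
    cut-walk (inj₁ y∈C)      ε y∉C = contradiction y∈C y∉C
    cut-walk (inj₂ (_ , wy)) ε y∉C = wy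
    cut-walk {x} x-state (_◅_ {j = z} (x∈S , z∈S , x~z) walk) y∉C with z ∈? C
    ... | yes z∈C = cut-walk (inj₁ z∈C) walk y∉C
    ... | no  z∉C = cut-walk (inj₂ (z∈S─C , extend x-state)) walk y∉C
      where
      z∈S─C : z ∈ S ─ C
      z∈S─C = x∈p∧x∉q⇒x∈p─q z∈S z∉C
      extend : x ∈ C ⊎ (x ∈ S ─ C × Star (Adjacent-in G (S ─ C)) w x) → Star (Adjacent-in G (S ─ C)) w z
      extend (inj₂ (x∈ , wx)) = wx ◅◅ ((x∈ , z∈S─C , x~z) ◅ ε)
      extend (inj₁ x∈C) with exit z∈S x∈C (~-sym x~z)
      ... | inj₁ z∈C    = contradiction z∈C z∉C
      ... | inj₂ ≡.refl = ε

    rest-⊆ : ∀ {x} → x ∈ (S ─ C) - w → x ∈ S - w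
    rest-⊆ x∈ = x∈p∧x≢y⇒x∈p-y (p─q⊆p S C (p─q⊆p (S ─ C) ⁅ w ⁆ x∈)) (∈-⇒≢ x∈)

    -- A neighbour in `C` would draw the vertex of `D` into `C`, so `D` remains closed when `C` is
    -- put back.
    lift-component : ∀ {D} → IsComponent G ((S ─ C) - w) D → IsComponent G (S - w) D
    lift-component {D} D-comp@(nonempty , D⊆ , conn) = nonempty , (λ x∈D → rest-⊆ (D⊆ x∈D)) , λ x x∈D y → mk⇔
      (λ y∈D → Star.map (λ (p , q , r) → rest-⊆ p , rest-⊆ q , r) (Equivalence.to (conn x x∈D y) y∈D))
      (closed-walk D-closed x∈D)
      where
      D-closed : Closed (S - w) D
      D-closed {x} {y} x∈D y∈S-w x~y = component-closed D-comp x∈D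
        (x∈p∧x≢y⇒x∈p-y (x∈p∧x∉q⇒x∈p─q (p─q⊆p S ⁅ w ⁆ y∈S-w) y∉C) (∈-⇒≢ y∈S-w)) x~y
        where
        y∉C : y ∉ C
        y∉C y∈C = ∈─⇒∉ (p─q⊆p (S ─ C) ⁅ w ⁆ (D⊆ x∈D)) (closed y∈C (rest-⊆ (D⊆ x∈D)) (~-sym x~y))

    lift-odd : ∀ {D} → IsOddComponent G ((S ─ C) - w) D → IsOddComponent G (S - w) D
    lift-odd (D-comp , D-odd) = lift-component D-comp , D-odd

    ≢C : ∀ {D} → IsComponent G ((S ─ C) - w) D → D ≢ C
    ≢C ((x , x∈D) , D⊆ , _) ≡.refl = ∈─⇒∉ (p─q⊆p (S ─ C) ⁅ w ⁆ (D⊆ x∈D)) x∈D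

    odd-C⇒even-S : 2 ∤ ∣ C ∣ → 2 ∣ ∣ S ∣
    odd-C⇒even-S C-odd with 2 ∣? ∣ S ∣
    ... | yes 2∣∣S∣ = 2∣∣S∣
    ... | no  2∤∣S∣ = contradiction (comp , C-odd) (odd 2∤∣S∣ C)

    rest : Branching (S ─ C) w
    rest = record
      { root∈S   = x∈p∧x∉q⇒x∈p─q root∈S w∉C
      ; reach    = λ x∈ → cut-walk (inj₂ (x∈p∧x∉q⇒x∈p─q root∈S w∉C , ε)) (reach (p─q⊆p S C x∈)) (∈─⇒∉ x∈)
      ; odd      = rest-odd
      ; even     = rest-even
      ; branches = λ u′ u′∈ w~u′ D D-comp u′∈D → branches u′ (p─q⊆p S C u′∈) w~u′ D (lift-component D-comp) u′∈D
      }
      where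
      rest-odd : 2 ∤ ∣ S ─ C ∣ → ∀ D → ¬ IsOddComponent G ((S ─ C) - w) D
      rest-odd 2∤ D D-odd with 2 ∣? ∣ C ∣
      ... | yes 2∣∣C∣ = odd (≡.subst (2 ∤_) ∣S∣≡ (odd+even 2∤ 2∣∣C∣)) D (lift-odd D-odd)
      -- Here `S` is even, so `C` and `D` would both be its one odd component, although they are
      -- disjoint.
      ... | no  2∤∣C∣ = ≢C (proj₁ D-odd) (even (odd-C⇒even-S 2∤∣C∣) (lift-odd D-odd) (comp , 2∤∣C∣))
      rest-even : 2 ∣ ∣ S ─ C ∣ → ∀ {D E} →
        IsOddComponent G ((S ─ C) - w) D → IsOddComponent G ((S ─ C) - w) E → D ≡ E
      rest-even 2∣ D-odd E-odd with 2 ∣? ∣ C ∣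
      ... | yes 2∣∣C∣ = even (≡.subst (2 ∣_) ∣S∣≡ (∣m∣n⇒∣m+n 2∣ 2∣∣C∣)) (lift-odd D-odd) (lift-odd E-odd)
      ... | no  2∤∣C∣ = contradiction (odd-C⇒even-S 2∤∣C∣) (≡.subst (2 ∤_) ∣S∣≡ (even+odd 2∣ 2∤∣C∣))

    branching : Branching C u
    branching = NEB⇒branching (branches u u∈S w~u C comp u∈C)
      (λ {x} x∈C → restrict-walk closed u∈C (Equivalence.to (proj₂ (proj₂ comp) u u∈C x) x∈C))

  Spans : Tree n → Set
  Spans (leaf v)   = ⊤
  Spans (join s t) = Spans s × Spans t × Disjoint s t × root s ~ root t ×
    (∀ {x y} → x ∈ᵗ s → y ∈ᵗ t → x ~ y → x ≡ root s × y ≡ root t)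

  record Decomposition (S : Subset n) (w : Fin n) : Set where
    field
      tree     : Tree n
      root≡    : root tree ≡ w
      ∈S⇒∈ᵗ    : ∀ {v} → v ∈ S → v ∈ᵗ tree
      ∈ᵗ⇒∈S    : ∀ {v} → v ∈ᵗ tree → v ∈ S
      spans    : Spans tree
      parity   : Parity
      pairs    : ℕ
      balanced : Balanced tree parity pairs
      order≡   : ∣ S ∣ ≡ order parity pairs

  module _ (acyclic : ∀ c → ¬ IsCycle G c) where
    private
      singleton : ∀ {S w} → Branching S w → (∀ {u} → u ∈ S → ¬ (w ~ u)) → Decomposition S w
      singleton {S} {w} B isolated = record
        { tree     = leaf w
        ; root≡    = ≡.refl
        ; ∈S⇒∈ᵗ    = ≡w
        ; ∈ᵗ⇒∈S    = λ { ≡.refl → root∈S }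
        ; spans    = tt
        ; parity   = 1ℙ
        ; pairs    = 0
        ; balanced = leaf
        ; order≡   = ≡.trans (≡.cong ∣_∣ (⊆-antisym
            (λ x∈S → ≡.subst (_∈ ⁅ w ⁆) (≡.sym (≡w x∈S)) (x∈⁅x⁆ w))
            (λ x∈ → ≡.subst (_∈ S) (≡.sym (x∈⁅y⁆⇒x≡y w x∈)) root∈S))) (∣⁅x⁆∣≡1 w)
        }
        where
        open Branching B
        ≡w : ∀ {x} → x ∈ S → x ≡ w
        ≡w x∈S with reach x∈S
        ... | ε                    = ≡.refl
        ... | (_ , y∈S , w~y) ◅ _ = contradiction w~y (isolated y∈S)

      module Attach {S w} (B : Branching S w) {u C} (u∈S : u ∈ S) (w~u : w ~ u)
        (comp : IsComponent G (S - w) C) (u∈C : u ∈ C)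
        (dS : Decomposition (S ─ C) w) (dC : Decomposition C u) where
        open Detach B u∈S w~u comp u∈C
        private
          module DS = Decomposition dS
          module DC = Decomposition dC

        combine : ∀ {p k q l} → Balanced DS.tree p k → ∣ S ─ C ∣ ≡ order p k → Balanced DC.tree q l →
          ∣ C ∣ ≡ order q l → ∃₂ λ r m → Balanced (join DS.tree DC.tree) r m × ∣ S ∣ ≡ order r m
        combine {1ℙ} {k} {1ℙ} {l} bS ∣S─C∣ bC ∣C∣ = 0ℙ , k ℕ.+ l , odd-odd bS bC ,
          ≡.trans (≡.sym ∣S∣≡) (≡.trans (≡.cong₂ ℕ._+_ ∣S─C∣ ∣C∣)
            (solve 2 (λ k l → con 1 :+ k :* con 2 :+ (con 1 :+ l :* con 2) := con 2 :+ (k :+ l) :* con 2) ≡.refl k l))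
          where open +-*-Solver
        combine {1ℙ} {k} {0ℙ} {l} bS ∣S─C∣ bC ∣C∣ = 1ℙ , k ℕ.+ suc l , odd-even bS bC ,
          ≡.trans (≡.sym ∣S∣≡) (≡.trans (≡.cong₂ ℕ._+_ ∣S─C∣ ∣C∣)
            (solve 2 (λ k l → con 1 :+ k :* con 2 :+ (con 2 :+ l :* con 2) := con 1 :+ (k :+ (con 1 :+ l)) :* con 2) ≡.refl k l))
          where open +-*-Solver
        combine {0ℙ} {k} {0ℙ} {l} bS ∣S─C∣ bC ∣C∣ = 0ℙ , k ℕ.+ suc l , even-even bS bC ,
          ≡.trans (≡.sym ∣S∣≡) (≡.trans (≡.cong₂ ℕ._+_ ∣S─C∣ ∣C∣)
            (solve 2 (λ k l → con 2 :+ k :* con 2 :+ (con 2 :+ l :* con 2) := con 2 :+ (k :+ (con 1 :+ l)) :* con 2) ≡.refl k l))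
          where open +-*-Solver
        -- The combination without a constructor: an odd branch forces `S` to be even, but an even
        -- rest and an odd branch have odd total order.
        combine {0ℙ} {k} {1ℙ} {l} bS ∣S─C∣ bC ∣C∣ = contradiction
          (odd-C⇒even-S (≡.subst (2 ∤_) (≡.sym ∣C∣) (order-odd l)))
          (≡.subst (2 ∤_) (≡.trans (≡.cong₂ ℕ._+_ (≡.sym ∣S─C∣) (≡.sym ∣C∣)) ∣S∣≡)
            (even+odd (order-even k) (order-odd l)))

        attach : Decomposition S w
        attach with combine DS.balanced DS.order≡ DC.balanced DC.order≡
        ... | r , m , b , ∣S∣≡order = record
          { tree     = join DS.tree DC.tree
          ; root≡    = DS.root≡
          ; ∈S⇒∈ᵗ    = ∈S⇒
          ; ∈ᵗ⇒∈S    = [ (λ v∈ → p─q⊆p S C (DS.∈ᵗ⇒∈S v∈)) , (λ v∈ → C⊆S (DC.∈ᵗ⇒∈S v∈)) ]′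
          ; spans    = DS.spans , DC.spans ,
              (λ v∈ v∈′ → ∈─⇒∉ (DS.∈ᵗ⇒∈S v∈) (DC.∈ᵗ⇒∈S v∈′)) ,
              ≡.subst₂ _~_ (≡.sym DS.root≡) (≡.sym DC.root≡) w~u ,
              λ x∈ y∈ x~y → only-edge (DS.∈ᵗ⇒∈S x∈) (DC.∈ᵗ⇒∈S y∈) x~y
          ; parity   = r
          ; pairs    = m
          ; balanced = b
          ; order≡   = ∣S∣≡order
          }
          where
          ∈S⇒ : ∀ {v} → v ∈ S → v ∈ᵗ join DS.tree DC.tree
          ∈S⇒ {v} v∈S with v ∈? C
          ... | yes v∈C = inj₂ (DC.∈S⇒∈ᵗ v∈C)
          ... | no  v∉C = inj₁ (DS.∈S⇒∈ᵗ (x∈p∧x∉q⇒x∈p─q v∈S v∉C))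
          only-edge : ∀ {x y} → x ∈ S ─ C → y ∈ C → x ~ y → x ≡ root DS.tree × y ≡ root DC.tree
          only-edge {x} {y} x∈ y∈C x~y with branch-rest x∈ y∈C x~y
          -- One end is `w` because `C` is closed in `S - w`; the other is `u` because a second
          -- neighbour of `w` in `C` would close a cycle.
          ... | ≡.refl = ≡.sym DS.root≡ , ≡.trans (≡.sym (unique-neighbour acyclic
                  (λ w∈S-w → ∈-⇒≢ w∈S-w ≡.refl) w~u x~y (C⊆S-w y∈C)
                  (Equivalence.to (proj₂ (proj₂ comp) u u∈C y) y∈C))) (≡.sym DC.root≡)

    -- `fuel` bounds the order: `S ─ C` misses `u` and `C` misses `w`, so both are smaller than `S`,
    -- though not structurally.
    decompose : ∀ fuel {S w} → ∣ S ∣ ℕ.≤ fuel → Branching S w → Decomposition S w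
    decompose zero ∣S∣≤0 B =
      contradiction (∈⇒∣∣>0 (Branching.root∈S B)) (ℕ.≤⇒≯ ∣S∣≤0)
    decompose (suc fuel) {S} {w} ∣S∣≤ B with Fin.any? (λ u → (u ∈? S) ×-dec (w ~? u))
    ... | no isolated = singleton B (λ u∈S w~u → isolated (_ , u∈S , w~u))
    ... | yes (u , u∈S , w~u) with component (S - w) u (x∈p∧x≢y⇒x∈p-y u∈S (λ { ≡.refl → ~-irrefl ≡.refl w~u }))
    ...   | C , comp , u∈C = Attach.attach B u∈S w~u comp u∈C
      (decompose fuel (ℕ.≤-pred (ℕ.<-≤-trans smaller-rest ∣S∣≤)) rest)
      (decompose fuel (ℕ.≤-pred (ℕ.<-≤-trans smaller-C ∣S∣≤)) branching)
      where
      open Detach B u∈S w~u comp u∈C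
      smaller-rest : ∣ S ─ C ∣ ℕ.< ∣ S ∣
      smaller-rest = ≡.subst (∣ S ─ C ∣ ℕ.<_) ∣S∣≡ (ℕ.m<m+n ∣ S ─ C ∣ (∈⇒∣∣>0 u∈C))
      smaller-C : ∣ C ∣ ℕ.< ∣ S ∣
      smaller-C = ≡.subst (∣ C ∣ ℕ.<_) ∣S∣≡ (ℕ.m<n+m ∣ C ∣ (∈⇒∣∣>0 (Branching.root∈S rest)))

-- Total on ℕ, so that halves of the range and mirrored indices become plain arithmetic; `d` is
-- returned only beyond the end.
extend : ∀ {A : Set} {n} → A → (Fin n → A) → ℕ → A
extend {n = zero}  d a i       = d
extend {n = suc n} d a zero    = a zero
extend {n = suc n} d a (suc i) = extend d (a ∘ suc) i

extend-toℕ : ∀ {A : Set} {n} d (a : Fin n → A) j → extend d a (toℕ j) ≡ a j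
extend-toℕ d a zero    = ≡.refl
extend-toℕ d a (suc j) = extend-toℕ d (a ∘ suc) j

extend-fromℕ< : ∀ {A : Set} {n} d (a : Fin n → A) {i} (i<n : i ℕ.< n) → extend d a i ≡ a (fromℕ< i<n)
extend-fromℕ< d a i<n =
  ≡.trans (≡.cong (extend d a) (≡.sym (Fin.toℕ-fromℕ< i<n))) (extend-toℕ d a (fromℕ< i<n))

-- The graph of the matrix and the prescribed spectra.

module Assembly (𝓡 : CompleteOrderedField) where
  open Reals 𝓡
  open OrderedField 𝓡
  open ComplexField 𝓡
  open PartialFractions 𝓡
  open Evaluation ℂ-commutativeRing fromℝ fromℝ-homomorphism
  open Realisation 𝓡 ℂ-commutativeRing fromℝ fromℝ-homomorphism
  open WeightedMatrix 𝓡 ℂ-commutativeRing fromℝ fromℝ-homomorphism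
  open IntegerCoefficients commutativeRing
  private
    module C = CommutativeRing ℂ-commutativeRing

  opaque
    fromℝ-pos : ∀ {a} → 0# < a → ¬ (fromℝ a C.≈ C.0#)
    fromℝ-pos 0<a (a≈0 , _) = pos⇒≉0 0<a a≈0

  open Spectrum ℂ-*-zero fromℝ-pos

  module _ {n : ℕ} (G : Graph n) where
    open Graph G renaming (sym to ~-sym; irrefl to ~-irrefl)
    open TreeDecomposition G using (Spans)

    spans⇒simple : ∀ t → Spans t → Simple t
    spans⇒simple (leaf v)   _                             = _
    spans⇒simple (join s t) (spans-s , spans-t , disjoint , _) =
      spans⇒simple s spans-s , spans⇒simple t spans-t , disjoint

    private
      opaque
        only-third : ∀ {x y z} → x ≈ 0# → y ≈ 0# → x + y + z ≈ z
        only-third x≈0 y≈0 = trans (+-congʳ (trans (+-cong x≈0 y≈0) (+-identityˡ 0#))) (+-identityˡ _)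

        only-first : ∀ {x y z} → y ≈ 0# → z ≈ 0# → x + y + z ≈ x
        only-first y≈0 z≈0 = trans (+-cong (trans (+-congˡ y≈0) (+-identityʳ _)) z≈0) (+-identityʳ _)

        only-second : ∀ {x y z} → x ≈ 0# → z ≈ 0# → x + y + z ≈ y
        only-second x≈0 z≈0 = trans (+-cong (trans (+-congʳ x≈0) (+-identityˡ _)) z≈0) (+-identityʳ _)

        edge-columns : ∀ a {w u i j : Fin n} → u ≢ i → u ≢ j → edge a w u i j ≈ 0#
        edge-columns a {w} {u} {i} {j} u≢i u≢j = trans
          (*-congˡ (+-cong (*-congˡ (reflexive (δ-≢ u≢j))) (-‿cong (*-congʳ (reflexive (δ-≢ u≢i))))))
          (solve 3 (λ a p q → a :* (p :* :0 :- :0 :* q) := :0) refl a (δ w i) (δ w j))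

        edge-columns′ : ∀ a {w u i j : Fin n} → w ≢ i → w ≢ j → edge a w u i j ≈ 0#
        edge-columns′ a {w} {u} {i} {j} w≢i w≢j = trans
          (*-congˡ (+-cong (*-congʳ (reflexive (δ-≢ w≢i))) (-‿cong (*-congˡ (reflexive (δ-≢ w≢j))))))
          (solve 3 (λ a p q → a :* (:0 :* p :- q :* :0) := :0) refl a (δ u j) (δ u i))

        edge-at : ∀ a {w u : Fin n} → w ≢ u → edge a w u w u ≈ a
        edge-at a {w} {u} w≢u = trans
          (*-congˡ (+-cong (*-cong (reflexive (δ-refl w)) (reflexive (δ-refl u))) (-‿cong (*-congˡ (reflexive (δ-≢ w≢u))))))
          (solve 2 (λ a p → a :* (:1 :* :1 :- p :* :0) := a) refl a (δ u w))

      ⇔-resp : ∀ {P : Set} {x y} → x ≈ y → (P ⇔ (¬ (y ≈ 0#))) → (P ⇔ (¬ (x ≈ 0#)))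
      ⇔-resp x≈y P⇔ = mk⇔ (λ p x≈0 → Equivalence.to P⇔ p (trans (sym x≈y) x≈0))
                          (λ x≉0 → Equivalence.from P⇔ (λ y≈0 → x≉0 (trans x≈y y≈0)))

    opaque
      -- At vertices of the same part only the matrix of that part contributes, and across the parts
      -- only the edge, whose weight is positive.
      matrix-graph : ∀ t w → Spans t → ∀ {i j} → i ∈ᵗ t → j ∈ᵗ t → (i ~ j) ⇔ (¬ (matrix t w i j ≈ 0#))
      matrix-graph (leaf v) _ _ ≡.refl ≡.refl =
        mk⇔ (λ v~v → ⊥-elim (~-irrefl ≡.refl v~v)) (λ ¬0≈0 → ⊥-elim (¬0≈0 refl))
      matrix-graph (join s t) ((a , 0<a) , ws , wt) (spans-s , spans-t , disjoint , s~t , only-edge) = go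
        where
        cross : ∀ {i j} → i ∈ᵗ s → j ∈ᵗ t → (i ~ j) ⇔ (¬ (matrix (join s t) ((a , 0<a) , ws , wt) i j ≈ 0#))
        cross {i} {j} i∈s j∈t = ⇔-resp
          (only-third (matrix-column s ws i (λ j∈s → disjoint j∈s j∈t)) (matrix-row t wt j (disjoint i∈s)))
          (mk⇔ to from)
          where
          to : i ~ j → ¬ (edge a (root s) (root t) i j ≈ 0#)
          to i~j edge≈0 with only-edge i∈s j∈t i~j
          ... | ≡.refl , ≡.refl = pos⇒≉0 0<a (trans
                (sym (edge-at a (λ s≡t → ∉⇒root≢ t (disjoint (root∈ s)) (≡.sym s≡t)))) edge≈0)
          from : ¬ (edge a (root s) (root t) i j ≈ 0#) → i ~ j
          from edge≉0 with root s Fin.≟ i | root t Fin.≟ j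
          ... | yes ≡.refl | yes ≡.refl = s~t
          ... | no  s≢i    | _          = ⊥-elim (edge≉0 (edge-row a {root s} {root t} j s≢i (∉⇒root≢ t (disjoint i∈s))))
          ... | yes _      | no t≢j     = ⊥-elim (edge≉0 (edge-columns a {root s} (∉⇒root≢ t (disjoint i∈s)) t≢j))
        go : ∀ {i j} → i ∈ᵗ join s t → j ∈ᵗ join s t →
          (i ~ j) ⇔ (¬ (matrix (join s t) ((a , 0<a) , ws , wt) i j ≈ 0#))
        go {i} {j} (inj₁ i∈s) (inj₁ j∈s) = ⇔-resp
          (only-first (matrix-row t wt j (disjoint i∈s))
            (edge-columns a {root s} (∉⇒root≢ t (disjoint i∈s)) (∉⇒root≢ t (disjoint j∈s))))
          (matrix-graph s ws spans-s i∈s j∈s)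
        go {i} {j} (inj₂ i∈t) (inj₂ j∈t) = ⇔-resp
          (only-second (matrix-row s ws j (λ i∈s → disjoint i∈s i∈t))
            (edge-columns′ a {root s} {root t} (∉⇒root≢ s (λ i∈s → disjoint i∈s i∈t)) (∉⇒root≢ s (λ j∈s → disjoint j∈s j∈t))))
          (matrix-graph t wt spans-t i∈t j∈t)
        go (inj₁ i∈s) (inj₂ j∈t) = cross i∈s j∈t
        go {i} {j} (inj₂ i∈t) (inj₁ j∈s) = mk⇔
          (λ i~j Aij≈0 → Equivalence.to (cross j∈s i∈t) (~-sym i~j)
            (trans (matrix-skew (join s t) ((a , 0<a) , ws , wt) j i) (trans (-‿cong Aij≈0) (solve 0 (:- :0 := :0) refl))))
          (λ Aij≉0 → ~-sym (Equivalence.from (cross j∈s i∈t) (λ Aji≈0 → Aij≉0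
            (trans (matrix-skew (join s t) ((a , 0<a) , ws , wt) i j) (trans (-‿cong Aji≈0) (solve 0 (:- :0 := :0) refl))))))

  extend-symmetric : ∀ {n} (a : Fin n → ℝ) → SymmetricAboutZero a → ∀ {i} → i ℕ.< n →
    extend 0# a i ≈ - extend 0# a (n ∸ suc i)
  extend-symmetric {n} a a-sym {i} i<n = trans (reflexive (extend-fromℕ< 0# a i<n))
    (trans (a-sym (fromℕ< i<n)) (-‿cong (reflexive
      (≡.trans (≡.sym (extend-toℕ 0# a (opposite (fromℕ< i<n)))) (≡.cong (extend 0# a)
        (≡.trans (Fin.opposite-prop (fromℕ< i<n)) (≡.cong (λ k → n ∸ suc k) (Fin.toℕ-fromℕ< i<n))))))))

  private
    opaque
      self-negative : ∀ {x} → x ≈ - x → x ≈ 0#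
      self-negative {x} x≈-x with compare 0# x
      ... | tri< 0<x _ _ = ⊥-elim (<-asym 0<x (<-respˡ-≈ (sym x≈-x) (pos-neg 0<x)))
      ... | tri≈ _ 0≈x _ = sym 0≈x
      ... | tri> _ _ x<0 = ⊥-elim (<-asym x<0 (pos-resp (sym x≈-x) (neg-pos x<0)))

      square-neg : ∀ x → (- x) * (- x) ≈ x * x
      square-neg = solve 1 (λ x → (:- x) :* (:- x) := x :* x) refl

  extend-middle : ∀ {n} (a : Fin n → ℝ) → SymmetricAboutZero a → ∀ {i} → i ℕ.< n → n ∸ suc i ≡ i →
    extend 0# a i ≈ 0#
  extend-middle a a-sym i<n middle = self-negative
    (trans (extend-symmetric a a-sym i<n) (-‿cong (reflexive (≡.cong (extend 0# a) middle))))

  opaque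
    𝕚* : ∀ x → 𝕚 C.* fromℝ x C.≈ 0# +i x
    𝕚* x = solve 1 (λ x → :0 :* x :+ :- (:1 :* :0) := :0) refl x , solve 1 (λ x → :0 :* :0 :+ :1 :* x := x) refl x

    𝕚*-injective : ∀ {x y} → 𝕚 C.* fromℝ x C.≈ 𝕚 C.* fromℝ y → x ≈ y
    𝕚*-injective {x} {y} eq = proj₂ (C.trans (C.sym (𝕚* x)) (C.trans eq (𝕚* y)))

    -- z² + x² = (z − i x) (z + i x)
    square-root-of-neg : ∀ z x → z C.* z C.+ fromℝ (x * x) C.≈ C.0# →
      z C.≈ 𝕚 C.* fromℝ x ⊎ z C.≈ 𝕚 C.* fromℝ (- x)
    square-root-of-neg (a +i b) x (p , q) with ℂ-*-zero (a +i (b - x)) (a +i (b + x))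
      (trans (solve 3 (λ a b x → a :* a :+ :- ((b :- x) :* (b :+ x)) := a :* a :+ :- (b :* b) :+ x :* x) refl a b x) p ,
       trans (solve 3 (λ a b x → a :* (b :+ x) :+ (b :- x) :* a := a :* b :+ b :* a :+ :0) refl a b x) q)
    ... | inj₁ (a≈0 , b-x≈0) = inj₁ (C.trans
            (a≈0 , trans (solve 2 (λ b x → b := b :- x :+ x) refl b x) (trans (+-congʳ b-x≈0) (+-identityˡ x)))
            (C.sym (𝕚* x)))
    ... | inj₂ (a≈0 , b+x≈0) = inj₂ (C.trans
            (a≈0 , trans (solve 2 (λ b x → b := b :+ x :- x) refl b x) (trans (+-congʳ b+x≈0) (+-identityˡ (- x))))
            (C.sym (𝕚* (- x))))

    𝕚*-square : ∀ {z} x → z C.≈ 𝕚 C.* fromℝ x → z C.* z C.+ fromℝ (x * x) C.≈ C.0#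
    𝕚*-square x z≈ = C.trans (C.+-congʳ (C.*-cong (C.trans z≈ (𝕚* x)) (C.trans z≈ (𝕚* x))))
      (solve 1 (λ x → :0 :* :0 :+ :- (x :* x) :+ x :* x := :0) refl x ,
       solve 1 (λ x → :0 :* x :+ x :* :0 :+ :0 := :0) refl x)

  -- z = ± i aⱼ for some index j with h ≤ j < N.
  RootAmong : (ℕ → ℝ) → ℕ → ℕ → ℂ → Set
  RootAmong a h N z = ∃ λ j → h ℕ.≤ j × j ℕ.< N × z C.* z C.+ fromℝ (a j * a j) C.≈ C.0#

  -- The factor `z² + aⱼ²` accounts for `aⱼ` and its mirror image `- aⱼ`. The indices from `h` on
  -- suffice because `h + h ≤ N` places the mirror of every index below `h` at or above `h`.
  symmetric-roots : ∀ {N} (a : Fin N → ℝ) → SymmetricAboutZero a → ∀ h → h ℕ.+ h ℕ.≤ N → ∀ z →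
    RootAmong (extend 0# a) h N z ⇔ (∃ λ j → z C.≈ 𝕚 C.* fromℝ (a j))
  symmetric-roots {N} a a-sym h 2h≤N z = mk⇔ to from
    where
    to : RootAmong (extend 0# a) h N z → ∃ λ j → z C.≈ 𝕚 C.* fromℝ (a j)
    to (j , _ , j<N , root) with square-root-of-neg z (extend 0# a j) root
    ... | inj₁ z≈ = fromℕ< j<N , C.trans z≈ (C.*-congˡ (reflexive (extend-fromℕ< 0# a j<N) , refl))
    ... | inj₂ z≈ = opposite (fromℕ< j<N) , C.trans z≈ (C.*-congˡ
      (trans (-‿cong (trans (reflexive (extend-fromℕ< 0# a j<N)) (a-sym (fromℕ< j<N))))
        (solve 1 (λ x → :- (:- x) := x) refl (a (opposite (fromℕ< j<N)))) , refl))
    from : (∃ λ j → z C.≈ 𝕚 C.* fromℝ (a j)) → RootAmong (extend 0# a) h N z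
    from (j , z≈) with h ℕ.≤? toℕ j
    ... | yes h≤j = toℕ j , h≤j , Fin.toℕ<n j ,
      𝕚*-square (extend 0# a (toℕ j)) (C.trans z≈ (C.*-congˡ (reflexive (≡.sym (extend-toℕ 0# a j)) , refl)))
    ... | no  h≰j = N ∸ suc (toℕ j) , h≤ , ℕ.∸-monoʳ-< (s≤s z≤n) (Fin.toℕ<n j) ,
      C.trans (C.+-congˡ (trans (sym (square-neg _)) (sym (*-cong flip flip)) , refl))
        (𝕚*-square (extend 0# a (toℕ j)) (C.trans z≈ (C.*-congˡ (reflexive (≡.sym (extend-toℕ 0# a j)) , refl))))
      where
      flip : extend 0# a (toℕ j) ≈ - extend 0# a (N ∸ suc (toℕ j))
      flip = extend-symmetric a a-sym (Fin.toℕ<n j)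
      h≤ : h ℕ.≤ N ∸ suc (toℕ j)
      h≤ = ℕ.≤-trans (ℕ.≤-trans (ℕ.≤-reflexive (≡.sym (ℕ.m+n∸n≡m h h))) (ℕ.∸-monoˡ-≤ h 2h≤N))
             (ℕ.∸-monoʳ-≤ N (ℕ.≰⇒> h≰j))

  m+m≡m*2 : ∀ m → m ℕ.+ m ≡ m ℕ.* 2
  m+m≡m*2 m = ≡.sym (≡.trans (ℕ.*-comm m 2) (≡.cong (m ℕ.+_) (ℕ.+-identityʳ m)))

  opaque
    nonneg-squares-< : ∀ {x y} → 0# ≤ʳ x → x < y → x * x < y * y
    nonneg-squares-< {x} {y} 0≤x x<y = diff-pos⇒<
      (pos-resp (solve 2 (λ x y → (y :- x) :* (x :+ y) := y :* y :- x :* x) refl x y)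
        (*-positive (<⇒diff-pos x<y) (x+y 0≤x)))
      where
      0<y : 0# < y
      0<y = ≤-<-trans 0≤x x<y
      x+y : 0# ≤ʳ x → 0# < x + y
      x+y (inj₁ 0<x) = +-pos 0<x 0<y
      x+y (inj₂ 0≈x) = pos-resp (trans (sym (+-identityˡ y)) (+-congʳ 0≈x)) 0<y

  prepend-root : ∀ (a : ℕ → ℝ) {h N z p q} → h ℕ.< N →
    (p C.≈ C.0#) ⇔ (z C.* z C.+ fromℝ (a h * a h) C.≈ C.0#) →
    (q C.≈ C.0#) ⇔ RootAmong a (suc h) N z → (p C.* q C.≈ C.0#) ⇔ RootAmong a h N z
  prepend-root a {h} {N} {z} {p} {q} h<N p-root q-roots = mk⇔ to from
    where
    to : p C.* q C.≈ C.0# → RootAmong a h N z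
    to pq≈0 with ℂ-*-zero p q pq≈0
    ... | inj₁ p≈0 = h , ℕ.≤-refl , h<N , Equivalence.to p-root p≈0
    ... | inj₂ q≈0 with Equivalence.to q-roots q≈0
    ...   | j , h<j , rest = j , ℕ.<⇒≤ h<j , rest
    from : RootAmong a h N z → p C.* q C.≈ C.0#
    from (j , h≤j , j<N , root) with ℕ.m≤n⇒m<n∨m≡n h≤j
    ... | inj₂ ≡.refl = C.trans (C.*-congʳ (Equivalence.from p-root root)) (C.zeroˡ q)
    ... | inj₁ h<j    = C.trans (C.*-congˡ (Equivalence.from q-roots (j , h<j , j<N , root))) (C.zeroʳ p)

  -- Lets the bare factor `z` play the part of `z² + aⱼ²` at the middle index, where `aⱼ` is 0.
  zero-root : ∀ {x} → x ≈ 0# → ∀ z → (z C.≈ C.0#) ⇔ (z C.* z C.+ fromℝ (x * x) C.≈ C.0#)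
  zero-root {x} x≈0 z = mk⇔
    (λ z≈0 → C.trans (C.+-cong (C.trans (C.*-congʳ z≈0) (C.zeroˡ z)) x²≈0) (C.+-identityˡ C.0#))
    (λ root → [ (λ z≈0 → z≈0) , (λ z≈0 → z≈0) ]′
      (ℂ-*-zero z z (C.trans (C.sym (C.trans (C.+-congˡ x²≈0) (C.+-identityʳ _))) root)))
    where
    x²≈0 : fromℝ (x * x) C.≈ C.0#
    x²≈0 = trans (*-congʳ x≈0) (zeroˡ x) , refl

  no-roots : ∀ (a : ℕ → ℝ) h z → (C.1# C.≈ C.0#) ⇔ RootAmong a h h z
  no-roots a h z = mk⇔ (λ 1≈0 → ⊥-elim (fromℝ-pos 0<1 1≈0))
    (λ (j , h≤j , j<h , _) → ⊥-elim (ℕ.<⇒≱ j<h h≤j))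

  module SquaredInterlacing {m : ℕ} (L U : ℕ → ℝ)
    (L<U : ∀ {i} → i ℕ.< m → L i < U i) (U<L : ∀ {i} → i ℕ.< m → U i < L (suc i)) where

    <m : ∀ {c i} → i ℕ.+ suc c ≡ m → i ℕ.< m
    <m {c} {i} i+1+c≡m = ℕ.<-≤-trans (ℕ.m<m+n i (s≤s z≤n)) (ℕ.≤-reflexive i+1+c≡m)

    -- Squaring preserves order only on the nonnegative half, hence the start at an index with
    -- `0 ≤ L i`. The `μ²` become the lower nodes, zeros for `rootMinor`, and each is paired with
    -- the next `λ²`, a zero for `charPoly`. `L i` itself stays outside the pairs and gets a factor
    -- of its own.
    squares : ∀ c i {lo} → i ℕ.+ c ≡ m → 0# ≤ʳ L i → lo ≤ʳ L i * L i → Interlaced lo c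
    squares zero    i i+c≡m 0≤Lᵢ lo≤ = []
    squares (suc c) i i+c≡m 0≤Lᵢ lo≤ = cons (U i * U i) (L (suc i) * L (suc i))
      (≤-<-trans lo≤ (nonneg-squares-< 0≤Lᵢ (L<U i<m)))
      (nonneg-squares-< (inj₁ 0<Uᵢ) (U<L i<m))
      (squares c (suc i) (≡.trans (≡.sym (ℕ.+-suc i c)) i+c≡m) (inj₁ (<-trans 0<Uᵢ (U<L i<m))) (inj₂ refl))
      where
      i<m : i ℕ.< m
      i<m = <m i+c≡m
      0<Uᵢ : 0# < U i
      0<Uᵢ = ≤-<-trans 0≤Lᵢ (L<U i<m)

    lower-roots : ∀ c i {lo} i+c≡m 0≤Lᵢ (lo≤ : lo ≤ʳ L i * L i) z →
      (lowerProduct (squares c i i+c≡m 0≤Lᵢ lo≤) (z C.* z) C.≈ C.0#) ⇔ RootAmong U i m z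
    lower-roots zero i i+c≡m _ _ z with ≡.trans (≡.sym (ℕ.+-identityʳ i)) i+c≡m
    ... | ≡.refl = no-roots U i z
    lower-roots (suc c) i i+c≡m _ _ z =
      prepend-root U (<m i+c≡m) (mk⇔ (λ root → root) (λ root → root)) (lower-roots c (suc i) _ _ _ z)

    upper-roots : ∀ c i {lo} i+c≡m 0≤Lᵢ (lo≤ : lo ≤ʳ L i * L i) z →
      (upperProduct (squares c i i+c≡m 0≤Lᵢ lo≤) (z C.* z) C.≈ C.0#) ⇔ RootAmong L (suc i) (suc m) z
    upper-roots zero i i+c≡m _ _ z with ≡.trans (≡.sym (ℕ.+-identityʳ i)) i+c≡m
    ... | ≡.refl = no-roots L (suc i) z
    upper-roots (suc c) i i+c≡m _ _ z =
      prepend-root L (s≤s (<m i+c≡m)) (mk⇔ (λ root → root) (λ root → root)) (upper-roots c (suc i) _ _ _ z)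

    increasing : ∀ {i j} → i ℕ.< j → j ℕ.≤ m → L i < L j
    increasing {i} {suc j} (s≤s i≤j) j<m with ℕ.m≤n⇒m<n∨m≡n i≤j
    ... | inj₂ ≡.refl = <-trans (L<U j<m) (U<L j<m)
    ... | inj₁ i<j    = <-trans (increasing i<j (ℕ.<⇒≤ j<m)) (<-trans (L<U j<m) (U<L j<m))

  module _ {m : ℕ} (T : Graph (suc m)) (isTree : IsTree T) {v : Fin (suc m)} (neb : NEB T v)
    (lam : Fin (suc m) → ℝ) (mu : Fin m → ℝ) (interlacing : Interlacing lam mu)
    (lam-sym : SymmetricAboutZero lam) (mu-sym : SymmetricAboutZero mu) where
    open TreeDecomposition T
    private
      L U : ℕ → ℝ
      L = extend 0# lam
      U = extend 0# mu

      L<U : ∀ {i} → i ℕ.< m → L i < U i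
      L<U i<m = ≡.subst₂ _<_
        (≡.trans (≡.sym (extend-toℕ 0# lam _)) (≡.cong L (≡.trans (Fin.toℕ-inject₁ _) (Fin.toℕ-fromℕ< i<m))))
        (≡.sym (extend-fromℕ< 0# mu i<m)) (proj₁ (interlacing (fromℕ< i<m)))

      U<L : ∀ {i} → i ℕ.< m → U i < L (suc i)
      U<L i<m = ≡.subst₂ _<_
        (≡.sym (extend-fromℕ< 0# mu i<m))
        (≡.trans (≡.sym (extend-toℕ 0# lam _)) (≡.cong (L ∘ suc) (Fin.toℕ-fromℕ< i<m)))
        (proj₂ (interlacing (fromℕ< i<m)))

      open SquaredInterlacing L U L<U U<L

      increasing-U : ∀ {i j} → i ℕ.< j → j ℕ.< m → U i < U j
      increasing-U {i} {suc j} (s≤s i≤j) 1+j<m with ℕ.m≤n⇒m<n∨m≡n i≤j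
      ... | inj₂ ≡.refl = <-trans (U<L (ℕ.<⇒≤ 1+j<m)) (L<U 1+j<m)
      ... | inj₁ i<j    = <-trans (U<L (ℕ.<-trans (s≤s i≤j) 1+j<m)) (<-trans (increasing (s≤s i<j) (ℕ.<⇒≤ 1+j<m)) (L<U 1+j<m))

      injective : ∀ {N} (a : Fin N → ℝ) → (∀ {i j} → i ℕ.< j → j ℕ.< N → extend 0# a i < extend 0# a j) →
        ∀ {i j} → 𝕚 C.* fromℝ (a i) C.≈ 𝕚 C.* fromℝ (a j) → i ≡ j
      injective a increasing {i} {j} eq = Fin.toℕ-injective (compareℕ (ℕ.<-cmp (toℕ i) (toℕ j)))
        where
        aᵢ≈aⱼ : extend 0# a (toℕ i) ≈ extend 0# a (toℕ j)
        aᵢ≈aⱼ = trans (reflexive (extend-toℕ 0# a i)) (trans (𝕚*-injective eq) (reflexive (≡.sym (extend-toℕ 0# a j))))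
        compareℕ : _ → toℕ i ≡ toℕ j
        compareℕ (tri< i<j _ _) = ⊥-elim (<-irrefl aᵢ≈aⱼ (increasing i<j (Fin.toℕ<n j)))
        compareℕ (tri≈ _ i≡j _) = i≡j
        compareℕ (tri> _ _ j<i) = ⊥-elim (<-irrefl (sym aᵢ≈aⱼ) (increasing j<i (Fin.toℕ<n i)))

      -- The source of nondegeneracy: a common zero of `rootMinor` and `charPoly` would be both an
      -- `i λⱼ` and an `i μₖ`.
      lam≉mu : ∀ j k → ¬ (lam j ≈ mu k)
      lam≉mu j k eq with toℕ j ℕ.≤? toℕ k
      ... | yes j≤k = <-irrefl Lⱼ≈Uₖ (Lⱼ<Uₖ (ℕ.m≤n⇒m<n∨m≡n j≤k))
        where
        Lⱼ≈Uₖ : L (toℕ j) ≈ U (toℕ k)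
        Lⱼ≈Uₖ = trans (reflexive (extend-toℕ 0# lam j)) (trans eq (reflexive (≡.sym (extend-toℕ 0# mu k))))
        Lⱼ<Uₖ : toℕ j ℕ.< toℕ k ⊎ toℕ j ≡ toℕ k → L (toℕ j) < U (toℕ k)
        Lⱼ<Uₖ (inj₁ j<k) = <-trans (increasing j<k (ℕ.<⇒≤ (Fin.toℕ<n k))) (L<U (Fin.toℕ<n k))
        Lⱼ<Uₖ (inj₂ j≡k) = ≡.subst (λ i → L i < U (toℕ k)) (≡.sym j≡k) (L<U (Fin.toℕ<n k))
      ... | no  j≰k = <-irrefl (sym Lⱼ≈Uₖ) (Uₖ<Lⱼ (ℕ.m≤n⇒m<n∨m≡n (ℕ.≰⇒> j≰k)))
        where
        Lⱼ≈Uₖ : L (toℕ j) ≈ U (toℕ k)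
        Lⱼ≈Uₖ = trans (reflexive (extend-toℕ 0# lam j)) (trans eq (reflexive (≡.sym (extend-toℕ 0# mu k))))
        Uₖ<Lⱼ : suc (toℕ k) ℕ.< toℕ j ⊎ suc (toℕ k) ≡ toℕ j → U (toℕ k) < L (toℕ j)
        Uₖ<Lⱼ (inj₁ k<j) = <-trans (U<L (Fin.toℕ<n k)) (increasing k<j (ℕ.≤-pred (Fin.toℕ<n j)))
        Uₖ<Lⱼ (inj₂ k≡j) = ≡.subst (λ i → U (toℕ k) < L i) k≡j (U<L (Fin.toℕ<n k))

      decomposition : Decomposition full v
      decomposition = decompose (proj₂ isTree) ∣ full {suc m} ∣ ℕ.≤-refl
        (NEB⇒branching neb (λ {x} _ → Star.map (λ v~x → ∈⊤ , ∈⊤ , v~x) (proj₁ isTree v x)))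

      HasRoots : (t : Tree (suc m)) → Weights t → Set
      HasRoots t w =
        (∀ z → (rootMinor t w z C.≈ C.0#) ⇔ (∃ λ k → z C.≈ 𝕚 C.* fromℝ (mu k))) ×
        (∀ z → (charPoly t w z C.≈ C.0#) ⇔ (∃ λ j → z C.≈ 𝕚 C.* fromℝ (lam j)))

      ≈0-resp : ∀ {x y} → x C.≈ y → (x C.≈ C.0#) ⇔ (y C.≈ C.0#)
      ≈0-resp x≈y = mk⇔ (C.trans (C.sym x≈y)) (C.trans x≈y)

      realise-roots : ∀ {t p} k → Balanced t p k → suc m ≡ order p k → ∃ (HasRoots t)
      -- Order `2k + 1`: the middle `λ`, of index `k`, is 0 and gives the factor `z` of `charPoly`;
      -- above it there are `k` pairs of a `μ` and a `λ`.
      realise-roots {t} {1ℙ} k balanced 1+m≡ = w ,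
        (λ z → symmetric-roots mu mu-sym k (ℕ.≤-reflexive k+k≡m) z ⇔-∘
          (lower-roots k k k+k≡m _ _ z ⇔-∘ ≈0-resp (proj₁ (eqs z)))) ,
        (λ z → symmetric-roots lam lam-sym k (ℕ.≤-trans (ℕ.≤-reflexive k+k≡m) (ℕ.n≤1+n m)) z ⇔-∘
          (prepend-root L (s≤s k≤m) (zero-root Lₖ≈0 z) (upper-roots k k k+k≡m _ _ z) ⇔-∘ ≈0-resp (proj₂ (eqs z))))
        where
        k+k≡m : k ℕ.+ k ≡ m
        k+k≡m = ≡.trans (m+m≡m*2 k) (≡.sym (ℕ.suc-injective 1+m≡))
        k≤m : k ℕ.≤ m
        k≤m = ≡.subst (k ℕ.≤_) k+k≡m (ℕ.m≤m+n k k)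
        Lₖ≈0 : L k ≈ 0#
        Lₖ≈0 = extend-middle lam lam-sym (s≤s k≤m)
          (≡.trans (≡.cong (_∸ k) (≡.sym k+k≡m)) (ℕ.m+n∸n≡m k k))
        I : Interlaced 0# k
        I = squares k k k+k≡m (inj₂ (sym Lₖ≈0)) (inj₂ (sym (trans (*-congʳ Lₖ≈0) (zeroˡ (L k)))))
        realisation : ∃ λ (w : Weights t) → ∀ z →
          rootMinor t w z C.≈ lowerProduct I (z C.* z) × charPoly t w z C.≈ z C.* upperProduct I (z C.* z)
        realisation = realise-odd balanced I
        w : Weights t
        w = proj₁ realisation
        eqs : ∀ z → rootMinor t w z C.≈ lowerProduct I (z C.* z) × charPoly t w z C.≈ z C.* upperProduct I (z C.* z)
        eqs = proj₂ realisation
      -- Order `2k + 2`: the middle `μ`, of index `k`, is 0 and gives the factor `z` of `rootMinor`.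
      -- The least positive `λ` has index `k + 1`; its square is the `d` of `realise-even`, and `k`
      -- pairs follow.
      realise-roots {t} {0ℙ} k balanced 1+m≡ = w ,
        (λ z → symmetric-roots mu mu-sym k (ℕ.≤-trans (ℕ.n≤1+n _) (ℕ.≤-reflexive 1+k+k≡m)) z ⇔-∘
          (prepend-root U k<m (zero-root Uₖ≈0 z) (lower-roots k (suc k) 1+k+k≡m _ _ z) ⇔-∘ ≈0-resp (proj₁ (eqs z)))) ,
        (λ z → symmetric-roots lam lam-sym (suc k)
            (ℕ.≤-trans (ℕ.≤-reflexive (ℕ.+-suc (suc k) k)) (s≤s (ℕ.≤-reflexive 1+k+k≡m))) z ⇔-∘
          (prepend-root L (s≤s k<m) (mk⇔ (λ root → root) (λ root → root)) (upper-roots k (suc k) 1+k+k≡m _ _ z) ⇔-∘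
            ≈0-resp (proj₂ (eqs z))))
        where
        1+k+k≡m : suc k ℕ.+ k ≡ m
        1+k+k≡m = ≡.trans (≡.cong suc (m+m≡m*2 k)) (≡.sym (ℕ.suc-injective 1+m≡))
        k<m : k ℕ.< m
        k<m = ≡.subst (k ℕ.<_) 1+k+k≡m (s≤s (ℕ.m≤m+n k k))
        Uₖ≈0 : U k ≈ 0#
        Uₖ≈0 = extend-middle mu mu-sym k<m
          (≡.trans (≡.cong (_∸ suc k) (≡.sym 1+k+k≡m)) (ℕ.m+n∸m≡n (suc k) k))
        0<L : 0# < L (suc k)
        0<L = <-respˡ-≈ Uₖ≈0 (U<L k<m)
        I : Interlaced (L (suc k) * L (suc k)) k
        I = squares k (suc k) 1+k+k≡m (inj₁ 0<L) (inj₂ refl)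
        realisation : ∃ λ (w : Weights t) → ∀ z →
          rootMinor t w z C.≈ z C.* lowerProduct I (z C.* z) ×
          charPoly t w z C.≈ (z C.* z C.+ fromℝ (L (suc k) * L (suc k))) C.* upperProduct I (z C.* z)
        realisation = realise-even balanced (*-positive 0<L 0<L) I
        w : Weights t
        w = proj₁ realisation
        eqs : ∀ z → rootMinor t w z C.≈ z C.* lowerProduct I (z C.* z) ×
          charPoly t w z C.≈ (z C.* z C.+ fromℝ (L (suc k) * L (suc k))) C.* upperProduct I (z C.* z)
        eqs = proj₂ realisation

      conclude : ∀ {t} → root t ≡ v → Spans t → Spanning t → ∃ (HasRoots t) →
        ∃ λ (A : Matrix (suc m)) → A ∈S⁻ T ×
          HasDistinctEigenvalues A (λ j → 𝕚 ℂR.* fromℝ (lam j)) ×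
          HasDistinctEigenvalues (delete A v) (λ k → 𝕚 ℂR.* fromℝ (mu k))
      conclude {t} ≡.refl spans spanning (w , f-roots , g-roots) = matrix t w ,
        (matrix-skew t w , λ i j _ → matrix-graph T t w spans (spanning i) (spanning j)) ,
        (injective lam (λ i<j j<n → increasing i<j (ℕ.≤-pred j<n)) ,
          λ z → g-roots z ⇔-∘ eigenvalue⇔ t w z simple spanning (nondegenerate z)) ,
        (injective mu increasing-U ,
          λ z → f-roots z ⇔-∘ delete-eigenvalue⇔ t w z simple spanning (nondegenerate z))
        where
        simple : Simple t
        simple = spans⇒simple T t spans
        nondegenerate : ∀ z → Nondegenerate t w z
        nondegenerate z (f≈0 , g≈0) with Equivalence.to (f-roots z) f≈0 | Equivalence.to (g-roots z) g≈0
        ... | k , z≈μ | j , z≈λ = lam≉mu j k (𝕚*-injective (C.trans (C.sym z≈λ) z≈μ))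

    realising-matrix : ∃ λ (A : Matrix (suc m)) → A ∈S⁻ T ×
      HasDistinctEigenvalues A (λ j → 𝕚 ℂR.* fromℝ (lam j)) ×
      HasDistinctEigenvalues (delete A v) (λ k → 𝕚 ℂR.* fromℝ (mu k))
    realising-matrix = conclude root≡ spans (λ u → ∈S⇒∈ᵗ ∈⊤)
      (realise-roots pairs balanced (≡.trans (≡.sym (∣⊤∣≡n (suc m))) order≡))
      where open Decomposition decomposition

theorem3p1 : (𝓡 : CompleteOrderedField) → let open Reals 𝓡 in
    (m : ℕ) → 2 ≤ suc m →
    (T : Graph (suc m)) → IsTree T →
    (lam : Fin (suc m) → ℝ) (mu : Fin m → ℝ) →
    Interlacing lam mu →
    SymmetricAboutZero lam →
    SymmetricAboutZero mu →
    (v : Fin (suc m)) → NEB T v →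
    ∃ λ (A : Matrix (suc m)) →
    A ∈S⁻ T ×
    HasDistinctEigenvalues A (λ j → 𝕚 ℂR.* fromℝ (lam j)) ×
    HasDistinctEigenvalues (delete A v) (λ k → 𝕚 ℂR.* fromℝ (mu k))
theorem3p1 𝓡 m _ T isTree lam mu interlacing lam-sym mu-sym v neb =
  Assembly.realising-matrix 𝓡 T isTree neb lam mu interlacing lam-sym mu-sym
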